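{- Let $\varepsilon>0$. There is $t_0(\varepsilon)$ such that for every integer $t\geq t_0(\varepsilon)$ there is a constant $C=C(\varepsilon,t)$ such that every graph $G$ with $n$ vertices and average degree $d(G)\geq(1+\varepsilon)s(t)$ contains a $K_t$-subdivision consisting of at most $C\log n$ vertices (i.e. $O_{\varepsilon,t}(\log n)$ vertices).
   Context: All graphs are finite and simple; $d(G)$ is the average degree and $\log$ is the natural logarithm. A subdivision of $K_t$ is a graph obtained from $K_t$ by replacing its edges by internally vertex-disjoint paths. $s(t)$ denotes the infimum of all real $c$ such that every graph with $d(G)\geq c$ contains a subgraph which is a $K_t$-subdivision. "$G$ contains a $K_t$-subdivision consisting of at most $N$ vertices" means $G$ has a subgraph with at most $N$ vertices which is a subdivision of $K_t$. -}

module Defs where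

open import Data.Nat as ℕ using (ℕ; zero; suc; _<ᵇ_)
open import Data.Bool using (Bool; true; false; if_then_else_)
open import Data.Fin using (Fin; toℕ) renaming (_<_ to _<ᶠ_)
open import Data.List using (List; []; _∷_; _++_; [_]; length; map; allFin)
open import Data.Nat.ListAction using (sum)
open import Data.List.Membership.Propositional using (_∈_; _∉_)
open import Data.List.Relation.Unary.Unique.Propositional using (Unique)
open import Data.Integer using (+_)
open import Data.Rational.Unnormalised using (ℚᵘ; mkℚᵘ; 0ℚᵘ) renaming (_≤_ to _≤ᵘ_; _<_ to _<ᵘ_; _*_ to _*ᵘ_)
open import Data.Product using (Σ; _×_; _,_; ∃; ∃-syntax)
open import Data.Unit using (⊤)
open import Data.Empty using (⊥)
open import Relation.Binary.PropositionalEquality using (_≡_; _≢_)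
open import Relation.Nullary using (¬_)
open import Function.Definitions using (Injective)

record Graph (n : ℕ) : Set where
  field
    adj   : Fin n → Fin n → Bool
    sym   : ∀ u v → adj u v ≡ adj v u
    irrefl : ∀ v → adj v v ≡ false
open Graph public

degree : ∀ {n} → Graph n → Fin n → ℕ
degree G v = sum (map (λ u → if adj G v u then 1 else 0) (allFin _))

degreeSum : ∀ {n} → Graph n → ℕ
degreeSum G = sum (map (degree G) (allFin _))

avgDeg : ∀ {n} → Graph n → ℚᵘ
avgDeg {zero}  G = 0ℚᵘ
avgDeg {suc m} G = mkℚᵘ (+ degreeSum G) m

Chain : ∀ {n} → Graph n → List (Fin n) → Set
Chain G []            = ⊤
Chain G (x ∷ [])      = ⊤
Chain G (x ∷ y ∷ r)   = (adj G x y ≡ true) × Chain G (y ∷ r)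

-- A K_t-subdivision in G: branch vertices f (injective), and for every pair
-- i < j a path  f i , P i j , f j  in G whose list of interior vertices P i j
-- has no repetitions, avoids all branch vertices, and is disjoint from the
-- interior of every other path (internally vertex-disjoint paths).
-- (P i j is irrelevant unless i < j.)
record Subdivision (t : ℕ) {n : ℕ} (G : Graph n) : Set where
  field
    branch   : Fin t → Fin n
    branchInj : Injective _≡_ _≡_ branch
    path     : Fin t → Fin t → List (Fin n)
    isPath   : ∀ i j → i <ᶠ j → Chain G (branch i ∷ path i j ++ [ branch j ])
    simple   : ∀ i j → i <ᶠ j → Unique (path i j)
    avoidsBranch : ∀ i j k v → i <ᶠ j → v ∈ path i j → v ≢ branch k
    disjoint : ∀ i j i' j' v → i <ᶠ j → i' <ᶠ j' → ¬ ((i ≡ i') × (j ≡ j')) →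
               v ∈ path i j → v ∉ path i' j'
open Subdivision public

sizeOf : ∀ {t n} {G : Graph n} → Subdivision t G → ℕ
sizeOf {t} S = t ℕ.+ sum (map (λ i → sum (map (λ j →
  if toℕ i <ᵇ toℕ j then length (path S i j) else 0) (allFin t))) (allFin t))

HasSubdivisionWithin : ∀ {n} → ℕ → Graph n → ℕ → Set
HasSubdivisionWithin t G N = Σ (Subdivision t G) λ S → sizeOf S ℕ.≤ N

-- c is in the set whose infimum is s(t): every graph with d(G) ≥ c
-- contains a K_t-subdivision
Forces : ℕ → ℚᵘ → Set
Forces t c = ∀ n (G : Graph n) → c ≤ᵘ avgDeg G → Subdivision t G

-- "x ≥ a · s(t)" for a > 0, where s(t) = inf { c | Forces t c } (an
-- upward-closed set).  Since a > 0 this holds iff every rational c with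
-- a·c > x lies in the set (c > x/a ≥ s(t)).
AtLeastTimesS : ℕ → ℚᵘ → ℚᵘ → Set
AtLeastTimesS t a x = ∀ (c : ℚᵘ) → x <ᵘ a *ᵘ c → Forces t c

{-# OPTIONS --safe #-}
-- Let d be the average degree of G.  A subgraph of bounded size and density close to d
-- contains a subdivision of K_t by definition of s(t), so it suffices to find either such
-- a subgraph or a subdivision made of O(log n)-long pieces.
--
-- If the density exceeds a large constant depending on t, repeated low-diameter
-- decompositions give t² disjoint connected sets U of logarithmic radius, all adjacent to
-- each of t common vertices.  Vertices of large degree are deleted: either few arcs are
-- lost or an auxiliary graph on them is so dense that the first case applies to it.
--
-- With bounded degree, t² rounds in the manner of Klein, Plotkin and Rao (pass to a slab of
-- BFS levels, let U consist of the levels above it) give disjoint connected sets U of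
-- logarithmic radius, each within bounded distance of every vertex of a remaining dense
-- core.  From t far apart vertices of the core one grows paths of bounded length to the
-- prescribed sets, one after another along geodesics.  A vertex has at most three
-- neighbours on a geodesic, so if the growth gets stuck in a bounded set, then this set has
-- lost at most 3t per vertex and either has density close to d, as s(t) is superlinear in
-- t, or can be removed from the core.  The bound s(t) = Ω(t²) comes from K_{r,r}.
module Submission where

open import Defs
open import Data.Bool using (Bool; true; false; if_then_else_; _∧_; _∨_; _xor_; not)
open import Data.Bool.Properties using (∧-comm; ∧-identityʳ; ∧-zeroʳ; ∨-comm; xor-comm; xor-same)
open import Data.Empty using (⊥; ⊥-elim)
open import Data.Fin using (Fin; zero; suc; toℕ; fromℕ<; combine; remQuot; splitAt; _↑ˡ_; _↑ʳ_)
open import Data.Fin.Properties using (_≟_; any?; toℕ-injective; toℕ<n; toℕ-fromℕ<; toℕ-↑ˡ; toℕ-↑ʳ; splitAt-↑ˡ; splitAt-↑ʳ; join-splitAt; combine-injective; combine-remQuot; injective⇒≤)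
import Data.Integer as ℤ
open import Data.Integer using (+<+; +≤+)
open import Data.Integer.Properties using (pos-*)
open import Data.List using (List; []; _∷_; _++_; [_]; length; map; allFin; tabulate)
import Data.List.Membership.DecPropositional
open import Data.List.Membership.Propositional using (_∈_; _∉_)
open import Data.List.Membership.Propositional.Properties using (∈-map⁻)
open import Data.List.Properties using (map-++; length-tabulate)
open import Data.List.Relation.Unary.All as All using (All)
open import Data.List.Relation.Unary.All.Properties as AllP using (¬Any⇒All¬; All¬⇒¬Any)
import Data.List.Relation.Unary.AllPairs as AllPairs
open import Data.List.Relation.Unary.Any using (here; there)
open import Data.List.Relation.Unary.Unique.Propositional using (Unique)
import Data.List.Relation.Unary.Unique.Propositional.Properties as UniqueP
open import Data.Maybe using (Maybe; just; nothing; is-just; is-nothing)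
open import Data.Nat renaming (_≟_ to _≟ℕ_)
open import Data.Nat.DivMod using (m≡m%n+[m/n]*n; m%n<n)
open import Data.Nat.ListAction using (sum)
open import Data.Nat.Logarithm using (⌊log₂_⌋; ⌊log₂⌋-mono-≤; ⌊log₂[2^n]⌋≡n)
open import Data.Nat.Properties hiding (_≟_)
open import Data.Nat.Tactic.RingSolver using (solve)
open import Data.Product using (Σ; _×_; _,_; ∃-syntax; proj₁; proj₂)
open import Data.Rational.Unnormalised using (ℚᵘ; mkℚᵘ; 0ℚᵘ; 1ℚᵘ; *≤*; *<*) renaming (_<_ to _<ᵘ_; _≤_ to _≤ᵘ_; _+_ to _+ᵘ_; _*_ to _*ᵘ_)
open import Data.Sum as Sum using (_⊎_; inj₁; inj₂)
open import Data.Unit using (⊤; tt)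
open import Function using (_∘_; id; case_of_)
open import Relation.Binary.Definitions using (tri<; tri≈; tri>)
open import Relation.Binary.PropositionalEquality using (_≡_; _≢_; refl; trans; cong; cong₂; subst; subst₂) renaming (sym to symm)
open import Relation.Nullary using (¬_; Dec; yes; no)
open import Relation.Nullary.Decidable using (⌊_⌋)

-- The obstacle is the budget of density. Keeping a whole core adjacent to each set `U` costs a
-- factor of about 24 per round, which only a density above `threshold t (t * t)` can afford. For a
-- density just above s(t), all t² rounds together may lose only a factor close to 1. So the levels
-- next to `U` cannot be kept: a thin gap of levels is cut out, and the core is merely near `U`, at
-- a distance depending on ε and t. The walks from the core to the sets `U` may then meet each
-- other, both for different core vertices and for different sets. The actual paths are geodesics in
-- the part of the graph that is still free, and starting points far from each other keep the
-- systems of paths apart. Bounded degree is what makes bounded path systems cover only boundedly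
-- many vertices, so vertices of large degree have to go first.

-- Finite sums, Boolean sets and counting.

𝟙 : Bool → ℕ
𝟙 b = if b then 1 else 0

on : Bool → ℕ → ℕ
on b x = if b then x else 0

-- A certificate for linear arithmetic: the hypotheses, multiplied and added up, form `l ≤ r`, `k`
-- is the slack, and the remaining identity is one for the ring solver.
linear : ∀ {l r X Y} k → l ≤ r → X + r + k ≡ Y + l → X ≤ Y
linear {l} {r} {X} {Y} k l≤r eq = +-cancelʳ-≤ r X Y (≤-trans (≤-trans (m≤m+n (X + r) k) (≤-reflexive eq)) (+-monoʳ-≤ Y l≤r))

opaque
  ∑ : ∀ {n} → (Fin n → ℕ) → ℕ
  ∑ {zero}  f = 0
  ∑ {suc n} f = f zero + ∑ (f ∘ suc)

  ∑-mono : ∀ {n} {f g : Fin n → ℕ} → (∀ i → f i ≤ g i) → ∑ f ≤ ∑ g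
  ∑-mono {zero}  p = z≤n
  ∑-mono {suc n} p = +-mono-≤ (p zero) (∑-mono (p ∘ suc))

  ∑-cong : ∀ {n} {f g : Fin n → ℕ} → (∀ i → f i ≡ g i) → ∑ f ≡ ∑ g
  ∑-cong {zero}  p = refl
  ∑-cong {suc n} p = cong₂ _+_ (p zero) (∑-cong (p ∘ suc))

  ∑-+ : ∀ {n} (f g : Fin n → ℕ) → ∑ (λ i → f i + g i) ≡ ∑ f + ∑ g
  ∑-+ {zero}  f g = refl
  ∑-+ {suc n} f g rewrite ∑-+ (f ∘ suc) (g ∘ suc) = interchange (f zero) (g zero) (∑ (f ∘ suc)) (∑ (g ∘ suc))
    where
    interchange : ∀ a b c d → a + b + (c + d) ≡ a + c + (b + d)
    interchange a b c d = solve (a ∷ b ∷ c ∷ d ∷ [])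

  ∑-* : ∀ {n} c (f : Fin n → ℕ) → ∑ (λ i → c * f i) ≡ c * ∑ f
  ∑-* {zero}  c f = symm (*-zeroʳ c)
  ∑-* {suc n} c f rewrite ∑-* c (f ∘ suc) = symm (*-distribˡ-+ c (f zero) _)

  ∑-const : ∀ {n} c → ∑ {n} (λ _ → c) ≡ n * c
  ∑-const {zero}  c = refl
  ∑-const {suc n} c = cong (c +_) (∑-const {n} c)

  ∑-zero : ∀ {n} → ∑ {n} (λ _ → 0) ≡ 0
  ∑-zero {n} = trans (∑-const {n} 0) (*-zeroʳ n)

  ∑-swap : ∀ {m n} (f : Fin m → Fin n → ℕ) → ∑ (λ i → ∑ (f i)) ≡ ∑ (λ j → ∑ (λ i → f i j))
  ∑-swap {zero}  {n} f = symm (∑-zero {n})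
  ∑-swap {suc m} f rewrite ∑-swap (f ∘ suc) = symm (∑-+ (f zero) _)

  ∑-≥ : ∀ {n} (f : Fin n → ℕ) i → f i ≤ ∑ f
  ∑-≥ f zero    = m≤m+n _ _
  ∑-≥ f (suc i) = ≤-trans (∑-≥ (f ∘ suc) i) (m≤n+m _ (f zero))

  -- The averaging principle; with `f` the scaled sizes and `g` the scaled arc counts of a family of
  -- pieces it selects a dense piece.
  ∑-<⇒∃ : ∀ {n} (f g : Fin n → ℕ) → ∑ f < ∑ g → ∃[ i ] f i < g i
  ∑-<⇒∃ {suc n} f g lt with f zero <? g zero
  ... | yes p = zero , p
  ... | no ¬p with i , q ← ∑-<⇒∃ (f ∘ suc) (g ∘ suc) (+-cancelˡ-< (g zero) _ _ (≤-<-trans (+-monoˡ-≤ _ (≮⇒≥ ¬p)) lt)) = suc i , q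

  ∑-unique : ∀ {n} (P : Fin n → Bool) → (∀ i j → P i ≡ true → P j ≡ true → i ≡ j) → ∑ (λ i → 𝟙 (P i)) ≤ 1
  ∑-unique {zero}  P u = z≤n
  ∑-unique {suc n} P u with P zero in p0
  ... | false = ∑-unique (P ∘ suc) (λ i j p q → Data.Fin.Properties.suc-injective (u (suc i) (suc j) p q))
  ... | true = s≤s (≤-trans (∑-mono none) (≤-reflexive (∑-zero {n})))
    where
    none : ∀ i → 𝟙 (P (suc i)) ≤ 0
    none i with P (suc i) in p
    ... | false = z≤n
    ... | true with () ← u zero (suc i) p0 p

  ∑-pick : ∀ {n} (i : Fin n) (f : Fin n → ℕ) → ∑ (λ j → on ⌊ j ≟ i ⌋ (f j)) ≡ f i
  ∑-pick {suc n} zero f = trans (cong (f zero +_) (∑-zero {n})) (+-identityʳ _)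
  ∑-pick {suc n} (suc i) f = trans (∑-cong step) (∑-pick i (f ∘ suc))
    where
    step : ∀ j → on ⌊ suc j ≟ suc i ⌋ (f (suc j)) ≡ on ⌊ j ≟ i ⌋ (f (suc j))
    step j with j ≟ i
    ... | yes _ = refl
    ... | no _ = refl

∑-zero-≤ : ∀ {n c} → ∑ {n} (λ _ → 0) ≤ c
∑-zero-≤ {n} = ≤-trans (≤-reflexive (∑-zero {n})) z≤n

0<∑⇒∃ : ∀ {n} (f : Fin n → ℕ) → 0 < ∑ f → ∃[ i ] 0 < f i
0<∑⇒∃ {n} f lt = ∑-<⇒∃ (λ _ → 0) f (subst (_< ∑ f) (symm (∑-zero {n})) lt)

∑-≤-const : ∀ {n c} (f : Fin n → ℕ) → (∀ i → f i ≤ c) → ∑ f ≤ n * c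
∑-≤-const f p = ≤-trans (∑-mono p) (≤-reflexive (∑-const _))

# : ∀ {n} → (Fin n → Bool) → ℕ
# P = ∑ (λ v → 𝟙 (P v))

∑∑ : ∀ {n} → (Fin n → Fin n → ℕ) → ℕ
∑∑ w = ∑ (λ u → ∑ (w u))

∑∑-mono : ∀ {n} {f g : Fin n → Fin n → ℕ} → (∀ i j → f i j ≤ g i j) → ∑∑ f ≤ ∑∑ g
∑∑-mono p = ∑-mono (λ i → ∑-mono (p i))

∑∑-+ : ∀ {n} (f g : Fin n → Fin n → ℕ) → ∑∑ (λ i j → f i j + g i j) ≡ ∑∑ f + ∑∑ g
∑∑-+ f g = trans (∑-cong (λ i → ∑-+ (f i) (g i))) (∑-+ _ _)

∑∑-* : ∀ {n} c (f : Fin n → Fin n → ℕ) → ∑∑ (λ i j → c * f i j) ≡ c * ∑∑ f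
∑∑-* c f = trans (∑-cong (λ i → ∑-* c (f i))) (∑-* c _)

0<∑∑⇒∃ : ∀ {n} (f : Fin n → Fin n → ℕ) → 0 < ∑∑ f → ∃[ i ] ∃[ j ] 0 < f i j
0<∑∑⇒∃ f lt with i , p ← 0<∑⇒∃ _ lt = i , 0<∑⇒∃ _ p

∑-≥-const : ∀ {n} c (f : Fin n → ℕ) → (∀ i → c ≤ f i) → n * c ≤ ∑ f
∑-≥-const {n} c f p = ≤-trans (≤-reflexive (symm (∑-const {n} c))) (∑-mono p)

false≢true : false ≢ true
false≢true ()

∧⁺ : ∀ {a b} → a ≡ true → b ≡ true → a ∧ b ≡ true
∧⁺ refl refl = refl

∧⁻ˡ : ∀ {a b} → a ∧ b ≡ true → a ≡ true
∧⁻ˡ {true} _ = refl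

∧⁻ʳ : ∀ {a b} → a ∧ b ≡ true → b ≡ true
∧⁻ʳ {true} p = p

∨⁺ˡ : ∀ {a b} → a ≡ true → a ∨ b ≡ true
∨⁺ˡ refl = refl

∨⁺ʳ : ∀ {a b} → b ≡ true → a ∨ b ≡ true
∨⁺ʳ {false} p = p
∨⁺ʳ {true}  p = refl

∨⁻ : ∀ {a b} → a ∨ b ≡ true → a ≡ true ⊎ b ≡ true
∨⁻ {true}  p = inj₁ refl
∨⁻ {false} p = inj₂ p

swap-∨ : ∀ a b c d → (a ∧ b) ∨ (c ∧ d) ≡ (d ∧ c) ∨ (b ∧ a)
swap-∨ a b c d = trans (∨-comm (a ∧ b) (c ∧ d)) (cong₂ _∨_ (∧-comm c d) (∧-comm a b))

not⁺ : ∀ {a} → a ≢ true → not a ≡ true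
not⁺ {true}  p = ⊥-elim (p refl)
not⁺ {false} p = refl

not⁻ : ∀ {a} → not a ≡ true → a ≢ true
not⁻ {true} () _
not⁻ {false} _ ()

⌊⌋⁻ : ∀ {p} {P : Set p} {d : Dec P} → ⌊ d ⌋ ≡ true → P
⌊⌋⁻ {d = yes p} _ = p

⌊⌋⁺ : ∀ {p} {P : Set p} {d : Dec P} → P → ⌊ d ⌋ ≡ true
⌊⌋⁺ {d = yes p} _ = refl
⌊⌋⁺ {d = no ¬p} p = ⊥-elim (¬p p)

⇒𝟙≤ : ∀ {a b} → (a ≡ true → b ≡ true) → 𝟙 a ≤ 𝟙 b
⇒𝟙≤ {false} p = z≤n
⇒𝟙≤ {true}  p rewrite p refl = ≤-refl

0<𝟙 : ∀ {b} → 0 < 𝟙 b → b ≡ true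
0<𝟙 {true} _ = refl

0<on : ∀ {b x} → 0 < on b x → b ≡ true × 0 < x
0<on {true} p = refl , p

on-≤ : ∀ b {x} → on b x ≤ x
on-≤ true  = ≤-refl
on-≤ false = z≤n

0<factorʳ : ∀ β {e} → 0 < β * e → 0 < e
0<factorʳ β {zero} lt = ⊥-elim (<-irrefl (symm (*-zeroʳ β)) lt)
0<factorʳ β {suc e} _ = z<s

_∩_ _∖_ : ∀ {n} → (Fin n → Bool) → (Fin n → Bool) → Fin n → Bool
(P ∩ Q) v = P v ∧ Q v
(P ∖ Q) v = P v ∧ not (Q v)

In : ∀ {n} → (Fin n → Bool) → Fin n → Set
In P v = P v ≡ true

_⊆_ : ∀ {n} → (Fin n → Bool) → (Fin n → Bool) → Set
P ⊆ Q = ∀ v → P v ≡ true → Q v ≡ true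

#-mono : ∀ {n} {P Q : Fin n → Bool} → P ⊆ Q → # P ≤ # Q
#-mono p = ∑-mono (λ v → ⇒𝟙≤ (p v))

#-≤ : ∀ {n} (P : Fin n → Bool) → # P ≤ n
#-≤ {n} P = ≤-trans (∑-≤-const {c = 1} _ bound) (≤-reflexive (*-identityʳ n))
  where
  bound : ∀ i → 𝟙 (P i) ≤ 1
  bound i with P i
  ... | true = ≤-refl
  ... | false = z≤n

#-∖ : ∀ {n} {P Q : Fin n → Bool} → Q ⊆ P → # P ≡ # Q + # (P ∖ Q)
#-∖ {P = P} {Q} sub = trans (∑-cong split) (∑-+ _ _)
  where
  split : ∀ v → 𝟙 (P v) ≡ 𝟙 (Q v) + 𝟙 (P v ∧ not (Q v))
  split v with P v in p | Q v in q
  ... | true  | true  = refl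
  ... | true  | false = refl
  ... | false | false = refl
  ... | false | true with () ← trans (symm p) (sub v q)

#-<⇒∃ : ∀ {n} (P Q : Fin n → Bool) → # P < # Q → ∃[ v ] Q v ≡ true × P v ≢ true
#-<⇒∃ P Q lt with v , p ← ∑-<⇒∃ _ _ lt = v , outside (P v) (Q v) p
  where
  outside : ∀ a b → 𝟙 a < 𝟙 b → b ≡ true × a ≢ true
  outside false true _ = refl , λ ()
  outside true true (s≤s ())

∃⇒0<# : ∀ {n} {P : Fin n → Bool} v → P v ≡ true → 0 < # P
∃⇒0<# {P = P} v p = ≤-trans (≤-reflexive (symm (cong 𝟙 p))) (∑-≥ _ v)

some : ∀ {n} → (Fin n → Bool) → Bool
some P = ⌊ any? (λ u → P u Data.Bool.≟ true) ⌋

some⁺ : ∀ {n} {P : Fin n → Bool} u → P u ≡ true → some P ≡ true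
some⁺ u p = ⌊⌋⁺ (u , p)

some⁻ : ∀ {n} {P : Fin n → Bool} → some P ≡ true → ∃[ u ] P u ≡ true
some⁻ = ⌊⌋⁻

some-≤ : ∀ {n} (P : Fin n → Bool) → 𝟙 (some P) ≤ # P
some-≤ P with some P in eq
... | false = z≤n
... | true with u , p ← some⁻ eq = ∃⇒0<# u p

∑-≤-+ : ∀ {n} {f g h : Fin n → ℕ} → (∀ i → f i ≤ g i + h i) → ∑ f ≤ ∑ g + ∑ h
∑-≤-+ p = ≤-trans (∑-mono p) (≤-reflexive (∑-+ _ _))

∑-≤-+₃ : ∀ {n} {f g h k : Fin n → ℕ} → (∀ i → f i ≤ g i + h i + k i) → ∑ f ≤ ∑ g + ∑ h + ∑ k
∑-≤-+₃ {g = g} {h} {k} p = ≤-trans (∑-≤-+ p) (+-monoˡ-≤ (∑ k) (≤-reflexive (∑-+ g h)))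

-- Walks, balls, truncated distances and geodesics.

-- A walk with at most k edges, all of whose vertices, end points included, satisfy P.
data Walk {n} (h : Fin n → Fin n → Bool) (P : Fin n → Set) : ℕ → Fin n → Fin n → Set where
  stop : ∀ {k x} → P x → Walk h P k x x
  step : ∀ {k x y z} → P x → h x y ≡ true → Walk h P k y z → Walk h P (suc k) x z

Symmetric : ∀ {n} → (Fin n → Fin n → Bool) → Set
Symmetric h = ∀ u v → h u v ≡ true → h v u ≡ true

module _ {n : ℕ} {h : Fin n → Fin n → Bool} where

  weaken : ∀ {P k l x y} → k ≤ l → Walk h P k x y → Walk h P l x y
  weaken le (stop p) = stop p
  weaken (s≤s le) (step p e w) = step p e (weaken le w)

  mapʷ : ∀ {h' : Fin n → Fin n → Bool} {P P' : Fin n → Set} {k x y} → (∀ {u v} → h u v ≡ true → h' u v ≡ true) →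
         (∀ {v} → P v → P' v) → Walk h P k x y → Walk h' P' k x y
  mapʷ f g (stop p) = stop (g p)
  mapʷ f g (step p e w) = step (g p) (f e) (mapʷ f g w)

  startʷ : ∀ {P k x y} → Walk h P k x y → P x
  startʷ (stop p) = p
  startʷ (step p _ _) = p

  endʷ : ∀ {P k x y} → Walk h P k x y → P y
  endʷ (stop p) = p
  endʷ (step _ _ w) = endʷ w

  infixr 5 _++ʷ_
  _++ʷ_ : ∀ {P k l x y z} → Walk h P k x y → Walk h P l y z → Walk h P (k + l) x z
  _++ʷ_ {k = k} {l} (stop p) w' = weaken (m≤n+m l k) w'
  step p e w ++ʷ w' = step p e (w ++ʷ w')

  snocʷ : ∀ {P k x y z} → Walk h P k x y → h y z ≡ true → P z → Walk h P (suc k) x z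
  snocʷ {k = k} w e p = weaken (≤-reflexive (+-comm k 1)) (w ++ʷ step (endʷ w) e (stop {k = 0} p))

  reverseʷ : ∀ {P k x y} → Symmetric h → Walk h P k x y → Walk h P k y x
  reverseʷ s (stop p) = stop p
  reverseʷ s (step p e w) = snocʷ (reverseʷ s w) (s _ _ e) p

module BFS {n : ℕ} (h : Fin n → Fin n → Bool) (s : Fin n → Bool) where

  ball : ℕ → Fin n → Bool
  ball zero    v = s v
  ball (suc i) v = ball i v ∨ some (λ u → ball i u ∧ h u v)

  ball-edge : ∀ {i u v} → ball i u ≡ true → h u v ≡ true → ball (suc i) v ≡ true
  ball-edge {i} {u} {v} p e = ∨⁺ʳ {ball i v} (some⁺ u (∧⁺ p e))

  ball-mono : ∀ {i j} → i ≤ j → ball i ⊆ ball j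
  ball-mono i≤j v = go (≤⇒≤′ i≤j)
    where
    go : ∀ {i j} → i ≤′ j → ball i v ≡ true → ball j v ≡ true
    go ≤′-refl p = p
    go (≤′-step le) p = ∨⁺ˡ (go le p)

  walk-ball : ∀ {P i k x y} → ball i x ≡ true → Walk h P k x y → ball (i + k) y ≡ true
  walk-ball {i = i} {k} b (stop _) = ball-mono (m≤m+n i k) _ b
  walk-ball {i = i} {suc k} {y = y} b (step _ e w) = subst (λ j → ball j y ≡ true) (symm (+-suc i k)) (walk-ball {i = suc i} (ball-edge {i} b e) w)

  opaque
    -- The distance to s, truncated at N.
    lev : ℕ → Fin n → ℕ
    lev zero    v = 0
    lev (suc N) v = lev N v + 𝟙 (not (ball N v))

    lev-≤N : ∀ N v → lev N v ≤ N
    lev-≤N zero v = z≤n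
    lev-≤N (suc N) v with ball N v
    ... | true  = ≤-trans (≤-reflexive (+-identityʳ _)) (m≤n⇒m≤1+n (lev-≤N N v))
    ... | false = ≤-trans (≤-reflexive (+-comm _ 1)) (s≤s (lev-≤N N v))

    ball⇒lev : ∀ N {i v} → ball i v ≡ true → lev N v ≤ i
    ball⇒lev zero p = z≤n
    ball⇒lev (suc N) {i} {v} p with ball N v in eq
    ... | true  = ≤-trans (≤-reflexive (+-identityʳ _)) (ball⇒lev N p)
    ... | false with i ≤? N
    ...   | yes le with () ← trans (symm eq) (ball-mono le v p)
    ...   | no ¬le = ≤-trans (≤-trans (≤-reflexive (+-comm _ 1)) (s≤s (lev-≤N N v))) (≰⇒> ¬le)

    lev⇒ball : ∀ N {v} → lev N v < N → ball (lev N v) v ≡ true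
    lev⇒ball (suc N) {v} lt with ball N v in eq
    ... | false = ⊥-elim (false≢true (trans (symm eq) (ball-mono (<⇒≤ lt') v (lev⇒ball N lt'))))
      where
      lt' : lev N v < N
      lt' = s≤s⁻¹ (subst (_< suc N) (+-comm (lev N v) 1) lt)
    ... | true rewrite +-identityʳ (lev N v) with m≤n⇒m<n∨m≡n (s≤s⁻¹ lt)
    ...   | inj₁ lt' = lev⇒ball N lt'
    ...   | inj₂ eq' rewrite eq' = eq

  lev-step : ∀ N {u v} → h u v ≡ true → lev N v ≤ suc (lev N u)
  lev-step N {u} {v} e with lev N u <? N
  ... | yes lt = ball⇒lev N (ball-edge {lev N u} (lev⇒ball N lt) e)
  ... | no ¬lt = ≤-trans (lev-≤N N v) (m≤n⇒m≤1+n (≮⇒≥ ¬lt))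

  lev-walk : ∀ N {P k x y} → Walk h P k x y → lev N y ≤ lev N x + k
  lev-walk N (stop _) = m≤m+n _ _
  lev-walk N {k = suc k} {x} (step _ e w) = ≤-trans (lev-walk N w) (≤-trans (+-monoˡ-≤ k (lev-step N e)) (≤-reflexive (symm (+-suc _ k))))

  lev-source : ∀ N {v} → lev N v ≡ 0 → 0 < N → s v ≡ true
  lev-source N {v} eq lt = subst (λ i → ball i v ≡ true) eq (lev⇒ball N (subst (_< N) (symm eq) lt))

  source-lev : ∀ N {v} → s v ≡ true → lev N v ≡ 0
  source-lev N p = n≤0⇒n≡0 (ball⇒lev N p)

  lev-pred : ∀ N {v k} → lev N v ≡ suc k → suc k < N → ∃[ u ] h u v ≡ true × lev N u ≡ k
  lev-pred N {v} {k} eq lt with ∨⁻ (subst (λ i → ball i v ≡ true) eq (lev⇒ball N (subst (_< N) (symm eq) lt)))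
  ... | inj₁ p = ⊥-elim (1+n≰n (subst (_≤ k) eq (ball⇒lev N {k} p)))
  ... | inj₂ p with u , q ← some⁻ p = u , ∧⁻ʳ {ball k u} q , ≤-antisym (ball⇒lev N (∧⁻ˡ q)) (s≤s⁻¹ (subst (_≤ suc (lev N u)) eq (lev-step N (∧⁻ʳ {ball k u} q))))

  opaque
    -- The parent is fixed once for every vertex, so that a colouring can be pulled back along this
    -- map. At level 0 and at the truncation level `N` the value `x` is only a default.
    parent : ∀ N x → Σ (Fin n) λ p → ∀ k → lev N x ≡ suc k → suc k < N → h p x ≡ true × lev N p ≡ k
    parent N x with lev N x in eq
    ... | zero = x , λ k ()
    ... | suc k with suc k <? N
    ...   | yes lt = let u , e , l = lev-pred N eq lt in u , λ { .k refl _ → e , l }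
    ...   | no ¬lt = x , λ { .k refl lt → ⊥-elim (¬lt lt) }

  climb : ∀ N → Symmetric h → ∀ d j {v} → lev N v ≡ d + j → d + j < N →
          ∃[ u ] lev N u ≡ j × Walk h (λ x → j ≤ lev N x × lev N x ≤ d + j) d v u
  climb N sy zero j eq lt = _ , eq , stop (≤-reflexive (symm eq) , ≤-reflexive eq)
  climb N sy (suc d) j {v} eq lt with v' , e , eq' ← lev-pred N eq lt
    with u , equ , w ← climb N sy d j eq' (<-trans (n<1+n _) lt) =
    u , equ , step (≤-trans (m≤n+m j (suc d)) (≤-reflexive (symm eq)) , ≤-reflexive eq) (sy _ _ e)
      (mapʷ id (λ (a , b) → a , m≤n⇒m≤1+n b) w)

  -- The source, at level 0, is left out, because the paths of a fan share it and have to be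
  -- disjoint elsewhere.
  record Geodesic (N d : ℕ) (z : Fin n) : Set where
    field
      set    : Fin n → Bool
      first  : Fin n
      first₁ : lev N first ≡ 1
      walk   : Walk h (In set) d z first
      low    : ∀ {x} → set x ≡ true → 1 ≤ lev N x
      high   : ∀ {x} → set x ≡ true → lev N x ≤ suc d
      unique : ∀ {x y} → set x ≡ true → set y ≡ true → lev N x ≡ lev N y → x ≡ y
      size   : # set ≤ suc d

  #-single : ∀ (z : Fin n) → # (λ x → ⌊ x ≟ z ⌋) ≤ 1
  #-single z = ∑-unique _ (λ i j p q → trans (⌊⌋⁻ p) (symm (⌊⌋⁻ q)))

  geodesic : ∀ N → Symmetric h → ∀ d {z} → lev N z ≡ suc d → suc d < N → Geodesic N d z
  geodesic N sy zero {z} eq lt = record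
    { set = λ x → ⌊ x ≟ z ⌋ ; first = z ; first₁ = eq ; walk = stop (⌊⌋⁺ refl)
    ; low = λ p → ≤-reflexive (symm (trans (cong (lev N) (⌊⌋⁻ p)) eq))
    ; high = λ p → ≤-reflexive (trans (cong (lev N) (⌊⌋⁻ p)) eq)
    ; unique = λ p q _ → trans (⌊⌋⁻ p) (symm (⌊⌋⁻ q))
    ; size = #-single z }
  geodesic N sy (suc d) {z} eq lt with z' , e , eq' ← lev-pred N eq lt = record
    { set = set' ; first = first ; first₁ = first₁
    ; walk = step (∨⁺ˡ {⌊ z ≟ z ⌋} (⌊⌋⁺ refl)) (sy _ _ e) (mapʷ id (λ {v} → ∨⁺ʳ {⌊ v ≟ z ⌋}) walk)
    ; low = λ {x} p → case ∨⁻ {⌊ x ≟ z ⌋} p of λ { (inj₁ q) → ≤-trans (s≤s z≤n) (≤-reflexive (symm (at q))) ; (inj₂ q) → low q }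
    ; high = λ {x} p → case ∨⁻ {⌊ x ≟ z ⌋} p of λ { (inj₁ q) → ≤-reflexive (at q) ; (inj₂ q) → m≤n⇒m≤1+n (high q) }
    ; unique = λ {x} {y} p q → uniq {x} {y} (∨⁻ p) (∨⁻ q)
    ; size = ≤-trans (∑-≤-+ split) (+-mono-≤ (#-single z) size) }
    where
    open Geodesic (geodesic N sy d eq' (<-trans (n<1+n _) lt))
    set' : Fin n → Bool
    set' x = ⌊ x ≟ z ⌋ ∨ set x
    at : ∀ {x} → ⌊ x ≟ z ⌋ ≡ true → lev N x ≡ suc (suc d)
    at q = trans (cong (lev N) (⌊⌋⁻ q)) eq
    far : ∀ {x y} → ⌊ x ≟ z ⌋ ≡ true → set y ≡ true → lev N x ≢ lev N y
    far p q e = 1+n≰n (≤-trans (≤-reflexive (trans (symm (at p)) e)) (high q))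
    uniq : ∀ {x y} → ⌊ x ≟ z ⌋ ≡ true ⊎ set x ≡ true → ⌊ y ≟ z ⌋ ≡ true ⊎ set y ≡ true → lev N x ≡ lev N y → x ≡ y
    uniq (inj₁ p) (inj₁ q) e = trans (⌊⌋⁻ p) (symm (⌊⌋⁻ q))
    uniq (inj₁ p) (inj₂ q) e = ⊥-elim (far p q e)
    uniq (inj₂ p) (inj₁ q) e = ⊥-elim (far q p (symm e))
    uniq (inj₂ p) (inj₂ q) e = unique p q e
    split : ∀ x → 𝟙 (set' x) ≤ 𝟙 ⌊ x ≟ z ⌋ + 𝟙 (set x)
    split x with x ≟ z
    ... | yes _ = s≤s z≤n
    ... | no _ = ≤-refl

  -- The levels of adjacent vertices differ by at most one, and the geodesic has at most one vertex
  -- on each of the three possible levels. Truncation does no harm, since `lev-step` holds for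
  -- truncated levels.
  geodesic-degree : ∀ {N d z} (g : Geodesic N d z) → Symmetric h → ∀ w → ∑ (λ u → 𝟙 (Geodesic.set g u ∧ h w u)) ≤ 3
  geodesic-degree {N} g sy w = ≤-trans (∑-≤-+₃ bound)
      (+-mono-≤ (+-mono-≤ (one (λ u → ⌊ lev N u ≟ℕ lev N w ⌋) λ p q → trans (⌊⌋⁻ p) (symm (⌊⌋⁻ q)))
        (one (λ u → ⌊ lev N u ≟ℕ suc (lev N w) ⌋) λ p q → trans (⌊⌋⁻ p) (symm (⌊⌋⁻ q))))
        (one (λ u → ⌊ suc (lev N u) ≟ℕ lev N w ⌋) λ p q → suc-injective (trans (⌊⌋⁻ p) (symm (⌊⌋⁻ q)))))
    where
    open Geodesic g
    one : (Q : Fin n → Bool) → (∀ {x y} → Q x ≡ true → Q y ≡ true → lev N x ≡ lev N y) → # (set ∩ Q) ≤ 1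
    one Q same = ∑-unique (set ∩ Q) (λ i j p q → unique (∧⁻ˡ p) (∧⁻ˡ q) (same (∧⁻ʳ {set i} p) (∧⁻ʳ {set j} q)))
    bound : ∀ u → 𝟙 (set u ∧ h w u) ≤ 𝟙 ((set ∩ λ v → ⌊ lev N v ≟ℕ lev N w ⌋) u) + 𝟙 ((set ∩ λ v → ⌊ lev N v ≟ℕ suc (lev N w) ⌋) u)
                                       + 𝟙 ((set ∩ λ v → ⌊ suc (lev N v) ≟ℕ lev N w ⌋) u)
    bound u with set u | h w u in e
    ... | false | _ = z≤n
    ... | true | false = z≤n
    ... | true | true with lev N u ≟ℕ lev N w | lev N u ≟ℕ suc (lev N w) | suc (lev N u) ≟ℕ lev N w
    ...   | yes _ | _ | _ = s≤s z≤n
    ...   | no _ | yes _ | _ = s≤s z≤n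
    ...   | no _ | no _ | yes _ = s≤s z≤n
    ...   | no a | no b | no c with <-cmp (lev N u) (lev N w)
    ...     | tri< lt _ _ = ⊥-elim (c (≤-antisym lt (lev-step N (sy _ _ e))))
    ...     | tri≈ _ eq _ = ⊥-elim (a eq)
    ...     | tri> _ _ gt = ⊥-elim (b (≤-antisym (lev-step N e) gt))

  ball-size : ∀ Δ → (∀ u → ∑ (λ v → 𝟙 (h u v)) ≤ Δ) → ∀ i → # (ball i) ≤ suc Δ ^ i * # s
  ball-size Δ deg zero = ≤-reflexive (symm (+-identityʳ _))
  ball-size Δ deg (suc i) = ≤-trans grow (≤-trans (*-monoʳ-≤ (suc Δ) (ball-size Δ deg i)) (≤-reflexive (symm (*-assoc (suc Δ) (suc Δ ^ i) (# s)))))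
    where
    split : ∀ v → 𝟙 (ball (suc i) v) ≤ 𝟙 (ball i v) + ∑ (λ u → 𝟙 (ball i u ∧ h u v))
    split v with ball i v
    ... | true  = s≤s z≤n
    ... | false = some-≤ _
    row : ∀ u → ∑ (λ v → 𝟙 (ball i u ∧ h u v)) ≤ Δ * 𝟙 (ball i u)
    row u with ball i u
    ... | true  = ≤-trans (deg u) (≤-reflexive (symm (*-identityʳ Δ)))
    ... | false = ∑-zero-≤ {n}
    grow : # (ball (suc i)) ≤ suc Δ * # (ball i)
    grow = ≤-trans (∑-≤-+ split) (+-monoʳ-≤ (# (ball i)) (≤-trans (≤-reflexive (∑-swap (λ v u → 𝟙 (ball i u ∧ h u v))))
             (≤-trans (∑-mono row) (≤-reflexive (∑-* Δ _)))))

-- Low-diameter decompositions.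

-- A sequence with f (ρ+1) > (1 + 1/q) f ρ for q consecutive ρ at least doubles.
slow-step : ∀ q .{{_ : NonZero q}} L (f : ℕ → ℕ) → 1 ≤ f 1 → (∀ i → f i < 2 ^ L) →
            ∃[ ρ ] 1 ≤ ρ × ρ ≤ q * L + 1 × q * f (suc ρ) ≤ suc q * f ρ
slow-step q L f f1 f<2^L with loop L
  where
  Slow : ℕ → ℕ → Set
  Slow i j = ∃[ ρ ] i ≤ ρ × ρ ≤ j × q * f (suc ρ) ≤ suc q * f ρ
  arith : ∀ a b c k → (q + k) * a ≤ q * b → suc q * b < q * c → (q + suc k) * a ≤ q * c
  arith a b c k h₁ h₂ = *-cancelˡ-≤ q
    (linear (k * a + q) (+-mono-≤ (*-monoʳ-≤ (suc q) h₁) (*-monoʳ-≤ q h₂)) (ring a b c k))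
    where
    ring : ∀ a b c k → q * ((q + suc k) * a) + (suc q * (q * b) + q * (q * c)) + (k * a + q)
                       ≡ q * (q * c) + (suc q * ((q + k) * a) + q * suc (suc q * b))
    ring a b c k = solve (q ∷ a ∷ b ∷ c ∷ k ∷ [])
  -- Bernoulli's inequality instead of powers: the invariant is (1 + k/q) f i ≤ f (i + k), which at
  -- k = q is the doubling.
  block : ∀ i k → Slow i (i + k) ⊎ (q + k) * f i ≤ q * f (i + k)
  block i zero rewrite +-identityʳ i | +-identityʳ q = inj₂ ≤-refl
  block i (suc k) with block i k
  ... | inj₁ (ρ , a , b , c) = inj₁ (ρ , a , ≤-trans b (+-monoʳ-≤ i (n≤1+n k)) , c)
  ... | inj₂ h with q * f (suc (i + k)) ≤? suc q * f (i + k)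
  ...   | yes p = inj₁ (i + k , m≤m+n i k , +-monoʳ-≤ i (n≤1+n k) , p)
  ...   | no ¬p rewrite +-suc i k = inj₂ (arith (f i) (f (i + k)) (f (suc (i + k))) k h (≰⇒> ¬p))
  loop : ∀ j → Slow 1 (q * j + 1) ⊎ 2 ^ j ≤ f (q * j + 1)
  loop zero rewrite *-zeroʳ q = inj₂ f1
  loop (suc j) with loop j
  ... | inj₁ (ρ , a , b , c) = inj₁ (ρ , a , ≤-trans b (+-monoˡ-≤ 1 (*-monoʳ-≤ q (n≤1+n j))) , c)
  ... | inj₂ h with block (q * j + 1) q | next q j
    where
    next : ∀ q j → q * j + 1 + q ≡ q * suc j + 1
    next q j = solve (q ∷ j ∷ [])
  ...   | inj₁ (ρ , a , b , c) | eq = inj₁ (ρ , ≤-trans (m≤n+m 1 (q * j)) a , ≤-trans b (≤-reflexive eq) , c)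
  ...   | inj₂ h' | eq = inj₂ (*-cancelˡ-≤ q (≤-trans (≤-trans (*-monoʳ-≤ q (*-monoʳ-≤ 2 h)) (≤-reflexive (twice (f (q * j + 1)))))
                           (subst (λ i → (q + q) * f (q * j + 1) ≤ q * f i) eq h')))
    where
    twice : ∀ a → q * (2 * a) ≡ (q + q) * a
    twice a = solve (q ∷ a ∷ [])
... | inj₁ found = found
... | inj₂ big = ⊥-elim (<-irrefl refl (<-≤-trans (f<2^L (q * L + 1)) big))

_↾_ : ∀ {n} → (Fin n → Fin n → ℕ) → (Fin n → Bool) → Fin n → Fin n → ℕ
(w ↾ P) u v = on (P u ∧ P v) (w u v)

_↿_ : ∀ {n} → (Fin n → ℕ) → (Fin n → Bool) → Fin n → ℕ
(m ↿ P) v = on (P v) (m v)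

↾-≤ : ∀ {n} (w : Fin n → Fin n → ℕ) P → ∑∑ (w ↾ P) ≤ ∑∑ w
↾-≤ w P = ∑∑-mono (λ u v → on-≤ (P u ∧ P v))

at : ∀ {n} → Fin n → Fin n → Bool
at r v = ⌊ v ≟ r ⌋

-- A low-diameter decomposition: balls whose weight grows slowly are cut off one
-- after another, and one of them inherits the density α / β.
module Decomposition {n : ℕ} (h : Fin n → Fin n → Bool) (w : Fin n → Fin n → ℕ) (m : Fin n → ℕ)
  (h-sym : Symmetric h) (w⇒h : ∀ u v → 0 < w u v → h u v ≡ true) (q : ℕ) .{{_ : NonZero q}} (L : ℕ) (w<2^L : ∑∑ w < 2 ^ L) (α β : ℕ) where

  record Piece : Set where
    field
      set      : Fin n → Bool
      root     : Fin n
      neighbor : Fin n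
      edge     : 0 < w root neighbor
      radius   : ℕ
      short    : radius ≤ q * L + 1
      inBall   : set ⊆ BFS.ball h (at root) radius
      dense    : α * ∑ (m ↿ set) < β * ∑∑ (w ↾ set)

  module Cut (Z : Fin n → Bool) (r : Fin n) (ρ : ℕ) where
    open BFS h (at r)
    P Z' P⁺ : Fin n → Bool
    P  = Z ∩ ball ρ
    P⁺ = Z ∩ ball (suc ρ)
    Z' = Z ∖ P
    -- Arcs of positive weight are edges of the symmetric `h`, so an arc with an end in `ball ρ` has
    -- both ends in `ball (suc ρ)`.
    edges : ∑∑ (w ↾ Z) ≤ ∑∑ (w ↾ Z') + ∑∑ (w ↾ P⁺)
    edges = ≤-trans (∑∑-mono pointwise) (≤-reflexive (∑∑-+ _ _))
      where
      pointwise : ∀ u v → (w ↾ Z) u v ≤ (w ↾ Z') u v + (w ↾ P⁺) u v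
      pointwise u v with w u v in eq
      ... | zero with Z u ∧ Z v
      ...   | true  = z≤n
      ...   | false = z≤n
      pointwise u v | suc x with h u v in e
      ... | false with () ← trans (symm (w⇒h u v (subst (0 <_) (symm eq) z<s))) e
      ... | true with Z u | Z v
      ...   | false | _ = z≤n
      ...   | true | false = z≤n
      ...   | true | true with ball ρ u in bu | ball ρ v in bv
      ...     | false | false = m≤m+n _ _
      ...     | true | true = ≤-refl
      ...     | true | false rewrite some⁺ {P = λ u → ball ρ u ∧ h u v} u (∧⁺ bu e) = ≤-refl
      ...     | false | true rewrite some⁺ {P = λ u' → ball ρ u' ∧ h u' u} v (∧⁺ bv (h-sym u v e)) = ≤-refl
    weight : ∑ (m ↿ Z) ≡ ∑ (m ↿ Z') + ∑ (m ↿ P)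
    weight = trans (∑-cong split) (∑-+ _ _)
      where
      split : ∀ v → (m ↿ Z) v ≡ (m ↿ Z') v + (m ↿ P) v
      split v with Z v | ball ρ v
      ... | false | _ = refl
      ... | true | true = refl
      ... | true | false = symm (+-identityʳ _)

  -- The invariant gives `Z` the density α/β with an extra factor 1 + 1/q. If the ball `P` is too
  -- sparse, cutting it off loses at most the weight of `P⁺`, which by the choice of ρ is at most 1
  -- + 1/q times that of `P`, hence at most (1 + 1/q) α/β times the mass of `P`. So the rest
  -- satisfies the same inequality.
  find : ∀ k (Z : Fin n → Bool) → # Z ≤ k → suc q * (α * ∑ (m ↿ Z)) < q * (β * ∑∑ (w ↾ Z)) → Piece
  find k Z #Z≤k start with 0<∑∑⇒∃ (w ↾ Z) (0<factorʳ β (0<factorʳ q (≤-<-trans z≤n start)))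
  ... | r , v , pos with 0<on {Z r ∧ Z v} pos
  ... | zz , 0<w with slow-step q L (λ i → ∑∑ (w ↾ (Z ∩ BFS.ball h (at r) i))) f1
                        (λ i → ≤-<-trans (↾-≤ w (Z ∩ BFS.ball h (at r) i)) w<2^L)
    where
    open BFS h (at r)
    r∈1 : ball 1 r ≡ true
    r∈1 = ∨⁺ˡ {at r r} (⌊⌋⁺ refl)
    v∈1 : ball 1 v ≡ true
    v∈1 = ball-edge {0} (⌊⌋⁺ refl) (w⇒h r v 0<w)
    inside : (Z ∩ ball 1) r ∧ (Z ∩ ball 1) v ≡ true
    inside = ∧⁺ (∧⁺ (∧⁻ˡ {Z r} zz) r∈1) (∧⁺ (∧⁻ʳ {Z r} zz) v∈1)
    -- The doubling starts at radius 1: `ball 0` is just the root, whereas `ball 1` contains the arc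
    -- from `r` to `v`.
    f1 : 1 ≤ ∑∑ (w ↾ (Z ∩ ball 1))
    f1 = ≤-trans (subst (λ b → 1 ≤ on b (w r v)) (symm inside) 0<w)
           (≤-trans (∑-≥ ((w ↾ (Z ∩ ball 1)) r) v) (∑-≥ (λ u → ∑ ((w ↾ (Z ∩ ball 1)) u)) r))
  ... | ρ , 1≤ρ , ρ≤ , slow with α * ∑ (m ↿ (Z ∩ BFS.ball h (at r) ρ)) <? β * ∑∑ (w ↾ (Z ∩ BFS.ball h (at r) ρ))
  ... | yes dense = record { set = Z ∩ BFS.ball h (at r) ρ ; root = r ; neighbor = v ; edge = 0<w ; radius = ρ ; short = ρ≤
                           ; inBall = λ u → ∧⁻ʳ {Z u} ; dense = dense }
  ... | no sparse = continue k #Z≤k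
    where
    open Cut Z r ρ
    smaller : # Z' < # Z
    smaller = ≤-trans (+-monoˡ-≤ (# Z') (∃⇒0<# {P = P} r (∧⁺ (∧⁻ˡ zz) (BFS.ball-mono h (at r) {0} {ρ} z≤n r (⌊⌋⁺ refl)))))
                (≤-reflexive (symm (#-∖ {P = Z} {P} (λ u → ∧⁻ˡ))))
    arith : ∀ z z' p e e' e⁺ eP → z ≡ z' + p → e ≤ e' + e⁺ → q * e⁺ ≤ suc q * eP → β * eP ≤ α * p →
            suc q * (α * z) < q * (β * e) → suc q * (α * z') < q * (β * e')
    arith z z' p e e' e⁺ eP refl h₁ h₂ h₃ start = linear 0
      (+-mono-≤ (+-mono-≤ start (*-monoʳ-≤ (q * β) h₁)) (+-mono-≤ (*-monoʳ-≤ β h₂) (*-monoʳ-≤ (suc q) h₃)))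
      (ring z' p e e' e⁺ eP)
      where
      ring : ∀ z' p e e' e⁺ eP → suc (suc q * (α * z')) + (q * (β * e) + q * β * (e' + e⁺) + (β * (suc q * eP) + suc q * (α * p))) + 0
             ≡ q * (β * e') + (suc (suc q * (α * (z' + p))) + q * β * e + (β * (q * e⁺) + suc q * (β * eP)))
      ring z' p e e' e⁺ eP = solve (q ∷ α ∷ β ∷ z' ∷ p ∷ e ∷ e' ∷ e⁺ ∷ eP ∷ [])
    continue : ∀ k → # Z ≤ k → Piece
    continue zero le = ⊥-elim (n≮0 (<-≤-trans smaller le))
    continue (suc k) le = find k Z' (s≤s⁻¹ (<-≤-trans smaller le))
      (arith _ _ _ _ _ _ _ weight edges slow (≮⇒≥ sparse) start)

  opaque
    piece : suc q * (α * ∑ m) < q * (β * ∑∑ w) → Piece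
    piece start = find n (λ _ → true) (#-≤ _) start

-- Enumerations, and subdivisions obtained from walks and from induced subgraphs.

-- That all of `A` is reached is encoded by `sums`, the form in which it is applied; the constant
-- function 1 turns it into the cardinality.
record Enumeration {n} (A : Fin n → Bool) : Set where
  field
    card   : ℕ
    elem   : Fin card → Fin n
    inj    : ∀ {i j} → elem i ≡ elem j → i ≡ j
    member : ∀ i → A (elem i) ≡ true
    sums   : ∀ f → ∑ (f ∘ elem) ≡ ∑ (λ v → on (A v) (f v))

opaque
  unfolding ∑
  sum-tabulate : ∀ {n} {A : Set} (f : A → ℕ) (g : Fin n → A) → sum (map f (tabulate g)) ≡ ∑ (f ∘ g)
  sum-tabulate {zero}  f g = refl
  sum-tabulate {suc n} f g = cong (f (g zero) +_) (sum-tabulate f (g ∘ suc))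

  enumerate : ∀ {n} (A : Fin n → Bool) → Enumeration A
  enumerate {zero} A = record { card = 0 ; elem = λ () ; inj = λ {} ; member = λ () ; sums = λ f → refl }
  enumerate {suc n} A with A zero in a0
  ... | false = record
    { card = card ; elem = suc ∘ elem ; inj = inj ∘ Data.Fin.Properties.suc-injective
    ; member = member ; sums = λ f → trans (sums (f ∘ suc)) (cong (λ b → on b (f zero) + ∑ (λ v → on (A (suc v)) (f (suc v)))) (symm a0)) }
    where open Enumeration (enumerate (A ∘ suc))
  ... | true = record
    { card = suc card ; elem = elem' ; inj = inj' ; member = member'
    ; sums = λ f → trans (cong (f zero +_) (sums (f ∘ suc))) (cong (λ b → on b (f zero) + ∑ (λ v → on (A (suc v)) (f (suc v)))) (symm a0)) }
    where
    open Enumeration (enumerate (A ∘ suc))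
    elem' : Fin (suc card) → Fin (suc n)
    elem' zero = zero
    elem' (suc i) = suc (elem i)
    inj' : ∀ {i j} → elem' i ≡ elem' j → i ≡ j
    inj' {zero} {zero} _ = refl
    inj' {suc i} {suc j} eq = cong suc (inj (Data.Fin.Properties.suc-injective eq))
    member' : ∀ i → A (elem' i) ≡ true
    member' zero = a0
    member' (suc i) = member i

sum-allFin : ∀ {n} (f : Fin n → ℕ) → sum (map f (allFin n)) ≡ ∑ f
sum-allFin f = sum-tabulate f id

degreeSum-∑∑ : ∀ {n} (G : Graph n) → degreeSum G ≡ ∑∑ (λ u v → 𝟙 (adj G u v))
degreeSum-∑∑ G = trans (sum-allFin (degree G)) (∑-cong (λ u → sum-allFin (λ v → 𝟙 (adj G u v))))

unique-length : ∀ {n} {P : Fin n → Bool} {p} → Unique p → All (In P) p → length p ≤ # P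
unique-length AllPairs.[] All.[] = z≤n
unique-length {P = P} {x ∷ p} (x∉p AllPairs.∷ u) (Px All.∷ Pp) =
  ≤-trans (+-mono-≤ (∃⇒0<# x (⌊⌋⁺ refl)) (unique-length u (All.zipWith rest (x∉p , Pp))))
    (≤-reflexive (symm (#-∖ {P = P} {at x} (λ v e → trans (cong P (⌊⌋⁻ e)) Px))))
  where
  rest : ∀ {v} → x ≢ v × P v ≡ true → (P ∖ at x) v ≡ true
  rest (x≢v , Pv) = ∧⁺ Pv (not⁺ (λ e → x≢v (symm (⌊⌋⁻ e))))

sizeOf-≤ : ∀ {t n} {G : Graph n} (S : Subdivision t G) c → (∀ i j → i Data.Fin.< j → length (path S i j) ≤ c) →
           sizeOf S ≤ t + t * (t * c)
sizeOf-≤ {t} S c le = +-monoʳ-≤ t (≤-trans (≤-reflexive (sum-allFin {t} _)) (∑-≤-const _ (λ i →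
                        ≤-trans (≤-reflexive (sum-allFin {t} _)) (∑-≤-const _ (λ j → bound i j)))))
  where
  bound : ∀ i j → (if toℕ i <ᵇ toℕ j then length (path S i j) else 0) ≤ c
  bound i j with toℕ i <ᵇ toℕ j in eq
  ... | true  = le i j (<ᵇ⇒< _ _ (subst Data.Bool.T (symm eq) _))
  ... | false = z≤n

module _ {n} {G : Graph n} where

  fromMember : ∀ {x y z p} → x ∈ p → Chain G (y ∷ p ++ [ z ]) → Unique p →
               ∃[ r ] Chain G (x ∷ r ++ [ z ]) × Unique (x ∷ r) × length (x ∷ r) ≤ length p × (∀ {v} → v ∈ x ∷ r → v ∈ p)
  fromMember {p = _ ∷ r} (here refl) (_ , ch) u = r , ch , u , ≤-refl , id
  fromMember {p = _ ∷ p} (there x∈p) (_ , ch) (_ AllPairs.∷ u) with r , ch' , u' , le , sub ← fromMember x∈p ch u =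
    r , ch' , u' , m≤n⇒m≤1+n le , there ∘ sub

  -- Loop erasure from the far end: if the next vertex `u` already occurs in the simple path of the
  -- rest, the path is cut down to the part that begins at `u`.
  eraseLoops : ∀ {S : Fin n → Set} {ℓ x u u' z} → adj G x u ≡ true → Walk (adj G) S ℓ u u' → adj G u' z ≡ true →
               ∃[ p ] Chain G (x ∷ p ++ [ z ]) × Unique p × All S p × length p ≤ suc ℓ
  eraseLoops {u = u} e (stop s) e' = [ u ] , (e , e' , _) , All.[] AllPairs.∷ AllPairs.[] , s All.∷ All.[] , s≤s z≤n
  eraseLoops {u = u} e (step s e₁ w) e' with p , ch , uq , al , le ← eraseLoops e₁ w e' with Data.List.Membership.DecPropositional._∈?_ _≟_ u p
  ... | yes u∈p with r , ch' , uq' , le' , sub ← fromMember u∈p ch uq =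
        u ∷ r , (e , ch') , uq' , All.tabulate (λ v∈ → All.lookup al (sub v∈)) , ≤-trans le' (m≤n⇒m≤1+n le)
  ... | no u∉p = u ∷ p , (e , ch) , ¬Any⇒All¬ p u∉p AllPairs.∷ uq , s All.∷ al , s≤s le

record Linked {n} (G : Graph n) (S : Fin n → Set) (ℓ : ℕ) (x y : Fin n) : Set where
  constructor link
  field
    {first last} : Fin n
    enter : adj G x first ≡ true
    walk  : Walk (adj G) S ℓ first last
    leave : adj G last y ≡ true

_<ᶠ_ : ∀ {t} → Fin t → Fin t → Set
_<ᶠ_ = Data.Fin._<_

-- Disjointness of paths is reduced to disjointness of the regions `S i j`. What remains is to link
-- two branch vertices by any walk inside their region, and such a walk may repeat vertices.
connect : ∀ {t n} {G : Graph n} (b : Fin t → Fin n) → (∀ {i j} → b i ≡ b j → i ≡ j) → (S : Fin t → Fin t → Fin n → Set) →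
  (∀ i j k v → i <ᶠ j → S i j v → v ≢ b k) →
  (∀ i j i' j' v → i <ᶠ j → i' <ᶠ j' → S i j v → S i' j' v → (i ≡ i') × (j ≡ j')) →
  ∀ {ℓ} → (∀ i j → i <ᶠ j → Linked G (S i j) ℓ (b i) (b j)) →
  HasSubdivisionWithin t G (t + t * (t * suc ℓ))
connect {t} {n} {G} b inj S avoid disj {ℓ} linked = sub , sizeOf-≤ sub (suc ℓ) (λ i j lt → proj₂ (proj₂ (proj₂ (good i j lt))))
  where
  simplePath : ∀ i j → i <ᶠ j → ∃[ p ] Chain G (b i ∷ p ++ [ b j ]) × Unique p × All (S i j) p × length p ≤ suc ℓ
  simplePath i j lt = eraseLoops enter walk leave where open Linked (linked i j lt)
  pathOf : ∀ i j → Dec (i <ᶠ j) → List (Fin n)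
  pathOf i j (yes lt) = proj₁ (simplePath i j lt)
  pathOf i j (no _) = []
  p : Fin t → Fin t → List (Fin n)
  p i j = pathOf i j (i Data.Fin.<? j)
  good : ∀ i j → i <ᶠ j → Chain G (b i ∷ p i j ++ [ b j ]) × Unique (p i j) × All (S i j) (p i j) × length (p i j) ≤ suc ℓ
  good i j lt with i Data.Fin.<? j
  ... | yes lt' = proj₂ (simplePath i j lt')
  ... | no ¬lt = ⊥-elim (¬lt lt)
  inS : ∀ {i j v} → i <ᶠ j → v ∈ p i j → S i j v
  inS {i} {j} lt = All.lookup (proj₁ (proj₂ (proj₂ (good i j lt))))
  sub : Subdivision t G
  sub = record
    { branch = b ; branchInj = inj ; path = p
    ; isPath = λ i j lt → proj₁ (good i j lt)
    ; simple = λ i j lt → proj₁ (proj₂ (good i j lt))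
    ; avoidsBranch = λ i j k v lt v∈ → avoid i j k v lt (inS lt v∈)
    ; disjoint = λ i j i' j' v lt lt' ne v∈ v∈' → ne (disj i j i' j' v lt lt' (inS lt v∈) (inS lt' v∈')) }

induced : ∀ {n} (G : Graph n) {A : Fin n → Bool} (e : Enumeration A) → Graph (Enumeration.card e)
induced G e = record { adj = λ i j → adj G (elem i) (elem j) ; sym = λ i j → Graph.sym G (elem i) (elem j) ; irrefl = λ i → irrefl G (elem i) }
  where open Enumeration e

module _ {n} (G : Graph n) {A : Fin n → Bool} (e : Enumeration A) where
  open Enumeration e

  card-# : card ≡ # A
  card-# = trans (trans (symm (*-identityʳ card)) (symm (∑-const 1))) (sums (λ _ → 1))

  degreeSum-induced : degreeSum (induced G e) ≡ ∑∑ ((λ u v → 𝟙 (adj G u v)) ↾ A)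
  degreeSum-induced = trans (degreeSum-∑∑ (induced G e)) (trans (∑-cong (λ i → sums (λ v → 𝟙 (adj G (elem i) v))))
    (trans (sums (λ u → ∑ (λ v → on (A v) (𝟙 (adj G u v))))) (∑-cong row)))
    where
    row : ∀ u → on (A u) (∑ (λ v → on (A v) (𝟙 (adj G u v)))) ≡ ∑ (λ v → on (A u ∧ A v) (𝟙 (adj G u v)))
    row u with A u
    ... | true  = refl
    ... | false = symm (∑-zero {n})

  chain-map : ∀ p → Chain (induced G e) p → Chain G (map elem p)
  chain-map [] _ = _
  chain-map (x ∷ []) _ = _
  chain-map (x ∷ y ∷ p) (a , ch) = a , chain-map (y ∷ p) ch

  -- A path without repetitions inside `A` has at most `# A` interior vertices. This crude bound is
  -- enough for sets whose size does not depend on n.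
  liftInduced : ∀ {t} → Subdivision t (induced G e) → HasSubdivisionWithin t G (t + t * (t * # A))
  liftInduced {t} S = S' , sizeOf-≤ S' (# A) (λ i j lt → unique-length (simple S' i j lt) (AllP.map⁺ (All.universal member (path S i j))))
    where
    back : ∀ {v p} → v ∈ map elem p → ∃[ x ] x ∈ p × v ≡ elem x
    back = ∈-map⁻ elem
    S' : Subdivision t G
    S' = record
      { branch = elem ∘ branch S
      ; branchInj = λ eq → branchInj S (inj eq)
      ; path = λ i j → map elem (path S i j)
      ; isPath = λ i j lt → subst (Chain G) (cong (_ ∷_) (map-++ elem (path S i j) _)) (chain-map _ (isPath S i j lt))
      ; simple = λ i j lt → UniqueP.map⁺ inj (simple S i j lt)
      ; avoidsBranch = λ i j k v lt v∈ eq → let x , x∈ , v≡ = back v∈ in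
          avoidsBranch S i j k x lt x∈ (inj (trans (symm v≡) eq))
      ; disjoint = λ i j i' j' v lt lt' ne v∈ v∈' → let x , x∈ , v≡ = back v∈ ; x' , x'∈ , v≡' = back v∈' in
          disjoint S i j i' j' x lt lt' ne x∈ (subst (_∈ path S i' j') (inj (trans (symm v≡') v≡)) x'∈) }

-- Cuts of weighted digraphs.

opaque
  unfolding ∑
  -- The greedy cut: vertices are coloured one after another, each opposite to the colour class with
  -- which it shares more weight. Since `w` need not be symmetric, arcs in both directions are
  -- counted.
  halfCut : ∀ {n} (w : Fin n → Fin n → ℕ) → (∀ v → w v v ≡ 0) →
            Σ (Fin n → Bool) λ c → ∑∑ w ≤ 2 * ∑∑ (λ u v → on (c u xor c v) (w u v))
  halfCut {zero} w d = (λ ()) , z≤n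
  halfCut {suc n} w d with halfCut (λ u v → w (suc u) (suc v)) (d ∘ suc)
  ... | c , le = choose (B ≤? A)
    where
    out into out₁ out₀ into₁ into₀ A B C rest : ℕ
    out = ∑ (λ v → w zero (suc v))
    into = ∑ (λ u → w (suc u) zero)
    rest = ∑∑ (λ u v → w (suc u) (suc v))
    out₁ = ∑ (λ v → on (c v) (w zero (suc v)))
    out₀ = ∑ (λ v → on (not (c v)) (w zero (suc v)))
    into₁ = ∑ (λ v → on (c v) (w (suc v) zero))
    into₀ = ∑ (λ v → on (not (c v)) (w (suc v) zero))
    A = out₁ + into₁
    B = out₀ + into₀
    C = ∑∑ (λ u v → on (c u xor c v) (w (suc u) (suc v)))
    total : ∑∑ w ≡ out + (into + rest)
    total = cong₂ _+_ (cong (_+ out) (d zero)) (∑-+ (λ u → w (suc u) zero) (λ u → ∑ (λ v → w (suc u) (suc v))))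
    halves : ∀ f → ∑ f ≡ ∑ (λ v → on (c v) (f v)) + ∑ (λ v → on (not (c v)) (f v))
    halves f = trans (∑-cong (λ v → split (c v))) (∑-+ (λ v → on (c v) (f v)) (λ v → on (not (c v)) (f v)))
      where
      split : ∀ b {x} → x ≡ on b x + on (not b) x
      split true = symm (+-identityʳ _)
      split false = refl
    extend : Bool → Fin (suc n) → Bool
    extend b zero = b
    extend b (suc v) = c v
    cutWeight : ∀ b → ∑∑ (λ u v → on (extend b u xor extend b v) (w u v)) ≡
      ∑ (λ v → on (b xor c v) (w zero (suc v))) + (∑ (λ u → on (c u xor b) (w (suc u) zero)) + C)
    cutWeight b = cong₂ _+_ (cong (_+ ∑ (λ v → on (b xor c v) (w zero (suc v)))) (self b (d zero)))
      (∑-+ (λ u → on (c u xor b) (w (suc u) zero)) (λ u → ∑ (λ v → on (c u xor c v) (w (suc u) (suc v)))))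
      where
      self : ∀ b {x} → x ≡ 0 → on (b xor b) x ≡ 0
      self true refl = refl
      self false refl = refl
    arith : ∀ {t a₁ a₂ b₁ b₂ o i r C x} → t ≡ o + (i + r) → o ≡ a₁ + b₁ → i ≡ a₂ + b₂ → r ≤ 2 * C → b₁ + b₂ ≤ a₁ + a₂ →
      x ≡ a₁ + (a₂ + C) → t ≤ 2 * x
    arith {a₁ = a₁} {a₂} {b₁} {b₂} {r = r} {C} refl refl refl h₁ h₂ refl = linear 0 (+-mono-≤ h₁ h₂) (ring a₁ a₂ b₁ b₂ r C)
      where
      ring : ∀ a₁ a₂ b₁ b₂ r C → a₁ + b₁ + (a₂ + b₂ + r) + (2 * C + (a₁ + a₂)) + 0 ≡ 2 * (a₁ + (a₂ + C)) + (r + (b₁ + b₂))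
      ring a₁ a₂ b₁ b₂ r C = solve (a₁ ∷ a₂ ∷ b₁ ∷ b₂ ∷ r ∷ C ∷ [])
    choose : Dec (B ≤ A) → Σ (Fin (suc n) → Bool) λ c' → ∑∑ w ≤ 2 * ∑∑ (λ u v → on (c' u xor c' v) (w u v))
    choose (yes B≤A) = extend false , arith {a₁ = out₁} {into₁} {out₀} {into₀} {out} {into} {rest} {C} total (halves _) (halves _) le B≤A
      (trans (cutWeight false) (cong (λ y → ∑ (λ v → on (c v) (w zero (suc v))) + (y + C)) (∑-cong (λ u → cong (λ b → on b (w (suc u) zero)) (simp (c u))))))
      where
      simp : ∀ b → b xor false ≡ b
      simp true = refl
      simp false = refl
    choose (no B≰A) = extend true , arith {a₁ = out₀} {into₀} {out₁} {into₁} {out} {into} {rest} {C} total (trans (halves _) (+-comm out₁ out₀)) (trans (halves _) (+-comm into₁ into₀)) le (<⇒≤ (≰⇒> B≰A))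
      (trans (cutWeight true) (cong (λ y → out₀ + (y + C)) (∑-cong (λ u → cong (λ b → on b (w (suc u) zero)) (simp (c u))))))
      where
      simp : ∀ b → b xor true ≡ not b
      simp true = refl
      simp false = refl

-- Of the two directions across a cut of half the weight, the heavier has at least a quarter;
-- exchanging the colours makes it start at colour `true`.
quarterCut : ∀ {n} (w : Fin n → Fin n → ℕ) → (∀ v → w v v ≡ 0) →
             Σ (Fin n → Bool) λ c → ∑∑ w ≤ 4 * ∑∑ (λ u v → on (c u ∧ not (c v)) (w u v))
quarterCut {n} w d with halfCut w d
... | c , le = choose (A ≤? B)
  where
  A B C : ℕ
  A = ∑∑ (λ u v → on (c u ∧ not (c v)) (w u v))
  B = ∑∑ (λ u v → on (not (c u) ∧ not (not (c v))) (w u v))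
  C = ∑∑ (λ u v → on (c u xor c v) (w u v))
  C≤ : C ≤ A + B
  C≤ = ≤-trans (∑∑-mono (λ u v → split (c u) (c v) {w u v})) (≤-reflexive (∑∑-+ {n} (λ u v → on (c u ∧ not (c v)) (w u v)) (λ u v → on (not (c u) ∧ not (not (c v))) (w u v))))
    where
    split : ∀ a b {x} → on (a xor b) x ≤ on (a ∧ not b) x + on (not a ∧ not (not b)) x
    split true true = z≤n
    split true false = m≤m+n _ _
    split false true = ≤-refl
    split false false = z≤n
  arith : ∀ {t A B C} → t ≤ 2 * C → C ≤ A + B → B ≤ A → t ≤ 4 * A
  arith {t} {A} {B} {C} h₁ h₂ h₃ = linear 0 (+-mono-≤ (+-mono-≤ h₁ (*-monoʳ-≤ 2 h₂)) (*-monoʳ-≤ 2 h₃)) (ring t A B C)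
    where
    ring : ∀ t A B C → t + (2 * C + 2 * (A + B) + 2 * A) + 0 ≡ 4 * A + (t + 2 * C + 2 * B)
    ring t A B C = solve (t ∷ A ∷ B ∷ C ∷ [])
  choose : Dec (A ≤ B) → Σ (Fin n → Bool) λ c' → ∑∑ w ≤ 4 * ∑∑ (λ u v → on (c' u ∧ not (c' v)) (w u v))
  choose (yes A≤B) = not ∘ c , arith {A = B} {A} {C} le (≤-trans C≤ (≤-reflexive (+-comm A B))) A≤B
  choose (no A≰B) = c , arith {A = A} {B} {C} le C≤ (<⇒≤ (≰⇒> A≰B))

opaque
  -- Each weight `w x y` is moved to the arc from `π x` to `y`, where `quarterCut` applies; the
  -- hypothesis says that no loops arise. With π a parent map, the colouring separates the parents,
  -- which will enter a connected set, from the vertices `y`, which have to stay outside.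
  pulledCut : ∀ {n} (π : Fin n → Fin n) (w : Fin n → Fin n → ℕ) → (∀ x → w x (π x) ≡ 0) →
              Σ (Fin n → Bool) λ c → ∑∑ w ≤ 4 * ∑∑ (λ x y → on (c (π x) ∧ not (c y)) (w x y))
  pulledCut {n} π w d with quarterCut W diag
    where
    W : Fin n → Fin n → ℕ
    W p y = ∑ (λ x → on ⌊ p ≟ π x ⌋ (w x y))
    diag : ∀ p → W p p ≡ 0
    diag p = trans (∑-cong zeros) (∑-zero {n})
      where
      zeros : ∀ x → on ⌊ p ≟ π x ⌋ (w x p) ≡ 0
      zeros x with p ≟ π x
      ... | yes refl = d x
      ... | no _ = refl
  ... | c , le = c , subst (λ e → ∑∑ w ≤ 4 * e) (pull (λ p y → c p ∧ not (c y))) (≤-trans (≤-reflexive (symm (pull (λ _ _ → true)))) le)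
    where
    pull : ∀ (b : Fin n → Fin n → Bool) → ∑ (λ p → ∑ (λ y → on (b p y) (∑ (λ x → on ⌊ p ≟ π x ⌋ (w x y))))) ≡ ∑∑ (λ x y → on (b (π x) y) (w x y))
    pull b = trans (∑-cong (λ p → trans (∑-cong (λ y → inside p y)) (∑-swap (λ y x → on ⌊ p ≟ π x ⌋ (on (b p y) (w x y))))))
      (trans (∑-swap (λ p x → ∑ (λ y → on ⌊ p ≟ π x ⌋ (on (b p y) (w x y)))))
        (∑-cong (λ x → trans (∑-swap (λ p y → on ⌊ p ≟ π x ⌋ (on (b p y) (w x y)))) (∑-cong (λ y → ∑-pick (π x) (λ p → on (b p y) (w x y)))))))
      where
      inside : ∀ p y → on (b p y) (∑ (λ x → on ⌊ p ≟ π x ⌋ (w x y))) ≡ ∑ (λ x → on ⌊ p ≟ π x ⌋ (on (b p y) (w x y)))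
      inside p y with b p y
      ... | true = refl
      ... | false = symm (trans (∑-cong (λ x → zeros ⌊ p ≟ π x ⌋)) (∑-zero {n}))
        where
        zeros : ∀ b → on b 0 ≡ 0
        zeros true = refl
        zeros false = refl

-- High density: one connected set adjacent to all of `X'`, with a dense remainder.

edges : ∀ {n} → Graph n → (Fin n → Bool) → (Fin n → Bool) → Fin n → Fin n → ℕ
edges G X Q x q = 𝟙 (X x ∧ Q q ∧ adj G x q)

∑∑-𝟙≤ : ∀ {n} (b : Fin n → Fin n → Bool) → ∑∑ (λ u v → 𝟙 (b u v)) ≤ n * n
∑∑-𝟙≤ b = ∑-≤-const _ (λ u → #-≤ (b u))

-- `X'` contains the candidates for common neighbours of all sets `U`. The vertices of `Q'` keep the
-- remainder dense and supply, together with `X'`, the sets of later rounds.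
record Attached {n} (G : Graph n) (X Q : Fin n → Bool) (D R : ℕ) : Set where
  field
    X' Q' U : Fin n → Bool
    X'⊆X : X' ⊆ X
    Q'⊆Q : Q' ⊆ Q
    U⊆   : ∀ v → U v ≡ true → X v ∨ Q v ≡ true
    X'#U : ∀ v → X' v ≡ true → U v ≢ true
    Q'#U : ∀ v → Q' v ≡ true → U v ≢ true
    touch : ∀ x → X' x ≡ true → ∃[ u ] U u ≡ true × adj G x u ≡ true
    joined : ∀ {u u'} → U u ≡ true → U u' ≡ true → Walk (adj G) (In U) (R + R) u u'
    dense : D * (# X' + # Q') < ∑∑ (edges G X' Q')

near : ℕ → ℕ → Bool
near i l = ⌊ i ≤? suc l ⌋ ∧ ⌊ l ≤? suc i ⌋

near⁺ : ∀ {i l} → i ≤ suc l → l ≤ suc i → near i l ≡ true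
near⁺ {i} {l} p q = ∧⁺ {⌊ i ≤? suc l ⌋} {⌊ l ≤? suc i ⌋} (⌊⌋⁺ p) (⌊⌋⁺ q)

near⁻ : ∀ {i l} → near i l ≡ true → i ≤ suc l
near⁻ {i} {l} p = ⌊⌋⁻ (∧⁻ˡ {⌊ i ≤? suc l ⌋} p)

near-count : ∀ {N} l → # {N} (λ i → near (toℕ i) l) ≤ 3
near-count {N} l = ≤-trans (∑-≤-+₃ bound) (+-mono-≤ (+-mono-≤
    (∑-unique {N} (λ i → ⌊ toℕ i ≟ℕ l ⌋) (λ i j p q → toℕ-injective (trans (⌊⌋⁻ p) (symm (⌊⌋⁻ q)))))
    (∑-unique {N} (λ i → ⌊ toℕ i ≟ℕ suc l ⌋) (λ i j p q → toℕ-injective (trans (⌊⌋⁻ p) (symm (⌊⌋⁻ q))))))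
    (∑-unique {N} (λ i → ⌊ suc (toℕ i) ≟ℕ l ⌋) (λ i j p q → toℕ-injective (suc-injective (trans (⌊⌋⁻ p) (symm (⌊⌋⁻ q)))))))
  where
  bound : ∀ (i : Fin N) → 𝟙 (near (toℕ i) l) ≤ 𝟙 ⌊ toℕ i ≟ℕ l ⌋ + 𝟙 ⌊ toℕ i ≟ℕ suc l ⌋ + 𝟙 ⌊ suc (toℕ i) ≟ℕ l ⌋
  bound i with toℕ i ≤? suc l | l ≤? suc (toℕ i)
  ... | no _ | _ = z≤n
  ... | yes _ | no _ = z≤n
  ... | yes a | yes b with toℕ i ≟ℕ l | toℕ i ≟ℕ suc l | suc (toℕ i) ≟ℕ l
  ...   | yes _ | _ | _ = s≤s z≤n
  ...   | no _ | yes _ | _ = s≤s z≤n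
  ...   | no _ | no _ | yes _ = s≤s z≤n
  ...   | no p | no q | no r = ⊥-elim (p (≤-antisym (s≤s⁻¹ (≤∧≢⇒< a q)) (s≤s⁻¹ (≤∧≢⇒< b (r ∘ symm)))))

module Attach {n} (G : Graph n) (X Q : Fin n → Bool) (L : ℕ) (n²<2^L : n * n < 2 ^ L)
  (D : ℕ) (1≤D : 1 ≤ D) (start : (24 * D + 2) * (# X + # Q) < ∑∑ (edges G X Q)) where

  h : Fin n → Fin n → Bool
  h u v = ((X u ∧ Q v) ∨ (Q u ∧ X v)) ∧ adj G u v

  h-sym : Symmetric h
  h-sym u v e = ∧⁺ (trans (swap-∨ (X v) (Q u) (Q v) (X u)) (∧⁻ˡ e)) (trans (Graph.sym G v u) (∧⁻ʳ {(X u ∧ Q v) ∨ (Q u ∧ X v)} e))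

  w : Fin n → Fin n → ℕ
  w = edges G X Q

  w⇒h : ∀ u v → 0 < w u v → h u v ≡ true
  w⇒h u v lt with X u | Q v | adj G u v
  w⇒h u v lt | true | true | true = refl

  m : Fin n → ℕ
  m v = 𝟙 (X v) + 𝟙 (Q v)

  ∑m : ∑ m ≡ # X + # Q
  ∑m = ∑-+ _ _

  -- Origin of 12 D + 1: a factor 4 goes to the directed cut, a factor 3 to the three levels for
  -- which a vertex may count, and 1 pays for the arcs to parents. The decomposition with q = 1
  -- costs the further factor 2 in `start`.
  open Decomposition h w m h-sym w⇒h 1 L (≤-<-trans (∑∑-𝟙≤ (λ x q → X x ∧ Q q ∧ adj G x q)) n²<2^L) (12 * D + 1) 1

  start' : 2 * ((12 * D + 1) * ∑ m) < 1 * (1 * ∑∑ w)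
  start' = subst₂ _<_ (trans (cong (λ k → (24 * D + 2) * k) (symm ∑m)) (ring D (∑ m))) (one (∑∑ w)) start
    where
    ring : ∀ D M → (24 * D + 2) * M ≡ 2 * ((12 * D + 1) * M)
    ring D M = solve (D ∷ M ∷ [])
    one : ∀ E → E ≡ 1 * (1 * E)
    one E = solve (E ∷ [])

  module FromPiece (pc : Piece) where
    open Piece pc renaming (set to P; root to r; radius to ρ; dense to P-dense)
    open BFS h (at r)

    N : ℕ
    N = suc ρ

    level : Fin n → ℕ
    level = lev N

    P⇒level : ∀ {v} → P v ≡ true → level v < N
    P⇒level {v} p = s≤s (ball⇒lev N {ρ} (inBall v p))

    π : Fin n → Fin n
    π x = proj₁ (parent N x)

    -- The arc from `x` to its own parent is dropped, since that parent cannot receive both colours.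
    -- Each `x` in `X` loses at most one arc this way.
    w₀ : Fin n → Fin n → ℕ
    w₀ x q = on (not ⌊ q ≟ π x ⌋) ((w ↾ P) x q)

    w₀-diag : ∀ x → w₀ x (π x) ≡ 0
    w₀-diag x with π x ≟ π x
    ... | yes _ = refl
    ... | no ne = ⊥-elim (ne refl)

    m' : Fin n → ℕ
    m' = m ↿ P

    w↾P≤ : ∑∑ (w ↾ P) ≤ ∑∑ w₀ + ∑ m'
    w↾P≤ = ≤-trans (∑∑-mono split) (≤-trans (≤-reflexive (∑∑-+ w₀ (λ x q → on ⌊ q ≟ π x ⌋ ((w ↾ P) x q))))
      (+-monoʳ-≤ (∑∑ w₀) (∑-mono (λ x → ≤-trans (≤-reflexive (∑-pick (π x) ((w ↾ P) x))) (atParent x (π x))))))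
      where
      split : ∀ x q → (w ↾ P) x q ≤ w₀ x q + on ⌊ q ≟ π x ⌋ ((w ↾ P) x q)
      split x q with q ≟ π x
      ... | yes _ = ≤-refl
      ... | no _ = m≤m+n _ _
      atParent : ∀ x p → (w ↾ P) x p ≤ m' x
      atParent x p with P x | P p | X x | Q p | adj G x p
      ... | false | _ | _ | _ | _ = z≤n
      ... | true | false | _ | _ | _ = z≤n
      ... | true | true | false | _ | _ = z≤n
      ... | true | true | true | false | _ = z≤n
      ... | true | true | true | true | false = z≤n
      ... | true | true | true | true | true = s≤s z≤n

    colouring : Σ (Fin n → Bool) λ c → ∑∑ w₀ ≤ 4 * ∑∑ (λ x y → on (c (π x) ∧ not (c y)) (w₀ x y))
    colouring = pulledCut π w₀ w₀-diag

    module Coloured (c : Fin n → Bool) (c-cut : ∑∑ w₀ ≤ 4 * ∑∑ (λ x y → on (c (π x) ∧ not (c y)) (w₀ x y))) where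
      wᶜ : Fin n → Fin n → ℕ
      wᶜ x y = on (c (π x) ∧ not (c y)) (w₀ x y)

      -- Neighbours of level i lie on levels i - 1, i and i + 1, hence `near`. The colours keep the
      -- parents of `Xⁱ` apart from `Qⁱ`.
      Xⁱ Qⁱ : ℕ → Fin n → Bool
      Xⁱ i x = (X x ∧ P x) ∧ (⌊ level x ≟ℕ i ⌋ ∧ c (π x))
      Qⁱ i q = (Q q ∧ P q) ∧ (near i (level q) ∧ not (c q))

      pieces : ∑∑ wᶜ ≤ ∑ {N} (λ i → ∑∑ (edges G (Xⁱ (toℕ i)) (Qⁱ (toℕ i))))
      pieces = ≤-trans (∑∑-mono pointwise) (≤-reflexive (trans (∑-cong (λ x → ∑-swap (λ q i → edges G (Xⁱ (toℕ i)) (Qⁱ (toℕ i)) x q)))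
                 (∑-swap (λ x (i : Fin N) → ∑ (edges G (Xⁱ (toℕ i)) (Qⁱ (toℕ i)) x)))))
        where
        pointwise : ∀ x q → wᶜ x q ≤ ∑ {N} (λ i → edges G (Xⁱ (toℕ i)) (Qⁱ (toℕ i)) x q)
        pointwise x q with wᶜ x q in eq
        ... | zero = z≤n
        ... | suc k with 0<on {c (π x) ∧ not (c q)} (subst (0 <_) (symm eq) z<s)
        ... | cc , pos₀ with 0<on {not ⌊ q ≟ π x ⌋} pos₀
        ... | _ , pos₁ with 0<on {P x ∧ P q} pos₁
        ... | pp , pos₂ = ≤-trans (≤-reflexive (trans (symm eq) value)) (∑-≥ (λ i → edges G (Xⁱ (toℕ i)) (Qⁱ (toℕ i)) x q) i)
          where
          xqe : X x ∧ Q q ∧ adj G x q ≡ true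
          xqe = 0<𝟙 pos₂
          e : h x q ≡ true
          e = w⇒h x q pos₂
          i : Fin N
          i = fromℕ< (P⇒level (∧⁻ˡ {P x} pp))
          i≡ : toℕ i ≡ level x
          i≡ = toℕ-fromℕ< _
          qe : Q q ∧ adj G x q ≡ true
          qe = ∧⁻ʳ {X x} xqe
          member : Xⁱ (toℕ i) x ∧ Qⁱ (toℕ i) q ∧ adj G x q ≡ true
          member = ∧⁺ (∧⁺ (∧⁺ (∧⁻ˡ {X x} xqe) (∧⁻ˡ {P x} pp)) (∧⁺ (⌊⌋⁺ (symm i≡)) (∧⁻ˡ {c (π x)} cc)))
            (∧⁺ (∧⁺ (∧⁺ (∧⁻ˡ {Q q} qe) (∧⁻ʳ {P x} pp)) (∧⁺ (near⁺ (subst (_≤ suc (level q)) (symm i≡) (lev-step N (h-sym _ _ e)))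
              (subst (λ j → level q ≤ suc j) (symm i≡) (lev-step N e))) (∧⁻ʳ {c (π x)} cc))) (∧⁻ʳ {Q q} qe))
          value : wᶜ x q ≡ 𝟙 (Xⁱ (toℕ i) x ∧ Qⁱ (toℕ i) q ∧ adj G x q)
          value = trans (≤-antisym (≤-trans (on-≤ (c (π x) ∧ not (c q))) (≤-trans (on-≤ (not ⌊ q ≟ π x ⌋)) (≤-trans (on-≤ (P x ∧ P q)) (≤-reflexive (cong 𝟙 xqe)))))
                    (subst (1 ≤_) (symm eq) z<s)) (cong 𝟙 (symm member))

      sizes : ∑ {N} (λ i → # (Xⁱ (toℕ i)) + # (Qⁱ (toℕ i))) ≤ 3 * ∑ m'
      sizes = ≤-trans (≤-reflexive (trans (∑-cong (λ i → symm (∑-+ (λ v → 𝟙 (Xⁱ (toℕ i) v)) (λ v → 𝟙 (Qⁱ (toℕ i) v))))) (∑-swap (λ i v → 𝟙 (Xⁱ (toℕ i) v) + 𝟙 (Qⁱ (toℕ i) v)))))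
        (≤-trans (∑-mono perVertex) (≤-reflexive (∑-* 3 m')))
        where
        restrict : ∀ a (b : Fin N → Bool) k → # b ≤ k → ∑ (λ i → 𝟙 (a ∧ b i)) ≤ k * 𝟙 a
        restrict true b k le = ≤-trans le (≤-reflexive (symm (*-identityʳ k)))
        restrict false b k le = ∑-zero-≤ {N}
        xs : ∀ v → # {N} (λ i → ⌊ level v ≟ℕ toℕ i ⌋ ∧ c (π v)) ≤ 3
        xs v = ≤-trans (∑-unique {N} _ (λ i j p q → toℕ-injective (trans (symm (⌊⌋⁻ (∧⁻ˡ {⌊ level v ≟ℕ toℕ i ⌋} p))) (⌊⌋⁻ (∧⁻ˡ {⌊ level v ≟ℕ toℕ j ⌋} q))))) (s≤s z≤n)
        qs : ∀ v → # {N} (λ i → near (toℕ i) (level v) ∧ not (c v)) ≤ 3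
        qs v = ≤-trans (#-mono (λ i p → ∧⁻ˡ {near (toℕ i) (level v)} p)) (near-count (level v))
        perVertex : ∀ v → ∑ {N} (λ i → 𝟙 (Xⁱ (toℕ i) v) + 𝟙 (Qⁱ (toℕ i) v)) ≤ 3 * m' v
        perVertex v = ≤-trans (≤-reflexive (∑-+ {N} (λ i → 𝟙 (Xⁱ (toℕ i) v)) (λ i → 𝟙 (Qⁱ (toℕ i) v))))
          (≤-trans (+-mono-≤ (restrict (X v ∧ P v) _ 3 (xs v)) (restrict (Q v ∧ P v) _ 3 (qs v))) (combineOn (X v) (Q v) (P v)))
          where
          combineOn : ∀ x q p → 3 * 𝟙 (x ∧ p) + 3 * 𝟙 (q ∧ p) ≤ 3 * on p (𝟙 x + 𝟙 q)
          combineOn x q true rewrite ∧-identityʳ x | ∧-identityʳ q = ≤-reflexive (symm (*-distribˡ-+ 3 (𝟙 x) (𝟙 q)))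
          combineOn x q false rewrite ∧-zeroʳ x | ∧-zeroʳ q = z≤n

      densePiece : ∃[ i ] D * (# (Xⁱ (toℕ {N} i)) + # (Qⁱ (toℕ i))) < ∑∑ (edges G (Xⁱ (toℕ i)) (Qⁱ (toℕ i)))
      densePiece = ∑-<⇒∃ _ _ (<-≤-trans (arith (≤-trans (≤-reflexive (∑-* D _)) (*-monoʳ-≤ D sizes)) c-cut w↾P≤ P-dense) pieces)
        where
        arith : ∀ {a M E E₀ C} → a ≤ D * (3 * M) → E₀ ≤ 4 * C → E ≤ E₀ + M → (12 * D + 1) * M < 1 * E → a < C
        arith {a} {M} {E} {E₀} {C} h₁ h₂ h₃ h₄ = *-cancelˡ-< 4 a C (linear 0 (+-mono-≤ (+-mono-≤ (*-monoʳ-≤ 4 h₁) h₂) (+-mono-≤ h₃ h₄)) (ring D a M E E₀ C))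
          where
          ring : ∀ D a M E E₀ C → suc (4 * a) + (4 * (D * (3 * M)) + 4 * C + (E₀ + M + 1 * E)) + 0 ≡ 4 * C + (4 * a + E₀ + (E + suc ((12 * D + 1) * M)))
          ring D a M E E₀ C = solve (D ∷ a ∷ M ∷ E ∷ E₀ ∷ C ∷ [])

      Xⁱ-level : ∀ {i} x → Xⁱ i x ≡ true → level x ≡ i
      Xⁱ-level {i} x p = ⌊⌋⁻ (∧⁻ˡ {⌊ level x ≟ℕ i ⌋} (∧⁻ʳ {X x ∧ P x} p))

      -- Level 0 is the root alone. With at most one arc per vertex of `Qⁱ 0` this piece is too
      -- sparse for D ≥ 1, so the dense piece has a level before it.
      rootPiece : ∑∑ (edges G (Xⁱ 0) (Qⁱ 0)) ≤ # (Qⁱ 0)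
      rootPiece = ≤-trans (∑∑-mono pointwise) (≤-reflexive (trans (∑-swap (λ x q → on ⌊ x ≟ r ⌋ (𝟙 (Qⁱ 0 q)))) (∑-cong (λ q → ∑-pick r (λ _ → 𝟙 (Qⁱ 0 q))))))
        where
        pointwise : ∀ x q → edges G (Xⁱ 0) (Qⁱ 0) x q ≤ on ⌊ x ≟ r ⌋ (𝟙 (Qⁱ 0 q))
        pointwise x q with x ≟ r
        ... | yes _ = ⇒𝟙≤ (λ e → ∧⁻ˡ {Qⁱ 0 q} (∧⁻ʳ {Xⁱ 0 x} e))
        ... | no x≢r with Xⁱ 0 x in eq
        ...   | false = z≤n
        ...   | true = ⊥-elim (x≢r (⌊⌋⁻ (lev-source N (Xⁱ-level x eq) z<s)))

      R : ℕ
      R = 1 * L + 1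

      module At (k : ℕ) (k<N : suc k < N) where

        -- Level k cannot be taken completely, because `Qⁱ (suc k)` reaches it. Its coloured
        -- vertices are exactly what the parents of `Xⁱ (suc k)` require, and they are connected
        -- through the earlier levels, all of which belong to `U`.
        U : Fin n → Bool
        U v = ⌊ level v <? k ⌋ ∨ (⌊ level v ≟ℕ k ⌋ ∧ c v)

        U⇒≤ : ∀ {v} → U v ≡ true → level v ≤ k
        U⇒≤ {v} p with ∨⁻ {⌊ level v <? k ⌋} p
        ... | inj₁ q = <⇒≤ (⌊⌋⁻ q)
        ... | inj₂ q = ≤-reflexive (⌊⌋⁻ (∧⁻ˡ {⌊ level v ≟ℕ k ⌋} q))

        below : ∀ {v} → level v < k → U v ≡ true
        below {v} lt = ∨⁺ˡ {⌊ level v <? k ⌋} (⌊⌋⁺ lt)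

        toRoot : ∀ {v} → U v ≡ true → Walk h (In U) R v r
        toRoot {v} p = go (level v) refl
          where
          go : ∀ j → level v ≡ j → Walk h (In U) R v r
          go zero eq = subst (Walk h (In U) R v) (⌊⌋⁻ (lev-source N eq z<s)) (stop p)
          go (suc j) eq with lev-pred N eq (≤-<-trans (subst (_≤ k) eq (U⇒≤ p)) (<-trans (n<1+n k) k<N))
          ... | u , e , lu with climb N h-sym j 0 (trans lu (symm (+-identityʳ j)))
                             (≤-<-trans (≤-reflexive (+-identityʳ j)) (<-trans (n<1+n j) (≤-<-trans (subst (_≤ k) eq (U⇒≤ p)) (<-trans (n<1+n k) k<N))))
          ... | s , ls , wk = weaken (≤-trans j<k (≤-trans (<⇒≤ (s≤s⁻¹ k<N)) short)) (step p (h-sym _ _ e)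
                (subst (Walk h (In U) j u) (⌊⌋⁻ (lev-source N ls z<s))
                  (mapʷ id (λ (_ , b) → below (≤-trans (s≤s (≤-trans b (≤-reflexive (+-identityʳ j)))) j<k)) wk)))
            where
            j<k : suc j ≤ k
            j<k = subst (_≤ k) eq (U⇒≤ p)

        inXQ : ∀ v → U v ≡ true → X v ∨ Q v ≡ true
        inXQ v p = go (level v) refl
          where
          go : ∀ j → level v ≡ j → X v ∨ Q v ≡ true
          go zero eq = subst (λ x → X x ∨ Q x ≡ true) (symm (⌊⌋⁻ (lev-source N eq z<s))) (∨⁺ˡ (∧⁻ˡ {X r} (0<𝟙 edge)))
          go (suc j) eq with lev-pred N eq (≤-<-trans (subst (_≤ k) eq (U⇒≤ p)) (<-trans (n<1+n k) k<N))
          ... | u , e , _ with ∨⁻ {X u ∧ Q v} (∧⁻ˡ e)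
          ...   | inj₁ q = ∨⁺ʳ {X v} (∧⁻ʳ {X u} q)
          ...   | inj₂ q = ∨⁺ˡ (∧⁻ʳ {Q u} q)

        attached : D * (# (Xⁱ (suc k)) + # (Qⁱ (suc k))) < ∑∑ (edges G (Xⁱ (suc k)) (Qⁱ (suc k))) → Attached G X Q D R
        attached dense = record
          { X' = Xⁱ (suc k) ; Q' = Qⁱ (suc k) ; U = U
          ; X'⊆X = λ v p → ∧⁻ˡ {X v} (∧⁻ˡ {X v ∧ P v} p)
          ; Q'⊆Q = λ v p → ∧⁻ˡ {Q v} (∧⁻ˡ {Q v ∧ P v} p)
          ; U⊆ = inXQ
          ; X'#U = λ v p u → 1+n≰n (≤-trans (≤-reflexive (symm (xLevel v p))) (U⇒≤ u))
          ; Q'#U = qOut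
          ; touch = touching
          ; joined = λ p q → mapʷ (λ {u} {v} e → ∧⁻ʳ {(X u ∧ Q v) ∨ (Q u ∧ X v)} e) id (toRoot p ++ʷ reverseʷ h-sym (toRoot q))
          ; dense = dense }
          where
          xLevel : ∀ v → Xⁱ (suc k) v ≡ true → level v ≡ suc k
          xLevel v p = Xⁱ-level v p
          qOut : ∀ v → Qⁱ (suc k) v ≡ true → U v ≢ true
          qOut v p u with ∧⁻ʳ {Q v ∧ P v} p
          ... | nc with ∨⁻ {⌊ level v <? k ⌋} u
          ...   | inj₁ lt = 1+n≰n (≤-trans (⌊⌋⁻ lt) (s≤s⁻¹ (near⁻ {suc k} (∧⁻ˡ {near (suc k) (level v)} nc))))
          ...   | inj₂ cc = not⁻ (∧⁻ʳ {near (suc k) (level v)} nc) (∧⁻ʳ {⌊ level v ≟ℕ k ⌋} cc)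
          touching : ∀ x → Xⁱ (suc k) x ≡ true → ∃[ u ] U u ≡ true × adj G x u ≡ true
          touching x p with proj₂ (parent N x) k (xLevel x p) k<N
          ... | e , l = π x , ∨⁺ʳ {⌊ level (π x) <? k ⌋} (∧⁺ (⌊⌋⁺ l) (∧⁻ʳ {⌊ level x ≟ℕ suc k ⌋} (∧⁻ʳ {X x ∧ P x} p))) ,
                        ∧⁻ʳ {(X x ∧ Q (π x)) ∨ (Q x ∧ X (π x))} (h-sym _ _ e)

      attached-at : ∀ i → i < N → D * (# (Xⁱ i) + # (Qⁱ i)) < ∑∑ (edges G (Xⁱ i) (Qⁱ i)) → Attached G X Q D R
      attached-at zero _ lt = ⊥-elim (<-irrefl refl (<-≤-trans lt (≤-trans rootPiece
        (≤-trans (m≤n+m _ (# (Xⁱ 0))) (≤-trans (≤-reflexive (symm (+-identityʳ _))) (*-monoˡ-≤ (# (Xⁱ 0) + # (Qⁱ 0)) 1≤D))))))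
      attached-at (suc k) lt dense = At.attached k lt dense

      result : Attached G X Q D R
      result = attached-at (toℕ (proj₁ densePiece)) (toℕ<n _) (proj₂ densePiece)

    resultᶜ : Attached G X Q D (1 * L + 1)
    resultᶜ = Coloured.result (proj₁ colouring) (proj₂ colouring)

  opaque
    attach : Attached G X Q D (1 * L + 1)
    attach = FromPiece.resultᶜ (piece start')

-- High density: many disjoint connected sets with common neighbours.

record Skeleton {n} (G : Graph n) (X Q : Fin n → Bool) (t T R : ℕ) : Set where
  field
    core   : Fin n → Bool
    U      : Fin T → Fin n → Bool
    core⊆X : core ⊆ X
    U⊆     : ∀ j v → U j v ≡ true → X v ∨ Q v ≡ true
    core#U : ∀ j v → core v ≡ true → U j v ≢ true
    U#U    : ∀ {i j} v → U i v ≡ true → U j v ≡ true → i ≡ j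
    touch  : ∀ j x → core x ≡ true → ∃[ u ] U j u ≡ true × adj G x u ≡ true
    joined : ∀ j {u u'} → U j u ≡ true → U j u' ≡ true → Walk (adj G) (In (U j)) (R + R) u u'
    large  : t < # core

-- The recursion is the loss in `Attach` with D = `threshold t T`. At the end a density of `suc t`
-- forces more than t core vertices, as the arcs number at most `# X * # Q`.
threshold : ℕ → ℕ → ℕ
threshold t zero = suc t
threshold t (suc T) = 24 * threshold t T + 2

1≤threshold : ∀ t T → 1 ≤ threshold t T
1≤threshold t zero = s≤s z≤n
1≤threshold t (suc T) = ≤-trans (s≤s z≤n) (m≤n+m 2 (24 * threshold t T))

edges-≤ : ∀ {n} (G : Graph n) X Q → ∑∑ (edges G X Q) ≤ # X * # Q
edges-≤ G X Q = ≤-trans (∑-mono row) (≤-reflexive (trans (∑-* (# Q) _) (*-comm (# Q) (# X))))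
  where
  row : ∀ x → ∑ (λ q → 𝟙 (X x ∧ Q q ∧ adj G x q)) ≤ # Q * 𝟙 (X x)
  row x with X x
  ... | true = ≤-trans (#-mono (λ q → ∧⁻ˡ {Q q})) (≤-reflexive (symm (*-identityʳ (# Q))))
  ... | false = ∑-zero-≤

module _ {n} (G : Graph n) (L : ℕ) (n²<2^L : n * n < 2 ^ L) (t : ℕ) where

  skeleton : ∀ T (X Q : Fin n → Bool) → threshold t T * (# X + # Q) < ∑∑ (edges G X Q) → Skeleton G X Q t T (1 * L + 1)
  skeleton zero X Q dense = record
    { core = X ; U = λ () ; core⊆X = λ _ p → p ; U⊆ = λ () ; core#U = λ () ; U#U = λ { {()} } ; touch = λ () ; joined = λ ()
    ; large = *-cancelʳ-< (# Q) t (# X) (≤-<-trans (arith t (# X) (# Q)) (<-≤-trans dense (edges-≤ G X Q))) }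
    where
    arith : ∀ t x q → t * q ≤ suc t * (x + q)
    arith t x q = *-mono-≤ (n≤1+n t) (m≤n+m q x)
  skeleton (suc T) X Q dense = extend (Attach.attach G X Q L n²<2^L (threshold t T) (1≤threshold t T) dense)
    where
    module Extend (A : Attached G X Q (threshold t T) (1 * L + 1)) (S : Skeleton G (Attached.X' A) (Attached.Q' A) t T (1 * L + 1)) where
      open Attached A renaming (U to U₀; U⊆ to U₀⊆; touch to touch₀; joined to joined₀; dense to dense₀)
      open Skeleton S
      V : Fin (suc T) → Fin n → Bool
      V zero = U₀
      V (suc j) = U j
      apart : ∀ j v → U₀ v ≡ true → U j v ≢ true
      apart j v p q with ∨⁻ {X' v} (U⊆ j v q)
      ... | inj₁ x = X'#U v x p
      ... | inj₂ x = Q'#U v x p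
      in₀ : ∀ j v → V j v ≡ true → X v ∨ Q v ≡ true
      in₀ zero v p = U₀⊆ v p
      in₀ (suc j) v p with ∨⁻ {X' v} (U⊆ j v p)
      ... | inj₁ x = ∨⁺ˡ (X'⊆X v x)
      ... | inj₂ x = ∨⁺ʳ {X v} (Q'⊆Q v x)
      same : ∀ {i j} v → V i v ≡ true → V j v ≡ true → i ≡ j
      same {zero} {zero} v p q = refl
      same {zero} {suc j} v p q = ⊥-elim (apart j v p q)
      same {suc i} {zero} v p q = ⊥-elim (apart i v q p)
      same {suc i} {suc j} v p q = cong suc (U#U v p q)
      extended : Skeleton G X Q t (suc T) (1 * L + 1)
      extended = record
        { core = core ; U = V
        ; core⊆X = λ v p → X'⊆X v (core⊆X v p)
        ; U⊆ = in₀
        ; core#U = λ { zero v p q → X'#U v (core⊆X v p) q ; (suc j) v p q → core#U j v p q }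
        ; U#U = λ {i} {j} → same {i} {j}
        ; touch = λ { zero x p → touch₀ x (core⊆X x p) ; (suc j) x p → touch j x p }
        ; joined = λ { zero p q → joined₀ p q ; (suc j) p q → joined j p q }
        ; large = large }
    extend : Attached G X Q (threshold t T) (1 * L + 1) → Skeleton G X Q t (suc T) (1 * L + 1)
    extend A = Extend.extended A (skeleton T (Attached.X' A) (Attached.Q' A) (Attached.dense A))

pick : ∀ {n t} (P : Fin n → Bool) → t ≤ # P → Σ (Fin t → Fin n) λ b → (∀ {i j} → b i ≡ b j → i ≡ j) × (∀ i → P (b i) ≡ true)
pick {n} {t} P le = (λ i → elem (Data.Fin.inject≤ i le')) , (λ eq → Data.Fin.Properties.inject≤-injective le' le' _ _ (inj eq)) , (λ i → member _)
  where
  open Enumeration (enumerate P)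
  le' : t ≤ card
  le' = ≤-trans le (≤-reflexive (symm (trans (trans (symm (*-identityʳ card)) (symm (∑-const 1))) (sums (λ _ → 1)))))

-- Every pair of branch vertices gets a set `U` of its own, indexed by `combine i j`, and enters and
-- leaves it through neighbours.
skeleton⇒subdivision : ∀ {n} {G : Graph n} {X Q t R} → Skeleton G X Q t (t * t) R → HasSubdivisionWithin t G (t + t * (t * suc (R + R)))
skeleton⇒subdivision {G = G} {t = t} {R} S with pick (Skeleton.core S) (<⇒≤ (Skeleton.large S))
... | b , b-inj , b∈ = connect b b-inj (λ i j v → U (combine i j) v ≡ true)
  (λ i j k v _ p eq → core#U (combine i j) (b k) (b∈ k) (subst (λ x → U (combine i j) x ≡ true) eq p))
  (λ i j i' j' v _ _ p q → combine-injective i j i' j' (U#U v p q))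
  (λ i j _ → let u , p , e = touch (combine i j) (b i) (b∈ i)
                 u' , p' , e' = touch (combine i j) (b j) (b∈ j)
             in link e (joined (combine i j) p p') (trans (Graph.sym G u' (b j)) e'))
  where open Skeleton S

-- The auxiliary graph on the vertices of large degree.

-- Every vertex a of A has at least t neighbours in B.  Each a in turn joins a new pair
-- of its B-neighbours by an auxiliary edge, unless these neighbours already span a
-- clique of auxiliary edges.
module Pairing {n} (G : Graph n) (A B : Fin n → Bool) (A#B : ∀ v → A v ≡ true → B v ≢ true) (t : ℕ)
  (manyNeighbors : ∀ a → A a ≡ true → t ≤ # (λ b → B b ∧ adj G a b)) where

  -- `M x y ≡ just a` says that `a` owns the auxiliary edge xy. An owner determines its edge by
  -- `M-inj`, so replacing auxiliary edges by paths x, a, y preserves disjointness.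
  record Pairs (as : List (Fin n)) : Set where
    field
      M       : Fin n → Fin n → Maybe (Fin n)
      M-sym   : ∀ x y → M x y ≡ M y x
      M-irr   : ∀ x → M x x ≡ nothing
      M-used  : ∀ x y {a} → M x y ≡ just a → a ∈ as
      M-end   : ∀ x y {a} → M x y ≡ just a → B x ∧ adj G a x ≡ true
      M-inj   : ∀ x y x' y' {a} → M x y ≡ just a → M x' y' ≡ just a → (x ≡ x' × y ≡ y') ⊎ (x ≡ y' × y ≡ x')
      M-count : 2 * length as ≤ ∑∑ (λ x y → 𝟙 (is-just (M x y)))

  cliqueSize : ℕ
  cliqueSize = t + t * (t * 1)

  module Step (a : Fin n) (as : List (Fin n)) (a∉as : a ∉ as) (S : Pairs as) where
    open Pairs S

    end : Fin n → Bool
    end x = B x ∧ adj G a x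

    -- If all pairs of neighbours of `a` have owners, then any t of these neighbours, with the
    -- owners as interior vertices, form a subdivision: owners of different pairs differ and lie in
    -- `A`, away from `B`.
    clique : A a ≡ true → All (In A) as → (∀ x y → end x ≡ true → end y ≡ true → x ≢ y → M x y ≢ nothing) → HasSubdivisionWithin t G cliqueSize
    clique Aa Aas full with pick end (manyNeighbors a Aa)
    ... | b , b-inj , b-end = connect b b-inj (λ i j v → M (b i) (b j) ≡ just v)
      (λ i j k v _ p eq → A#B v (All.lookup Aas (M-used (b i) (b j) p)) (subst (In B) (symm eq) (∧⁻ˡ (b-end k))))
      distinct linked
      where
      distinct : ∀ i j i' j' v → i <ᶠ j → i' <ᶠ j' → M (b i) (b j) ≡ just v → M (b i') (b j') ≡ just v → (i ≡ i') × (j ≡ j')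
      distinct i j i' j' v lt lt' p q with M-inj (b i) (b j) (b i') (b j') p q
      ... | inj₁ (e , e') = b-inj e , b-inj e'
      ... | inj₂ (e , e') with b-inj e | b-inj e'
      ...   | refl | refl = ⊥-elim (<-asym lt lt')
      linked : ∀ i j → i <ᶠ j → Linked G (λ v → M (b i) (b j) ≡ just v) 0 (b i) (b j)
      linked i j lt with M (b i) (b j) in eq
      ... | nothing = ⊥-elim (full (b i) (b j) (b-end i) (b-end j) (λ e → <-irrefl (cong toℕ (b-inj e)) lt) eq)
      ... | just v = link (trans (Graph.sym G (b i) v) (∧⁻ʳ {B (b i)} (M-end (b i) (b j) eq))) (stop refl)
                       (∧⁻ʳ {B (b j)} (M-end (b j) (b i) (trans (M-sym (b j) (b i)) eq)))

    module Add (p q : Fin n) (p-end : end p ≡ true) (q-end : end q ≡ true) (p≢q : p ≢ q) (fresh : M p q ≡ nothing) where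

      hit : Fin n → Fin n → Bool
      hit x y = (at p x ∧ at q y) ∨ (at q x ∧ at p y)

      data Hit (x y : Fin n) : Set where
        pq : x ≡ p → y ≡ q → Hit x y
        qp : x ≡ q → y ≡ p → Hit x y

      hit⁻ : ∀ {x y} → hit x y ≡ true → Hit x y
      hit⁻ {x} {y} e with ∨⁻ {at p x ∧ at q y} e
      ... | inj₁ f = pq (⌊⌋⁻ (∧⁻ˡ {at p x} f)) (⌊⌋⁻ (∧⁻ʳ {at p x} f))
      ... | inj₂ f = qp (⌊⌋⁻ (∧⁻ˡ {at q x} f)) (⌊⌋⁻ (∧⁻ʳ {at q x} f))

      hit-sym : ∀ x y → hit x y ≡ hit y x
      hit-sym x y = swap-∨ (at p x) (at q y) (at q x) (at p y)

      M' : Fin n → Fin n → Maybe (Fin n)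
      M' x y = if hit x y then just a else M x y

      cases : ∀ x y {c} → M' x y ≡ just c → (Hit x y × c ≡ a) ⊎ M x y ≡ just c
      cases x y e with hit x y in eq
      cases x y refl | true = inj₁ (hit⁻ eq , refl)
      ... | false = inj₂ e

      old≢a : ∀ x y → M x y ≢ just a
      old≢a x y e = a∉as (M-used x y e)

      inj' : ∀ x y x' y' {c} → M' x y ≡ just c → M' x' y' ≡ just c → (x ≡ x' × y ≡ y') ⊎ (x ≡ y' × y ≡ x')
      inj' x y x' y' e e' with cases x y e | cases x' y' e'
      ... | inj₂ o | inj₂ o' = M-inj x y x' y' o o'
      ... | inj₁ (_ , refl) | inj₂ o' = ⊥-elim (old≢a x' y' o')
      ... | inj₂ o | inj₁ (_ , refl) = ⊥-elim (old≢a x y o)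
      ... | inj₁ (pq refl refl , _) | inj₁ (pq refl refl , _) = inj₁ (refl , refl)
      ... | inj₁ (pq refl refl , _) | inj₁ (qp refl refl , _) = inj₂ (refl , refl)
      ... | inj₁ (qp refl refl , _) | inj₁ (pq refl refl , _) = inj₂ (refl , refl)
      ... | inj₁ (qp refl refl , _) | inj₁ (qp refl refl , _) = inj₁ (refl , refl)

      count : 2 * suc (length as) ≤ ∑∑ (λ x y → 𝟙 (is-just (M' x y)))
      count = ≤-trans (arith M-count (one p q) (one q p)) (≤-trans (≤-reflexive (symm sums)) (∑∑-mono pointwise))
        where
        one : ∀ p q → 1 ≤ ∑∑ (λ x y → 𝟙 (at p x ∧ at q y))
        one p q = ≤-trans (≤-reflexive (cong 𝟙 (symm (∧⁺ (⌊⌋⁺ {d = p ≟ p} refl) (⌊⌋⁺ {d = q ≟ q} refl)))))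
          (≤-trans (∑-≥ (λ y → 𝟙 (at p p ∧ at q y)) q) (∑-≥ (λ x → ∑ (λ y → 𝟙 (at p x ∧ at q y))) p))
        sums : ∑∑ (λ x y → 𝟙 (is-just (M x y)) + 𝟙 (at p x ∧ at q y) + 𝟙 (at q x ∧ at p y)) ≡
               ∑∑ (λ x y → 𝟙 (is-just (M x y))) + ∑∑ (λ x y → 𝟙 (at p x ∧ at q y)) + ∑∑ (λ x y → 𝟙 (at q x ∧ at p y))
        sums = trans (∑∑-+ (λ x y → 𝟙 (is-just (M x y)) + 𝟙 (at p x ∧ at q y)) (λ x y → 𝟙 (at q x ∧ at p y)))
          (cong (_+ ∑∑ (λ x y → 𝟙 (at q x ∧ at p y))) (∑∑-+ (λ x y → 𝟙 (is-just (M x y))) (λ x y → 𝟙 (at p x ∧ at q y))))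
        arith : ∀ {l s b c} → 2 * l ≤ s → 1 ≤ b → 1 ≤ c → 2 * suc l ≤ s + b + c
        arith {l} {s} {b} {c} h₁ h₂ h₃ = linear 0 (+-mono-≤ (+-mono-≤ h₁ h₂) h₃) (ring l s b c)
          where
          ring : ∀ l s b c → 2 * suc l + (s + b + c) + 0 ≡ s + b + c + (2 * l + 1 + 1)
          ring l s b c = solve (l ∷ s ∷ b ∷ c ∷ [])
        freshʳ : M q p ≡ nothing
        freshʳ = trans (M-sym q p) fresh
        pointwise : ∀ x y → 𝟙 (is-just (M x y)) + 𝟙 (at p x ∧ at q y) + 𝟙 (at q x ∧ at p y) ≤ 𝟙 (is-just (M' x y))
        pointwise x y with x ≟ p | y ≟ q | x ≟ q | y ≟ p
        ... | yes refl | yes refl | yes eq | _ = ⊥-elim (p≢q eq)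
        ... | yes refl | yes refl | no _ | _ rewrite fresh = ≤-refl
        ... | yes refl | no _ | yes eq | _ = ⊥-elim (p≢q eq)
        ... | yes refl | no _ | no _ | _ = ≤-reflexive (trans (+-identityʳ _) (+-identityʳ _))
        ... | no _ | _ | yes refl | yes refl rewrite freshʳ = ≤-refl
        ... | no _ | _ | yes refl | no _ = ≤-reflexive (trans (+-identityʳ _) (+-identityʳ _))
        ... | no _ | _ | no _ | _ = ≤-reflexive (trans (+-identityʳ _) (+-identityʳ _))

      end' : ∀ x y {c} → M' x y ≡ just c → B x ∧ adj G c x ≡ true
      end' x y e with cases x y e
      ... | inj₂ o = M-end x y o
      ... | inj₁ (pq refl refl , refl) = p-end
      ... | inj₁ (qp refl refl , refl) = q-end

      used' : ∀ x y {c} → M' x y ≡ just c → c ∈ a ∷ as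
      used' x y e with cases x y e
      ... | inj₂ o = there (M-used x y o)
      ... | inj₁ (_ , refl) = here refl

      irr' : ∀ x → M' x x ≡ nothing
      irr' x with M' x x in eq
      ... | nothing = refl
      ... | just c with cases x x eq
      ...   | inj₁ (pq refl e , _) = ⊥-elim (p≢q e)
      ...   | inj₁ (qp refl e , _) = ⊥-elim (p≢q (symm e))
      ...   | inj₂ o with () ← trans (symm (M-irr x)) o

      pairs : Pairs (a ∷ as)
      pairs = record
        { M = M' ; M-sym = λ x y → cong₂ (λ b m → if b then just a else m) (hit-sym x y) (M-sym x y)
        ; M-irr = irr' ; M-used = used' ; M-end = end' ; M-inj = inj' ; M-count = count }

    step' : A a ≡ true → All (In A) as → HasSubdivisionWithin t G cliqueSize ⊎ Pairs (a ∷ as)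
    step' Aa Aas with any? (λ x → any? (λ y → free? x y))
      where
      free : Fin n → Fin n → Bool
      free x y = end x ∧ end y ∧ not ⌊ x ≟ y ⌋ ∧ is-nothing (M x y)
      free? : ∀ x y → Dec (free x y ≡ true)
      free? x y = free x y Data.Bool.≟ true
    ... | yes (x , y , f) = inj₂ (Add.pairs x y (∧⁻ˡ {end x} f) (∧⁻ˡ {end y} f₁)
                                    (λ e → not⁻ {⌊ x ≟ y ⌋} (∧⁻ˡ {not ⌊ x ≟ y ⌋} f₂) (⌊⌋⁺ e)) (isNothing (M x y) (∧⁻ʳ {not ⌊ x ≟ y ⌋} f₂)))
      where
      f₁ : end y ∧ not ⌊ x ≟ y ⌋ ∧ is-nothing (M x y) ≡ true
      f₁ = ∧⁻ʳ {end x} f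
      f₂ : not ⌊ x ≟ y ⌋ ∧ is-nothing (M x y) ≡ true
      f₂ = ∧⁻ʳ {end y} f₁
      isNothing : ∀ m → is-nothing m ≡ true → m ≡ nothing
      isNothing nothing _ = refl
    ... | no none = inj₁ (clique Aa Aas (λ x y ex ey x≢y e → none (x , y , ∧⁺ ex (∧⁺ ey (∧⁺ (not⁺ (λ eq → x≢y (⌊⌋⁻ {d = x ≟ y} eq))) (cong is-nothing e))))))

  pairUp : ∀ as → Unique as → All (In A) as → HasSubdivisionWithin t G cliqueSize ⊎ Pairs as
  pairUp [] _ _ = inj₂ (record
    { M = λ _ _ → nothing ; M-sym = λ _ _ → refl ; M-irr = λ _ → refl ; M-used = λ _ _ () ; M-end = λ _ _ () ; M-inj = λ _ _ _ _ () ; M-count = z≤n })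
  pairUp (a ∷ as) (a∉as AllPairs.∷ u) (Aa All.∷ Aas) with pairUp as u Aas
  ... | inj₁ sub = inj₁ sub
  ... | inj₂ S = Step.step' a as (All¬⇒¬Any a∉as) S Aa Aas

  module Lift (as : List (Fin n)) (Aas : All (In A) as) (S : Pairs as) where
    open Pairs S

    H : Graph n
    H = record { adj = λ x y → is-just (M x y) ; sym = λ x y → cong is-just (M-sym x y) ; irrefl = λ x → cong is-just (M-irr x) }

    isJust : ∀ {x y} → adj H x y ≡ true → ∃[ a ] M x y ≡ just a
    isJust {x} {y} e with M x y
    ... | just a = a , refl

    many : 2 * length as ≤ ∑∑ (edges H B B)
    many = ≤-trans M-count (∑∑-mono pointwise)
      where
      pointwise : ∀ x y → 𝟙 (is-just (M x y)) ≤ edges H B B x y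
      pointwise x y = ⇒𝟙≤ (λ e → let a , eq = isJust e in
        ∧⁺ (∧⁻ˡ {B x} (M-end x y eq)) (∧⁺ (∧⁻ˡ {B y} (M-end y x (trans (M-sym y x) eq))) e))

    inA : ∀ {x y a} → M x y ≡ just a → A a ≡ true
    inA {x} {y} e = All.lookup Aas (M-used x y e)

    adjˡ : ∀ {x y a} → M x y ≡ just a → adj G x a ≡ true
    adjˡ {x} {y} {a} e = trans (Graph.sym G x a) (∧⁻ʳ {B x} (M-end x y e))

    adjʳ : ∀ {x y a} → M x y ≡ just a → adj G a y ≡ true
    adjʳ {x} {y} e = ∧⁻ʳ {B y} (M-end y x (trans (M-sym y x) e))

    lift : ∀ {R} → Skeleton H B B t (t * t) R → HasSubdivisionWithin t G (t + t * (t * suc (suc (suc ((R + R) + (R + R))))))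
    lift {R} K with pick (Skeleton.core K) (<⇒≤ (Skeleton.large K))
    ... | b , b-inj , b∈ = connect b b-inj W avoid distinct linked
      where
      open Skeleton K
      V : Fin t → Fin t → Fin n → Set
      V i j v = U (combine i j) v ≡ true
      W : Fin t → Fin t → Fin n → Set
      -- Besides `V i j`, the region has the owners of auxiliary edges with one end in `V i j`; the
      -- other end may be a branch vertex, as for the first and the last edge. Since an owner
      -- determines its edge and branch vertices lie in no `U`, the regions remain disjoint.
      W i j v = V i j v ⊎ (Σ (Fin n) λ x → Σ (Fin n) λ y → V i j x × (V i j y ⊎ (y ≡ b i ⊎ y ≡ b j)) × M x y ≡ just v)
      V⊆B : ∀ {i j v} → V i j v → B v ≡ true
      V⊆B {v = v} p with ∨⁻ {B v} (U⊆ _ v p)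
      ... | inj₁ q = q
      ... | inj₂ q = q
      bB : ∀ k → B (b k) ≡ true
      bB k = core⊆X (b k) (b∈ k)
      avoid : ∀ i j k v → i <ᶠ j → W i j v → v ≢ b k
      avoid i j k v _ (inj₁ p) refl = core#U (combine i j) v (b∈ k) p
      avoid i j k v _ (inj₂ (x , y , _ , _ , e)) refl = A#B v (inA e) (bB k)
      distinct : ∀ i j i' j' v → i <ᶠ j → i' <ᶠ j' → W i j v → W i' j' v → (i ≡ i') × (j ≡ j')
      distinct i j i' j' v _ _ (inj₁ p) (inj₁ q) = combine-injective i j i' j' (U#U v p q)
      distinct i j i' j' v _ _ (inj₁ p) (inj₂ (x , y , _ , _ , e)) = ⊥-elim (A#B v (inA e) (V⊆B {i} {j} p))
      distinct i j i' j' v _ _ (inj₂ (x , y , _ , _ , e)) (inj₁ q) = ⊥-elim (A#B v (inA e) (V⊆B {i'} {j'} q))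
      distinct i j i' j' v _ _ (inj₂ (x , y , p , p' , e)) (inj₂ (x' , y' , q , q' , e')) with M-inj x y x' y' e e'
      ... | inj₁ (refl , _) = combine-injective i j i' j' (U#U x p q)
      ... | inj₂ (refl , refl) with p'
      ...   | inj₁ r = combine-injective i j i' j' (U#U y r q)
      ...   | inj₂ (inj₁ refl) = ⊥-elim (core#U (combine i' j') y (b∈ i) q)
      ...   | inj₂ (inj₂ refl) = ⊥-elim (core#U (combine i' j') y (b∈ j) q)
      double : ∀ {i j k x y} → Walk (adj H) (V i j) k x y → Walk (adj G) (W i j) (k + k) x y
      double (stop p) = stop (inj₁ p)
      double {k = suc k} (step {x = x} {y} p e w) with isJust e
      ... | a , eq = weaken (≤-reflexive (cong suc (symm (+-suc k k))))
        (step (inj₁ p) (adjˡ eq) (step (inj₂ (x , y , p , inj₁ (startʷ w) , eq)) (adjʳ eq) (double w)))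
      linked : ∀ i j → i <ᶠ j → Linked G (W i j) (suc (suc ((R + R) + (R + R)))) (b i) (b j)
      linked i j _ with touch (combine i j) (b i) (b∈ i) | touch (combine i j) (b j) (b∈ j)
      ... | u , p , e | u' , p' , e' with isJust e | isJust e'
      ...   | a , eq | a' , eq' = link (adjˡ eq)
        (step (inj₂ (u , b i , p , inj₂ (inj₁ refl) , trans (M-sym u (b i)) eq)) (adjʳ eq)
          (snocʷ (double {i} {j} (joined (combine i j) p p')) (adjˡ (trans (M-sym u' (b j)) eq')) (inj₂ (u' , b j , p' , inj₂ (inj₂ refl) , trans (M-sym u' (b j)) eq'))))
        (adjʳ (trans (M-sym u' (b j)) eq'))

  -- Unless a clique turns up, `# A` auxiliary edges lie on the `# B` vertices of `B`, which is
  -- dense enough for a skeleton of the auxiliary graph.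
  paired : ∀ (L : ℕ) → n * n < 2 ^ L → threshold t (t * t) * # B < # A →
    HasSubdivisionWithin t G (t + t * (t * suc (suc (suc (((1 * L + 1) + (1 * L + 1)) + ((1 * L + 1) + (1 * L + 1)))))))
  paired L n²<2^L big = conclude (pairUp as (UniqueP.tabulate⁺ inj) as⊆A)
    where
    open Enumeration (enumerate A)
    as : List (Fin n)
    as = tabulate elem
    as⊆A : All (In A) as
    as⊆A = AllP.tabulate⁺ member
    length-as : length as ≡ # A
    length-as = trans (length-tabulate elem) (card-# G (enumerate A))
    R : ℕ
    R = 1 * L + 1
    arith : ∀ {τ b a s} → τ * b < a → 2 * a ≤ s → τ * (b + b) < s
    arith {τ} {b} {a} {s} h₁ h₂ = linear 1 (+-mono-≤ (*-monoʳ-≤ 2 h₁) h₂) (ring τ b a s)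
      where
      ring : ∀ τ b a s → suc (τ * (b + b)) + (2 * a + s) + 1 ≡ s + (2 * suc (τ * b) + 2 * a)
      ring τ b a s = solve (τ ∷ b ∷ a ∷ s ∷ [])
    conclude : HasSubdivisionWithin t G cliqueSize ⊎ Pairs as → _
    conclude (inj₁ (S , le)) = S , ≤-trans le (+-monoʳ-≤ t (*-monoʳ-≤ t (*-monoʳ-≤ t (s≤s z≤n))))
    conclude (inj₂ S) = Lift.lift as as⊆A S (skeleton (Lift.H as as⊆A S) L n²<2^L t (t * t) B B
      (arith {threshold t (t * t)} (subst (_ <_) (symm length-as) big) (Lift.many as as⊆A S)))

-- Bounded degree: slabs of BFS levels.

-- The number of ordered pairs of adjacent vertices of Z, i.e. twice the number of edges of G[Z].
arcs : ∀ {n} → Graph n → (Fin n → Bool) → ℕ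
arcs G Z = ∑∑ ((λ u v → 𝟙 (adj G u v)) ↾ Z)

∑-least : ∀ {b} (f : Fin (suc b) → ℕ) → ∃[ c ] suc b * f c ≤ ∑ f
∑-least {b} f with ∑-<⇒∃ (λ c → suc b * f c) (λ _ → suc (∑ f)) (≤-trans (s≤s (≤-reflexive (∑-* (suc b) f)))
  (≤-trans (m<m*n' (∑ f)) (≤-reflexive (symm (∑-const {suc b} (suc (∑ f)))))))
  where
  m<m*n' : ∀ s → suc (suc b * s) ≤ suc b * suc s
  m<m*n' s = linear b (z≤n {0}) (ring s b)
    where
    ring : ∀ s b → suc (suc b * s) + 0 + b ≡ suc b * suc s + 0
    ring s b = solve (s ∷ b ∷ [])
... | c , lt = c , s≤s⁻¹ lt

-- Positions are cut into periods of length `Π`, the last `g` positions of each being a gap. The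
-- width p + 1 leaves room for walks of length p on both sides of a band, and shifts by multiples of
-- `g` move the gap through the period.
module Periods (b p : ℕ) where
  g Π : ℕ
  g = suc p
  Π = suc b * g

  opaque
    rem quo : ℕ → ℕ
    rem l = l % Π
    quo l = l / Π

    decompose : ∀ l → l ≡ rem l + quo l * Π
    decompose l = m≡m%n+[m/n]*n l Π

    rem<Π : ∀ l → rem l < Π
    rem<Π l = m%n<n l Π

  gap : ℕ → Bool
  gap l = ⌊ b * g ≤? rem l ⌋

  ¬gap⇒< : ∀ {l} → gap l ≢ true → rem l < b * g
  ¬gap⇒< {l} e = ≰⇒> (λ q → e (⌊⌋⁺ q))

  jump : ∀ {l l'} → quo l < quo l' → l' ≤ suc l → rem l < b * g → ⊥
  jump {l} {l'} lt h e = arith (rem l) (quo l) (rem l') (quo l') (decompose l) (decompose l') e (*-monoˡ-≤ Π lt) h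
    where
    arith : ∀ {l l'} x y x' y' → l ≡ x + y * Π → l' ≡ x' + y' * Π → suc x ≤ b * g → suc y * Π ≤ y' * Π → l' ≤ suc l → ⊥
    arith x y x' y' refl refl h₁ h₂ h₃ = 1+n≰n {0} (linear (p + x') (+-mono-≤ (+-mono-≤ h₁ h₂) h₃) (ring x y x' y' (b * suc p)))
      where
      ring : ∀ x y x' y' bg → 1 + (bg + y' * (suc p + bg) + suc (x + y * (suc p + bg))) + (p + x') ≡
                              0 + (suc x + suc y * (suc p + bg) + (x' + y' * (suc p + bg)))
      ring x y x' y' bg = solve (x ∷ y ∷ x' ∷ y' ∷ bg ∷ p ∷ [])

  -- Passing to another period means crossing a gap, which has width at least 1, while an edge
  -- changes the position by at most 1.
  samePeriod : ∀ {l l'} → l ≤ suc l' → l' ≤ suc l → gap l ≢ true → gap l' ≢ true → quo l ≡ quo l'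
  samePeriod {l} {l'} h h' e e' with <-cmp (quo l) (quo l')
  ... | tri≈ _ eq _ = eq
  ... | tri< lt _ _ = ⊥-elim (jump lt h' (¬gap⇒< e))
  ... | tri> _ _ gt = ⊥-elim (jump gt h (¬gap⇒< e'))

  noTwoGaps : ∀ a {K} → g ≤ K → K + g ≤ Π → gap a ≡ true → gap (a + K) ≡ true → ⊥
  noTwoGaps a {K} g≤K K≤ e e' with <-cmp (quo a) (quo (a + K))
  ... | tri> _ _ gt = arith (rem a) (quo a) (rem (a + K)) (quo (a + K)) (b * g) (decompose a) (decompose (a + K)) (rem<Π (a + K)) (*-monoˡ-≤ Π gt)
    where
    arith : ∀ x y x' y' B → a ≡ x + y * (g + B) → a + K ≡ x' + y' * (g + B) → x' < g + B → suc y' * (g + B) ≤ y * (g + B) → ⊥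
    arith x y x' y' B eq eq' h₁ h₂ = 1+n≰n {0} (linear (x + K) (+-mono-≤ (+-mono-≤ h₁ h₂) (+-mono-≤ (≤-reflexive (symm eq)) (≤-reflexive eq')))
        (ring a K x y x' y' (g + B)))
      where
      ring : ∀ a K x y x' y' Π → 1 + (Π + y * Π + (a + (x' + y' * Π))) + (x + K) ≡ 0 + (suc x' + suc y' * Π + (x + y * Π + (a + K)))
      ring a K x y x' y' Π = solve (a ∷ K ∷ x ∷ y ∷ x' ∷ y' ∷ Π ∷ [])
  ... | tri≈ _ same _ = arith (rem a) (quo a) (rem (a + K)) (quo (a + K)) (b * g) (decompose a) (decompose (a + K)) (rem<Π (a + K)) (⌊⌋⁻ e) same
    where
    arith : ∀ x y x' y' B → a ≡ x + y * (g + B) → a + K ≡ x' + y' * (g + B) → x' < g + B → B ≤ x → y ≡ y' → ⊥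
    arith x y x' .y B eq eq' h₁ h₂ refl = 1+n≰n {0} (linear 0 (+-mono-≤ (+-mono-≤ h₁ (+-mono-≤ h₂ g≤K)) (+-mono-≤ (≤-reflexive (symm eq)) (≤-reflexive eq')))
        (ring a K x y x' B g))
      where
      ring : ∀ a K x y x' B g → 1 + (g + B + (x + K) + (a + (x' + y * (g + B)))) + 0 ≡ 0 + (suc x' + (B + g) + (x + y * (g + B) + (a + K)))
      ring a K x y x' B g = solve (a ∷ K ∷ x ∷ y ∷ x' ∷ B ∷ g ∷ [])
  ... | tri< lt _ _ = arith (rem a) (quo a) (rem (a + K)) (quo (a + K)) (b * g) (decompose a) (decompose (a + K)) (rem<Π a) (⌊⌋⁻ e') (*-monoˡ-≤ Π lt) K≤
    where
    arith : ∀ x y x' y' B → a ≡ x + y * (g + B) → a + K ≡ x' + y' * (g + B) → x < g + B → B ≤ x' → suc y * (g + B) ≤ y' * (g + B) → K + g ≤ g + B → ⊥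
    arith x y x' y' B eq eq' h₁ h₂ h₃ h₄ = 1+n≰n {0} (linear 0 (+-mono-≤ (+-mono-≤ h₁ (+-mono-≤ h₂ (+-mono-≤ h₃ h₄))) (+-mono-≤ (≤-reflexive eq) (≤-reflexive (symm eq'))))
        (ring a K x y x' y' B g))
      where
      ring : ∀ a K x y x' y' B g → 1 + (g + B + (x' + (y' * (g + B) + (g + B))) + (x + y * (g + B) + (a + K))) + 0 ≡
                                    0 + (suc x + (B + (suc y * (g + B) + (K + g))) + (a + (x' + y' * (g + B))))
      ring a K x y x' y' B g = solve (a ∷ K ∷ x ∷ y ∷ x' ∷ y' ∷ B ∷ g ∷ [])

  oneGap< : ∀ l {c c'} → c < c' → c' ≤ b → gap (l + c * g) ≡ true → gap (l + c' * g) ≡ true → ⊥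
  oneGap< l {c} lt c'≤b e e' with m≤n⇒∃[o]m+o≡n lt
  ... | d , refl = noTwoGaps (l + c * g) (m≤m+n g (d * g)) (≤-trans (≤-reflexive (+-comm (suc d * g) g)) (+-monoʳ-≤ g (*-monoˡ-≤ g (≤-trans (s≤s (m≤n+m d c)) c'≤b))))
                     e (subst (λ k → gap k ≡ true) (move l c d g) e')
    where
    move : ∀ l c d g → l + (suc c + d) * g ≡ l + c * g + suc d * g
    move l c d g = solve (l ∷ c ∷ d ∷ g ∷ [])

  oneGap : ∀ l (c c' : Fin (suc b)) → gap (l + toℕ c * g) ≡ true → gap (l + toℕ c' * g) ≡ true → c ≡ c'
  oneGap l c c' e e' with <-cmp (toℕ c) (toℕ c')
  ... | tri≈ _ eq _ = toℕ-injective eq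
  ... | tri< lt _ _ = ⊥-elim (oneGap< l lt (s≤s⁻¹ (toℕ<n c')) e e')
  ... | tri> _ _ gt = ⊥-elim (oneGap< l gt (s≤s⁻¹ (toℕ<n c)) e' e)

-- Consequently an end of an arc falls into a gap for at most one of the b + 1 offsets, and some
-- offset destroys at most 2/(b + 1) of the arcs.
gapCount : ∀ b p l → # {suc b} (λ c → Periods.gap b p (l + toℕ c * suc p)) ≤ 1
gapCount b p l = ∑-unique {suc b} _ (Periods.oneGap b p l)

SmallDense : ∀ {n} → Graph n → (Fin n → Bool) → ℕ → ℕ → ℕ → Set
SmallDense G Z α β K = Σ (Fin _ → Bool) λ A → A ⊆ Z × # A ≤ K × α * # A < β * arcs G A

Leg : ∀ {n} → Graph n → (Fin n → Set) → ℕ → (Fin n → Bool) → Fin n → Set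
Leg G P ℓ U y = ∃[ z ] ∃[ u ] Walk (adj G) P ℓ y z × adj G z u ≡ true × U u ≡ true

-- The set U of the levels above the slab W₁ of BFS levels; the walks from the core Z₁
-- of length at most p stay inside the slab.
record Slab {n} (G : Graph n) (W Z : Fin n → Bool) (α β p ℓ R : ℕ) : Set where
  field
    W₁ Z₁ U : Fin n → Bool
    Z₁⊆Z : Z₁ ⊆ Z
    W₁⊆W : W₁ ⊆ W
    U⊆W  : U ⊆ W
    U#W₁ : ∀ v → U v ≡ true → W₁ v ≢ true
    pad  : ∀ {y z} → Z₁ y ≡ true → Walk (adj G) (In W) p y z → W₁ z ≡ true
    leg  : ∀ {y} → Z₁ y ≡ true → Leg G (In W₁) ℓ U y
    joined : ∀ {u u'} → U u ≡ true → U u' ≡ true → Walk (adj G) (In U) (R + R) u u'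
    dense : α * # Z₁ < β * arcs G Z₁

arcs⇒vertex : ∀ {n} (G : Graph n) Z → 0 < arcs G Z → ∃[ v ] Z v ≡ true
arcs⇒vertex G Z lt with 0<∑∑⇒∃ _ lt
... | u , v , lt' = u , ∧⁻ˡ {Z u} (proj₁ (0<on {Z u ∧ Z v} lt'))

-- Chosen so that there are b + 1 = 2(3x + 1) offsets and the best one destroys at most 1/(3x + 1)
-- of the arcs.
bands : ℕ → ℕ
bands x = 6 * x + 1

module SlabStep {n} (G : Graph n) (W Z : Fin n → Bool) (Z⊆W : Z ⊆ W) (L : ℕ) (n²<2^L : n * n < 2 ^ L)
  (α β x' p Δ : ℕ) (deg : ∀ u → ∑ (λ v → 𝟙 (adj G u v)) ≤ Δ)
  (start : suc (suc x') * (α * # Z) < suc x' * (β * arcs G Z)) (b : ℕ) (b-def : b ≡ bands (suc x')) where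

  x : ℕ
  x = suc x'

  open Periods b p

  h : Fin n → Fin n → Bool
  h u v = (W u ∧ W v) ∧ adj G u v

  h⇒adj : ∀ {u v} → h u v ≡ true → adj G u v ≡ true
  h⇒adj {u} {v} = ∧⁻ʳ {W u ∧ W v}

  h-sym : Symmetric h
  h-sym u v e = ∧⁺ (∧⁺ (∧⁻ʳ {W u} (∧⁻ˡ {W u ∧ W v} e)) (∧⁻ˡ {W u} (∧⁻ˡ {W u ∧ W v} e))) (trans (Graph.sym G v u) (h⇒adj {u} e))

  outW : ∀ {P k y z} → W y ≡ true → Walk h P k y z → Walk (adj G) (λ v → W v ≡ true × P v) k y z
  outW Wy (stop q) = stop (Wy , q)
  outW {y = y} Wy (step {y = y'} q e w) = step (Wy , q) (h⇒adj {y} e) (outW (∧⁻ʳ {W y} (∧⁻ˡ {W y ∧ W y'} e)) w)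

  intoW : ∀ {k y z} → Walk (adj G) (In W) k y z → Walk h (In W) k y z
  intoW (stop q) = stop q
  intoW (step q e w) = step q (∧⁺ (∧⁺ q (startʷ w)) e) (intoW w)

  w : Fin n → Fin n → ℕ
  w = (λ u v → 𝟙 (adj G u v)) ↾ Z

  w⇒h : ∀ u v → 0 < w u v → h u v ≡ true
  w⇒h u v lt with 0<on {Z u ∧ Z v} lt
  ... | zz , a = ∧⁺ (∧⁺ (Z⊆W u (∧⁻ˡ {Z u} zz)) (Z⊆W v (∧⁻ʳ {Z u} zz))) (0<𝟙 a)

  w<2^L : ∑∑ w < 2 ^ L
  w<2^L = ≤-<-trans (≤-trans (↾-≤ (λ u v → 𝟙 (adj G u v)) Z) (∑∑-𝟙≤ (adj G))) n²<2^L

  -- The decomposition and the gaps cost a factor 1 + 1/(3x) each. The budget 1 + 1/x suffices,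
  -- because (3x + 1)² ≤ 9x(x + 1).
  open Decomposition h w (λ v → 𝟙 (Z v)) h-sym w⇒h (3 * x) L w<2^L ((3 * x + 1) * α) (3 * x * β)

  start' : suc (3 * x) * ((3 * x + 1) * α * # Z) < 3 * x * (3 * x * β * ∑∑ w)
  start' = arith x' α β (# Z) (∑∑ w) start
    where
    arith : ∀ x' α β z e → suc (suc x') * (α * z) < suc x' * (β * e) →
            suc (3 * suc x') * ((3 * suc x' + 1) * α * z) < 3 * suc x' * (3 * suc x' * β * e)
    arith x' α β z e lt = linear (9 * x' + 8 + (3 * x' + 2) * (α * z)) (*-monoʳ-≤ (9 * suc x') lt) (ring x' α β z e)
      where
      ring : ∀ x' α β z e → suc (suc (3 * suc x') * ((3 * suc x' + 1) * α * z)) + 9 * suc x' * (suc x' * (β * e)) + (9 * x' + 8 + (3 * x' + 2) * (α * z))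
             ≡ 3 * suc x' * (3 * suc x' * β * e) + 9 * suc x' * suc (suc (suc x') * (α * z))
      ring x' α β z e = solve (x' ∷ α ∷ β ∷ z ∷ e ∷ [])

  module FromPiece (pc : Piece) where
    open Piece pc renaming (set to P; root to r; radius to ρ; dense to P-dense)
    open BFS h (at r)

    N : ℕ
    N = suc ρ

    level : Fin n → ℕ
    level = lev N

    P⇒level : ∀ {v} → P v ≡ true → level v ≤ ρ
    P⇒level {v} q = ball⇒lev N {ρ} (inBall v q)

    pos : Fin (suc b) → Fin n → ℕ
    pos c v = level v + toℕ c * g

    w' : Fin n → Fin n → ℕ
    w' = w ↾ P

    killed : Fin (suc b) → Fin n → Fin n → ℕ
    killed c u v = on (gap (pos c u)) (w' u v) + on (gap (pos c v)) (w' u v)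

    killed-total : ∑ (λ c → ∑∑ (killed c)) ≤ 2 * ∑∑ w'
    killed-total = ≤-trans (≤-reflexive (trans (∑-swap (λ c u → ∑ (killed c u))) (∑-cong (λ u → ∑-swap (λ c v → killed c u v)))))
      (≤-trans (∑∑-mono pointwise) (≤-reflexive (∑∑-* 2 w')))
      where
      once : ∀ l y → ∑ (λ (c : Fin (suc b)) → on (gap (l + toℕ c * g)) y) ≤ y
      once l y = ≤-trans (≤-reflexive (trans (∑-cong (λ c → scale (gap (l + toℕ c * g)))) (∑-* y (λ c → 𝟙 (gap (l + toℕ c * g))))))
        (≤-trans (*-monoʳ-≤ y (gapCount b p l)) (≤-reflexive (*-identityʳ y)))
        where
        scale : ∀ a → on a y ≡ y * 𝟙 a
        scale true = symm (*-identityʳ y)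
        scale false = symm (*-zeroʳ y)
      pointwise : ∀ u v → ∑ (λ c → killed c u v) ≤ 2 * w' u v
      pointwise u v = ≤-trans (≤-reflexive (∑-+ (λ c → on (gap (pos c u)) (w' u v)) (λ c → on (gap (pos c v)) (w' u v))))
        (+-mono-≤ (once (level u) (w' u v)) (≤-trans (once (level v) (w' u v)) (≤-reflexive (symm (+-identityʳ _)))))

    module FromOffset (c : Fin (suc b)) (c-least : suc b * ∑∑ (killed c) ≤ 2 * ∑∑ w') where

      position : Fin n → ℕ
      position = pos c

      wᵍ : Fin n → Fin n → ℕ
      wᵍ u v = on (not (gap (position u)) ∧ not (gap (position v))) (w' u v)

      Zⁱ : ℕ → Fin n → Bool
      Zⁱ i v = (Z v ∧ P v) ∧ (not (gap (position v)) ∧ ⌊ quo (position v) ≟ℕ i ⌋)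

      I : ℕ
      I = suc (N + b * g)

      quo<I : ∀ v → quo (position v) < I
      quo<I v = s≤s (≤-trans (≤-trans (≤-trans (m≤m*n (quo (position v)) Π) (m≤n+m _ (rem (position v)))) (≤-reflexive (symm (decompose (position v)))))
                  (+-mono-≤ (lev-≤N N v) (*-monoˡ-≤ g (s≤s⁻¹ (toℕ<n c)))))

      position-edge : ∀ {u v} → h u v ≡ true → position v ≤ suc (position u)
      position-edge e = +-monoˡ-≤ (toℕ c * g) (lev-step N e)

      survivors : ∑∑ w' ≤ ∑∑ wᵍ + ∑∑ (killed c)
      survivors = ≤-trans (∑∑-mono pointwise) (≤-reflexive (∑∑-+ wᵍ (killed c)))
        where
        pointwise : ∀ u v → w' u v ≤ wᵍ u v + killed c u v
        pointwise u v with gap (position u) | gap (position v)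
        ... | true | true = m≤m+n _ _
        ... | true | false = m≤m+n _ _
        ... | false | true = ≤-refl
        ... | false | false = m≤m+n _ _

      pieces : ∑∑ wᵍ ≤ ∑ {I} (λ i → arcs G (Zⁱ (toℕ i)))
      pieces = ≤-trans (∑∑-mono pointwise) (≤-reflexive (trans (∑-cong (λ u → ∑-swap (λ v (i : Fin I) → a i u v))) (∑-swap (λ u (i : Fin I) → ∑ (a i u)))))
        where
        a : Fin I → Fin n → Fin n → ℕ
        a i = (λ u v → 𝟙 (adj G u v)) ↾ Zⁱ (toℕ i)
        pointwise : ∀ u v → wᵍ u v ≤ ∑ (λ i → a i u v)
        pointwise u v with wᵍ u v in eq
        ... | zero = z≤n
        ... | suc k with 0<on {not (gap (position u)) ∧ not (gap (position v))} (subst (0 <_) (symm eq) z<s)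
        ... | gg , pos₁ with 0<on {P u ∧ P v} pos₁
        ... | pp , pos₂ with 0<on {Z u ∧ Z v} pos₂
        ... | zz , _ = ≤-trans (≤-reflexive (symm eq)) (≤-trans (≤-trans (on-≤ (not (gap (position u)) ∧ not (gap (position v)))) (≤-trans (on-≤ (P u ∧ P v)) (on-≤ (Z u ∧ Z v))))
              (≤-trans (≤-reflexive (cong (λ t → on t (𝟙 (adj G u v))) (symm member))) (∑-≥ (λ i → a i u v) i)))
          where
          e : h u v ≡ true
          e = w⇒h u v pos₂
          i : Fin I
          i = fromℕ< (quo<I u)
          i≡ : quo (position u) ≡ toℕ i
          i≡ = symm (toℕ-fromℕ< (quo<I u))
          gu : not (gap (position u)) ≡ true
          gu = ∧⁻ˡ {not (gap (position u))} gg
          gv : not (gap (position v)) ≡ true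
          gv = ∧⁻ʳ {not (gap (position u))} gg
          same : quo (position v) ≡ toℕ i
          same = trans (symm (samePeriod (position-edge (h-sym u v e)) (position-edge e) (not⁻ gu) (not⁻ gv))) i≡
          member : Zⁱ (toℕ i) u ∧ Zⁱ (toℕ i) v ≡ true
          member = ∧⁺ (∧⁺ (∧⁺ (∧⁻ˡ {Z u} zz) (∧⁻ˡ {P u} pp)) (∧⁺ gu (⌊⌋⁺ {d = quo (position u) ≟ℕ toℕ i} i≡)))
                      (∧⁺ (∧⁺ (∧⁻ʳ {Z u} zz) (∧⁻ʳ {P u} pp)) (∧⁺ gv (⌊⌋⁺ {d = quo (position v) ≟ℕ toℕ i} same)))

      sizes : ∑ {I} (λ i → # (Zⁱ (toℕ i))) ≤ ∑ ((λ v → 𝟙 (Z v)) ↿ P)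
      sizes = ≤-trans (≤-reflexive (∑-swap (λ i v → 𝟙 (Zⁱ (toℕ i) v)))) (∑-mono perVertex)
        where
        perVertex : ∀ v → ∑ {I} (λ i → 𝟙 (Zⁱ (toℕ i) v)) ≤ on (P v) (𝟙 (Z v))
        perVertex v with Z v | P v
        ... | false | _ = ∑-zero-≤ {I}
        ... | true | false = ∑-zero-≤ {I}
        ... | true | true = ∑-unique {I} (λ i → not (gap (position v)) ∧ ⌊ quo (position v) ≟ℕ toℕ i ⌋)
              (λ i j p q → toℕ-injective (trans (symm (⌊⌋⁻ (∧⁻ʳ {not (gap (position v))} p))) (⌊⌋⁻ (∧⁻ʳ {not (gap (position v))} q))))

      densePiece : ∃[ i ] α * # (Zⁱ (toℕ {I} i)) < β * arcs G (Zⁱ (toℕ i))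
      densePiece = ∑-<⇒∃ _ _ (<-≤-trans (≤-<-trans (≤-trans (≤-reflexive (∑-* α _)) (*-monoʳ-≤ α sizes)) (arith x' P-dense halfKilled survivors))
                     (≤-trans (*-monoʳ-≤ β pieces) (≤-reflexive (symm (∑-* β _)))))
        where
        halfKilled : (3 * x + 1) * ∑∑ (killed c) ≤ ∑∑ w'
        halfKilled = *-cancelˡ-≤ 2 (≤-trans (≤-reflexive (trans (ring x (∑∑ (killed c))) (cong (λ t → suc t * ∑∑ (killed c)) (symm b-def)))) c-least)
          where
          ring : ∀ x k → 2 * ((3 * x + 1) * k) ≡ suc (6 * x + 1) * k
          ring x k = solve (x ∷ k ∷ [])
        arith : ∀ x' {m e k s} → (3 * suc x' + 1) * α * m < 3 * suc x' * β * e → (3 * suc x' + 1) * k ≤ e → e ≤ s + k → α * m < β * s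
        arith x' {m} {e} {k} {s} h₁ h₂ h₃ = *-cancelˡ-< (3 * suc x' + 1) _ _ (linear 0
          (+-mono-≤ h₁ (+-mono-≤ (*-monoʳ-≤ β h₂) (*-monoʳ-≤ (β * (3 * suc x' + 1)) h₃))) (ring x' α β m e k s))
          where
          ring : ∀ x' α β m e k s → suc ((3 * suc x' + 1) * (α * m)) + (3 * suc x' * β * e + (β * e + β * (3 * suc x' + 1) * (s + k))) + 0
                 ≡ (3 * suc x' + 1) * (β * s) + (suc ((3 * suc x' + 1) * α * m) + (β * ((3 * suc x' + 1) * k) + β * (3 * suc x' + 1) * e))
          ring x' α β m e k s = solve (x' ∷ α ∷ β ∷ m ∷ e ∷ k ∷ s ∷ [])

      core-rem : ∀ {i} v → Zⁱ i v ≡ true → rem (position v) < b * g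
      core-rem v q = ¬gap⇒< (not⁻ (∧⁻ˡ {not (gap (position v))} (∧⁻ʳ {Z v ∧ P v} q)))

      core-position : ∀ {i} v → Zⁱ i v ≡ true → position v ≡ rem (position v) + i * Π
      core-position {i} v q = trans (decompose (position v)) (cong (λ j → rem (position v) + j * Π) (⌊⌋⁻ (∧⁻ʳ {not (gap (position v))} (∧⁻ʳ {Z v ∧ P v} q))))

      core-level : ∀ {i} v → Zⁱ i v ≡ true → level v ≤ ρ
      core-level v q = P⇒level (∧⁻ʳ {Z v} (∧⁻ˡ {Z v ∧ P v} q))

      core⊆Z : ∀ {i} v → Zⁱ i v ≡ true → Z v ≡ true
      core⊆Z v q = ∧⁻ˡ {Z v} (∧⁻ˡ {Z v ∧ P v} q)

      -- The first period may have nothing above it to serve as `U`. But it lies within distance `Π`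
      -- of the root, and bounded degree makes it small.
      topSmall : # (Zⁱ 0) ≤ suc Δ ^ Π
      topSmall = ≤-trans (#-mono inside) (≤-trans (ball-size Δ (λ u → ≤-trans (∑-mono (λ v → ⇒𝟙≤ (h⇒adj {u}))) (deg u)) Π)
        (≤-trans (*-monoʳ-≤ (suc Δ ^ Π) (#-single r)) (≤-reflexive (*-identityʳ _))))
        where
        inside : Zⁱ 0 ⊆ ball Π
        inside v q = ball-mono (≤-trans (m≤m+n (level v) (toℕ c * g)) (≤-trans (≤-reflexive (trans (core-position v q) (+-identityʳ _))) (<⇒≤ (rem<Π (position v)))))
                       v (lev⇒ball N (s≤s (core-level v q)))

      module At (k A : ℕ) (A-def : suc k * Π ≡ A) (Z-dense : α * # (Zⁱ (suc k)) < β * arcs G (Zⁱ (suc k))) where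

        W₁ U : Fin n → Bool
        -- `A` is the first position of the period. The slab consists of the band, the p positions
        -- before it and the gap after it, so walks of length p from the core cannot leave it.
        W₁ v = W v ∧ (⌊ A <? position v + g ⌋ ∧ ⌊ position v <? A + Π ⌋)
        U v = W v ∧ ⌊ position v + g ≤? A ⌋

        W₁⁺ : ∀ {v} → W v ≡ true → A < position v + g → position v < A + Π → W₁ v ≡ true
        W₁⁺ {v} Wv lo hi = ∧⁺ Wv (∧⁺ {⌊ A <? position v + g ⌋} (⌊⌋⁺ lo) (⌊⌋⁺ {d = position v <? A + Π} hi))

        U⁺ : ∀ {v} → W v ≡ true → position v + g ≤ A → U v ≡ true
        U⁺ {v} Wv le = ∧⁺ Wv (⌊⌋⁺ {d = position v + g ≤? A} le)

        U⁻ : ∀ {v} → U v ≡ true → position v + g ≤ A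
        U⁻ {v} q = ⌊⌋⁻ (∧⁻ʳ {W v} q)

        core-lo : ∀ {y} → Zⁱ (suc k) y ≡ true → A ≤ position y
        core-lo {y} q = ≤-trans (m≤n+m A (rem (position y))) (≤-reflexive (symm (trans (core-position y q) (cong (rem (position y) +_) A-def))))

        core-hi : ∀ {y} → Zⁱ (suc k) y ≡ true → position y < A + b * g
        core-hi {y} q = ≤-trans (s≤s (≤-reflexive (trans (core-position y q) (cong (rem (position y) +_) A-def)))) (≤-trans (+-monoˡ-≤ A (core-rem y q)) (≤-reflexive (+-comm (b * g) A)))

        padded : ∀ {y z} → Zⁱ (suc k) y ≡ true → Walk (adj G) (In W) p y z → W₁ z ≡ true
        padded {y} {z} q wk = W₁⁺ (endʷ wk)
          (lower {level y} {level z} {toℕ c * g} {A} (core-lo q) (lev-walk N (reverseʷ h-sym (intoW wk))))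
          (upper {level y} {level z} {toℕ c * g} {A} {b * g} (core-hi q) (lev-walk N (intoW wk)))
          where
          lower : ∀ {ly lz C A} → A ≤ ly + C → ly ≤ lz + p → A < lz + C + suc p
          lower {ly} {lz} {C} {A} h₁ h₂ = linear 0 (+-mono-≤ h₁ h₂) (ring ly lz C A p)
            where
            ring : ∀ ly lz C A p → suc A + (ly + C + (lz + p)) + 0 ≡ lz + C + suc p + (A + ly)
            ring ly lz C A p = solve (ly ∷ lz ∷ C ∷ A ∷ p ∷ [])
          upper : ∀ {ly lz C A B} → ly + C < A + B → lz ≤ ly + p → lz + C < A + (suc p + B)
          upper {ly} {lz} {C} {A} {B} h₁ h₂ = linear 1 (+-mono-≤ h₁ h₂) (ring ly lz C A B p)
            where
            ring : ∀ ly lz C A B p → suc (lz + C) + (A + B + (ly + p)) + 1 ≡ A + (suc p + B) + (suc (ly + C) + lz)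
            ring ly lz C A B p = solve (ly ∷ lz ∷ C ∷ A ∷ B ∷ p ∷ [])

        coreVertex : ∃[ y ] Zⁱ (suc k) y ≡ true
        coreVertex = arcs⇒vertex G (Zⁱ (suc k)) (0<factorʳ β (≤-<-trans z≤n Z-dense))

        -- Truncated levels are true distances only below `N`. A core vertex, which is at most at
        -- level ρ and deeper than all of `U`, shows that `U` stays in that range.
        U-level : ∀ {u} → U u ≡ true → level u < ρ
        U-level {u} q = from coreVertex
          where
          below : ∀ {lu ly C A} → lu + C + suc p ≤ A → A ≤ ly + C → lu < ly
          below {lu} {ly} {C} {A} h₁ h₂ = linear p (+-mono-≤ h₁ h₂) (ring lu ly C A p)
            where
            ring : ∀ lu ly C A p → suc lu + (A + (ly + C)) + p ≡ ly + (lu + C + suc p + A)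
            ring lu ly C A p = solve (lu ∷ ly ∷ C ∷ A ∷ p ∷ [])
          from : ∃[ y ] Zⁱ (suc k) y ≡ true → level u < ρ
          from (y , Zy) = ≤-trans (below {level u} {level y} {toℕ c * g} {A} (U⁻ q) (core-lo Zy)) (core-level y Zy)

        toRoot : ∀ {u} → U u ≡ true → Walk (adj G) (In U) ρ u r
        toRoot {u} q = from (climb N h-sym (level u) 0 (symm (+-identityʳ _)) (≤-trans (s≤s (≤-reflexive (+-identityʳ _))) (≤-trans (U-level q) (n≤1+n ρ))))
          where
          above : ∀ {v} → W v ≡ true × 0 ≤ level v × level v ≤ level u + 0 → U v ≡ true
          above (Wv , _ , le) = U⁺ Wv (≤-trans (+-monoˡ-≤ g (+-monoˡ-≤ (toℕ c * g) (≤-trans le (≤-reflexive (+-identityʳ _))))) (U⁻ q))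
          from : ∃[ s ] level s ≡ 0 × Walk h (λ v → 0 ≤ level v × level v ≤ level u + 0) (level u) u s → Walk (adj G) (In U) ρ u r
          from (s , ls , wk) = subst (Walk (adj G) (In U) ρ u) (⌊⌋⁻ (lev-source N ls z<s))
            (weaken (<⇒≤ (U-level q)) (mapʷ id above (outW (∧⁻ˡ {W u} q) wk)))

        -- U consists of the levels up to j.
        j : ℕ
        j = A ∸ suc (toℕ c) * g

        -- The subtraction is exact because the period is not the first one: (c + 1) g ≤ Π ≤ A.
        j-spec : j + suc (toℕ c) * g ≡ A
        j-spec = m∸n+n≡m (≤-trans (*-monoˡ-≤ g (toℕ<n c)) (≤-trans (m≤m+n Π (k * Π)) (≤-reflexive A-def)))

        module DownLeg {y} (q : Zⁱ (suc k) y ≡ true) (d : ℕ) (y-level : level y ≡ d + suc j) where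
          inSlab : ∀ {v} → W v ≡ true × suc j ≤ level v × level v ≤ d + suc j → W₁ v ≡ true
          inSlab {v} (Wv , lo , hi) = W₁⁺ Wv (lower {j} {level v} {toℕ c} {A} j-spec lo)
            (≤-trans (s≤s (+-monoˡ-≤ (toℕ c * g) (≤-trans hi (≤-reflexive (symm y-level))))) (≤-trans (core-hi q) (+-monoʳ-≤ A (m≤n+m (b * g) g))))
            where
            lower : ∀ {j l c A} → j + suc c * g ≡ A → suc j ≤ l → A < l + c * g + g
            lower {j} {l} {c} refl h = linear 0 h (ring j l c g)
              where
              ring : ∀ j l c g → suc (j + suc c * g) + l + 0 ≡ l + c * g + g + suc j
              ring j l c g = solve (j ∷ l ∷ c ∷ g ∷ [])
          d≤Π : d ≤ Π
          d≤Π = bound {j} {level y} {toℕ c} {A} {b * g} y-level j-spec (core-hi q)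
            where
            bound : ∀ {j l c A B} → l ≡ d + suc j → j + suc c * g ≡ A → l + c * g < A + B → d ≤ g + B
            bound {j} {c = c} {B = B} refl refl h = linear 2 h (ring j d c B g)
              where
              ring : ∀ j d c B g → d + (j + suc c * g + B) + 2 ≡ g + B + suc (d + suc j + c * g)
              ring j d c B g = solve (j ∷ d ∷ c ∷ B ∷ g ∷ [])
          y-low : d + suc j < N
          y-low = s≤s (≤-trans (≤-reflexive (symm y-level)) (core-level y q))
          below : ∀ z → (∃[ u ] h u z ≡ true × level u ≡ j) → Walk h (λ v → suc j ≤ level v × level v ≤ d + suc j) d y z → Leg G (In W₁) Π U y
          below z (u , e , lu) wk = z , u , weaken d≤Π (mapʷ id inSlab (outW (Z⊆W y (core⊆Z y q)) wk)) , h⇒adj {z} (h-sym u z e) ,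
            U⁺ (∧⁻ˡ {W u} (∧⁻ˡ {W u ∧ W z} e)) (≤-reflexive (trans (cong (λ t → t + toℕ c * g + g) lu) (trans (assoc j (toℕ c) g) j-spec)))
            where
            assoc : ∀ j c g → j + c * g + g ≡ j + suc c * g
            assoc j c g = solve (j ∷ c ∷ g ∷ [])
          from : ∃[ z ] level z ≡ suc j × Walk h (λ v → suc j ≤ level v × level v ≤ d + suc j) d y z → Leg G (In W₁) Π U y
          from (z , lz , wk) = below z (lev-pred N lz (≤-<-trans (m≤n+m (suc j) d) y-low)) wk
          leg : Leg G (In W₁) Π U y
          leg = from (climb N h-sym d (suc j) y-level y-low)

        downLeg : ∀ {y} → Zⁱ (suc k) y ≡ true → Leg G (In W₁) Π U y
        downLeg {y} q = from (m≤n⇒∃[o]m+o≡n (above {j} {level y} {toℕ c} {A} j-spec (core-lo q)))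
          where
          above : ∀ {j l c A} → j + suc c * g ≡ A → A ≤ l + c * g → suc j ≤ l
          above {j} {l} {c} refl h = linear p h (ring j l c p)
            where
            ring : ∀ j l c p → suc j + (l + c * suc p) + p ≡ l + (j + suc c * suc p)
            ring j l c p = solve (j ∷ l ∷ c ∷ p ∷ [])
          from : ∃[ d ] suc j + d ≡ level y → Leg G (In W₁) Π U y
          from (d , eq) = DownLeg.leg q d (trans (symm eq) (+-comm (suc j) d))

        slab : Slab G W Z α β p Π (3 * x * L + 1)
        slab = record
          { W₁ = W₁ ; Z₁ = Zⁱ (suc k) ; U = U
          ; Z₁⊆Z = λ v → core⊆Z v
          ; W₁⊆W = λ v → ∧⁻ˡ {W v}
          ; U⊆W = λ v → ∧⁻ˡ {W v}
          ; U#W₁ = λ v q q' → <-irrefl refl (<-≤-trans (⌊⌋⁻ (∧⁻ˡ {⌊ A <? position v + g ⌋} (∧⁻ʳ {W v} q'))) (U⁻ q))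
          ; pad = padded
          ; leg = downLeg
          ; joined = λ q q' → weaken (+-mono-≤ short short) (toRoot q ++ʷ reverseʷ (λ u v e → trans (Graph.sym G v u) e) (toRoot q'))
          ; dense = Z-dense }

      finish : ∀ i → α * # (Zⁱ i) < β * arcs G (Zⁱ i) → SmallDense G Z α β (suc Δ ^ Π) ⊎ Slab G W Z α β p Π (3 * x * L + 1)
      finish zero dense = inj₁ (Zⁱ 0 , (λ v → core⊆Z v) , topSmall , dense)
      finish (suc k) dense = inj₂ (At.slab k (suc k * Π) refl dense)

      finished : SmallDense G Z α β (suc Δ ^ Π) ⊎ Slab G W Z α β p Π (3 * x * L + 1)
      finished = finish (toℕ (proj₁ densePiece)) (proj₂ densePiece)

    fromOffset : ∃[ c ] suc b * ∑∑ (killed c) ≤ ∑ (λ c → ∑∑ (killed c)) → SmallDense G Z α β (suc Δ ^ Π) ⊎ Slab G W Z α β p Π (3 * x * L + 1)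
    fromOffset (c , le) = FromOffset.finished c (≤-trans le killed-total)

    fromPiece : SmallDense G Z α β (suc Δ ^ Π) ⊎ Slab G W Z α β p Π (3 * x * L + 1)
    fromPiece = fromOffset (∑-least (λ c → ∑∑ (killed c)))

  opaque
    slabStep : SmallDense G Z α β (suc Δ ^ (suc b * suc p)) ⊎ Slab G W Z α β p (suc b * suc p) (3 * suc x' * L + 1)
    slabStep = FromPiece.fromPiece (piece start')

-- Bounded degree: nested slabs.

-- Padding speaks about end points of walks; applied to initial segments it controls every vertex of
-- a walk.
prefixʷ : ∀ {n} {h : Fin n → Fin n → Bool} {P k y z} → Walk h P k y z → Walk h (λ v → P v × Walk h P k y v) k y z
prefixʷ (stop p) = stop (p , stop p)
prefixʷ (step p e w) = step (p , stop p) e (mapʷ id (λ (q , w') → q , step p e w') (prefixʷ w))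

Avoids : ∀ {n T} → (Fin T → Fin n → Bool) → Fin n → Set
Avoids U v = ∀ i → U i v ≢ true

-- `inner` is a zone without vertices of any `U` that contains all walks of length p in `W` from the
-- core. An enclosing round relies on it: its own leg, of length p, avoids all sets found further
-- inside.
record Hub {n} (G : Graph n) (W Z : Fin n → Bool) (α β T p ℓ R : ℕ) : Set where
  field
    core inner : Fin n → Bool
    U       : Fin T → Fin n → Bool
    core⊆Z  : core ⊆ Z
    U⊆W     : ∀ j → U j ⊆ W
    inner⊆W : inner ⊆ W
    U#inner : ∀ j v → U j v ≡ true → inner v ≢ true
    U#U     : ∀ {i j} v → U i v ≡ true → U j v ≡ true → i ≡ j
    pad     : ∀ {y z} → core y ≡ true → Walk (adj G) (In W) p y z → inner z ≡ true
    leg     : ∀ j {y} → core y ≡ true → Leg G (λ v → W v ≡ true × Avoids U v) ℓ (U j) y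
    joined  : ∀ j {u u'} → U j u ≡ true → U j u' ≡ true → Walk (adj G) (In (U j)) (R + R) u u'
    dense   : α * # core < β * arcs G core

module HubBounds (b Δ : ℕ) where
  -- Both the length of a leg in a slab with padding p and the padding required of the rounds inside
  -- that slab, hence the iteration below.
  width : ℕ → ℕ
  width p = suc b * suc p

  smallSize legLength : ℕ → ℕ → ℕ
  smallSize zero p = 0
  smallSize (suc T) p = suc Δ ^ width p + smallSize T (width p)
  legLength zero p = 0
  legLength (suc T) p = width p + legLength T (width p)

module Hubs {n} (G : Graph n) (L : ℕ) (n²<2^L : n * n < 2 ^ L) (α β x' Δ : ℕ) (deg : ∀ u → ∑ (λ v → 𝟙 (adj G u v)) ≤ Δ)
  (s' : ℕ) (b : ℕ) (b-def : b ≡ bands (suc x')) where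

  s : ℕ
  s = suc s'

  open HubBounds b Δ

  R : ℕ
  R = 3 * suc x' * L + 1

  cancel : ∀ T {c e} → (s + T) * α * c < s * β * e → α * c < β * e
  cancel T {c} {e} lt = *-cancelˡ-< s _ _ (≤-<-trans (≤-reflexive (symm (*-assoc s α c)))
    (≤-<-trans (*-monoˡ-≤ c (*-monoˡ-≤ α (m≤m+n s T))) (<-≤-trans lt (≤-reflexive (*-assoc s β e)))))

  -- A hub with T sets to find has slack (s + T)/s over α/β. One round lowers T by one, which
  -- releases a factor 1 + 1/(s + T); this covers its cost 1 + 1/x as s + T ≤ x.
  advance : ∀ T {c e} → s + T ≤ suc x' → (s + suc T) * α * c < s * β * e → suc (suc x') * ((s + T) * α * c) < suc x' * (s * β * e)
  advance T {c} {e} h lt = linear x' (+-mono-≤ (*-monoˡ-≤ (α * c) h) (*-monoʳ-≤ (suc x') lt)) (ring x' s' T α c (s * β * e))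
    where
    ring : ∀ x' s' T α c e → suc (suc (suc x') * ((suc s' + T) * α * c)) + (suc x' * (α * c) + suc x' * e) + x'
           ≡ suc x' * e + ((suc s' + T) * (α * c) + suc x' * suc ((suc s' + suc T) * α * c))
    ring x' s' T α c e = solve (x' ∷ s' ∷ T ∷ α ∷ c ∷ e ∷ [])

  module Extend {W Z : Fin n → Bool} {α' β' T p : ℕ} (W-slab : Slab G W Z α' β' p (width p) R)
    (H : Hub G (Slab.W₁ W-slab) (Slab.Z₁ W-slab) α β T (width p) (legLength T (width p)) R) where
    open Slab W-slab renaming (U to U₀; U⊆W to U₀⊆W; pad to pad₀; leg to leg₀; joined to joined₀; dense to dense₀)
    open Hub H

    V : Fin (suc T) → Fin n → Bool
    V zero = U₀
    V (suc j) = U j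

    V#V : ∀ {i j} v → V i v ≡ true → V j v ≡ true → i ≡ j
    V#V {zero} {zero} v _ _ = refl
    V#V {zero} {suc j} v q q' = ⊥-elim (U#W₁ v q (U⊆W j v q'))
    V#V {suc i} {zero} v q q' = ⊥-elim (U#W₁ v q' (U⊆W i v q))
    V#V {suc i} {suc j} v q q' = cong suc (U#U v q q')

    inner#V : ∀ j v → W₁ v ≡ true → inner v ≡ true → V j v ≢ true
    inner#V zero v w₁ _ q = U#W₁ v q w₁
    inner#V (suc j) v _ i q = U#inner j v q i

    padInner : ∀ {y z} → core y ≡ true → Walk (adj G) (In W₁) (width p) y z → inner z ≡ true
    padInner = pad

    p≤width : p ≤ width p
    p≤width = ≤-trans (n≤1+n p) (m≤m+n (suc p) (b * suc p))

    padW : ∀ {y z} → core y ≡ true → Walk (adj G) (In W) p y z → inner z ≡ true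
    padW {y} q wk = padInner q (weaken p≤width (mapʷ id (λ (_ , w') → pad₀ (core⊆Z y q) w') (prefixʷ wk)))

    LegV : Fin (suc T) → Fin n → Set
    LegV j y = Leg G (λ v → W v ≡ true × Avoids V v) (legLength (suc T) p) (V j) y

    legs : ∀ j {y} → core y ≡ true → LegV j y
    legs zero {y} q = from (leg₀ (core⊆Z y q))
      where
      from : Leg G (In W₁) (width p) U₀ y → LegV zero y
      from (z , u , wk , e , q') = z , u , weaken (m≤m+n _ _) (mapʷ id (λ {v} (w₁ , w') → W₁⊆W v w₁ , λ i → inner#V i v w₁ (padInner q w')) (prefixʷ wk)) , e , q'
    legs (suc j) {y} q = from (leg j q)
      where
      avoid : ∀ {v} → W₁ v ≡ true → Avoids U v → Avoids V v
      avoid {v} w₁ av zero q = U#W₁ v q w₁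
      avoid w₁ av (suc i) q = av i q
      from : Leg G (λ v → W₁ v ≡ true × Avoids U v) (legLength T (width p)) (U j) y → LegV (suc j) y
      from (z , u , wk , e , q') = z , u , weaken (m≤n+m _ (width p)) (mapʷ id (λ {v} (w₁ , av) → W₁⊆W v w₁ , avoid w₁ av) wk) , e , q'

    extended : Hub G W Z α β (suc T) p (legLength (suc T) p) R
    extended = record
      { core = core ; inner = inner ; U = V
      ; core⊆Z = λ v q → Z₁⊆Z v (core⊆Z v q)
      ; U⊆W = λ { zero → U₀⊆W ; (suc j) v q → W₁⊆W v (U⊆W j v q) }
      ; U#inner = λ { zero v q i → U#W₁ v q (inner⊆W v i) ; (suc j) → U#inner j }
      ; inner⊆W = λ v i → W₁⊆W v (inner⊆W v i)
      ; U#U = V#V ; pad = padW ; leg = legs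
      ; joined = λ { zero → joined₀ ; (suc j) → joined j }
      ; dense = dense }

  hub : ∀ T p W Z → Z ⊆ W → s + T ≤ suc x' → (s + T) * α * # Z < s * β * arcs G Z →
        SmallDense G Z α β (smallSize T p) ⊎ Hub G W Z α β T p (legLength T p) R
  hub zero p W Z Z⊆W _ dense = inj₂ (record
    { core = Z ; inner = W ; U = λ () ; core⊆Z = λ _ q → q ; U⊆W = λ () ; inner⊆W = λ _ q → q ; U#inner = λ () ; U#U = λ { {()} }
    ; pad = λ _ wk → endʷ wk ; leg = λ () ; joined = λ () ; dense = cancel 0 dense })
  hub (suc T) p W Z Z⊆W le dense = first (SlabStep.slabStep G W Z Z⊆W L n²<2^L ((s + T) * α) (s * β) x' p Δ deg (advance T le' dense) b b-def)
    where
    le' : s + T ≤ suc x'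
    le' = ≤-trans (+-monoʳ-≤ s (n≤1+n T)) le
    Goal : Set
    Goal = SmallDense G Z α β (smallSize (suc T) p) ⊎ Hub G W Z α β (suc T) p (legLength (suc T) p) R
    first : SmallDense G Z ((s + T) * α) (s * β) (suc Δ ^ width p) ⊎ Slab G W Z ((s + T) * α) (s * β) p (width p) R → Goal
    first (inj₁ (A , A⊆Z , small , A-dense)) = inj₁ (A , A⊆Z , ≤-trans small (m≤m+n _ _) , cancel T A-dense)
    first (inj₂ S) = second (hub T (width p) W₁ Z₁ core⊆W₁ le' dense₁)
      where
      open Slab S using (W₁; Z₁; Z₁⊆Z) renaming (dense to dense₁)
      core⊆W₁ : Z₁ ⊆ W₁
      core⊆W₁ v q = Slab.pad S q (stop (Z⊆W v (Z₁⊆Z v q)))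
      second : SmallDense G Z₁ α β (smallSize T (width p)) ⊎ Hub G W₁ Z₁ α β T (width p) (legLength T (width p)) R → Goal
      second (inj₁ (A , A⊆Z₁ , small , A-dense)) = inj₁ (A , (λ v q → Z₁⊆Z v (A⊆Z₁ v q)) , ≤-trans small (m≤n+m _ _) , A-dense)
      second (inj₂ H) = inj₂ (Extend.extended S H)

-- Bounded degree: fans of disjoint paths from one vertex.

module _ {n : ℕ} {h h' : Fin n → Fin n → Bool} {s : Fin n → Bool} (h⇒h' : ∀ {u v} → h u v ≡ true → h' u v ≡ true) where

  ball-host-mono : ∀ i → BFS.ball h s i ⊆ BFS.ball h' s i
  ball-host-mono zero v q = q
  ball-host-mono (suc i) v q with ∨⁻ {BFS.ball h s i v} q
  ... | inj₁ q' = ∨⁺ˡ (ball-host-mono i v q')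
  ... | inj₂ q' with some⁻ {P = λ u → BFS.ball h s i u ∧ h u v} q'
  ...   | u , e = BFS.ball-edge h' s {i} (ball-host-mono i u (∧⁻ˡ {BFS.ball h s i u} e)) (h⇒h' (∧⁻ʳ {BFS.ball h s i u} e))

-- As long as the ball has not stopped growing, each step adds at least one vertex.
growOrClose : ∀ {n} (h : Fin n → Fin n → Bool) (s : Fin n → Bool) → 0 < # s → ∀ N →
              (∃[ i ] i < N × BFS.ball h s (suc i) ⊆ BFS.ball h s i) ⊎ N < # (BFS.ball h s N)
growOrClose h s 0<s zero = inj₂ 0<s
growOrClose h s 0<s (suc N) with growOrClose h s 0<s N
... | inj₁ (i , lt , sub) = inj₁ (i , m≤n⇒m≤1+n lt , sub)
... | inj₂ big with # (BFS.ball h s N) <? # (BFS.ball h s (suc N))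
...   | yes lt = inj₂ (≤-trans (s≤s big) lt)
...   | no ¬lt = inj₁ (N , ≤-refl , closed)
  where
  open BFS h s
  closed : ball (suc N) ⊆ ball N
  closed v q = decide (ball N v) refl
    where
    decide : ∀ a → ball N v ≡ a → ball N v ≡ true
    decide true eq = eq
    decide false eq = ⊥-elim (¬lt (≤-trans (≤-trans (≤-reflexive (+-comm 1 (# (ball N)))) (+-monoʳ-≤ (# (ball N)) (∃⇒0<# {P = ball (suc N) ∖ ball N} v (∧⁺ q (cong not eq)))))
                  (≤-reflexive (symm (#-∖ {P = ball (suc N)} {ball N} (ball-mono {N} {suc N} (n≤1+n N)))))))

adj-sym : ∀ {n} (G : Graph n) → Symmetric (adj G)
adj-sym G u v e = trans (Graph.sym G v u) e

Route : ∀ {n} → Graph n → (Fin n → Bool) → (Fin n → Bool) → ℕ → Fin n → Set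
Route G F U c v = ∃[ z ] ∃[ u ] adj G v z ≡ true × Walk (adj G) (λ x → In F x ⊎ In U x) c z u × U u ≡ true

-- A set of this kind is either dense, and then a small dense set, or cheap to remove from `Z`:
-- apart from its inner arcs only δ arcs per vertex are lost in each direction.
record Closed {n} (G : Graph n) (Z : Fin n → Bool) (K δ : ℕ) : Set where
  field
    A : Fin n → Bool
    A⊆Z : A ⊆ Z
    vertex : Fin n
    vertex∈A : A vertex ≡ true
    small : # A ≤ K
    boundary : ∀ w → A w ≡ true → ∑ (λ u → 𝟙 ((Z ∖ A) u ∧ adj G w u)) ≤ δ

module FanBounds (Δ ℓ : ℕ) where
  -- `reach m` bounds the number of vertices within distance ℓ of a fan with m paths; a larger set
  -- has a vertex whose leg misses the fan. A further path then takes at most `reach m + ℓ`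
  -- vertices.
  reach fanSize closedSize : ℕ → ℕ
  reach m = suc Δ ^ ℓ * fanSize m
  fanSize zero = 0
  fanSize (suc m) = fanSize m + (reach m + ℓ)
  closedSize zero = 0
  closedSize (suc m) = closedSize m + suc Δ ^ reach m

module Fans {n} (G : Graph n) (Δ : ℕ) (deg : ∀ u → ∑ (λ v → 𝟙 (adj G u v)) ≤ Δ) {T : ℕ} (U : Fin T → Fin n → Bool)
  (ℓ : ℕ) (Z : Fin n → Bool)
  (Z#U : ∀ j v → Z v ≡ true → U j v ≢ true)
  (leg : ∀ j {y} → Z y ≡ true → Leg G (Avoids U) ℓ (U j) y) where

  open FanBounds Δ ℓ

  -- `few` is the gain from geodesics: a vertex of `Z` off the fan loses at most three neighbours to
  -- each path. `close` bounds the radius, so that fans at distant vertices are disjoint.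
  record Fan (v : Fin n) {m} (σ : Fin m → Fin T) : Set where
    field
      F     : Fin m → Fin n → Bool
      Q     : Fin n → Bool
      F⊆Q   : ∀ i → F i ⊆ Q
      F#F   : ∀ {i j} u → F i u ≡ true → F j u ≡ true → i ≡ j
      Q#U   : ∀ j u → Q u ≡ true → U j u ≢ true
      v∉Q   : Q v ≢ true
      size  : # Q ≤ fanSize m
      close : ∀ {u} → Q u ≡ true → Walk (adj G) (λ _ → ⊤) (fanSize m) v u
      route : ∀ i → Route G (F i) (U (σ i)) (fanSize m) v
      few   : ∀ w → Z w ≡ true → Q w ≢ true → ∑ (λ u → 𝟙 (Q u ∧ adj G w u)) ≤ 3 * m

  emptyFan : ∀ {v} (σ : Fin 0 → Fin T) → Fan v σ
  emptyFan σ = record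
    { F = λ () ; Q = λ _ → false ; F⊆Q = λ () ; F#F = λ { {()} } ; Q#U = λ _ _ () ; v∉Q = λ () ; size = ≤-reflexive (∑-zero {n})
    ; close = λ () ; route = λ () ; few = λ _ _ _ → ≤-reflexive (∑-zero {n}) }

  module ExtendFan {v : Fin n} (Zv : Z v ≡ true) {m : ℕ} (σ : Fin (suc m) → Fin T) (fan : Fan v (σ ∘ suc)) where
    open Fan fan

    N : ℕ
    N = reach m

    free : Fin n → Bool
    free u = not (Q u) ∧ not (some (λ j → U j u))

    free⁺ : ∀ {u} → Q u ≢ true → Avoids U u → free u ≡ true
    free⁺ {u} q av = ∧⁺ (not⁺ q) (not⁺ (λ e → let j , e' = some⁻ {P = λ j → U j u} e in av j e'))

    free⁻Q : ∀ {u} → free u ≡ true → Q u ≢ true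
    free⁻Q {u} f = not⁻ (∧⁻ˡ {not (Q u)} f)

    free⁻U : ∀ {u} → free u ≡ true → ∀ j → U j u ≢ true
    free⁻U {u} f j e = not⁻ (∧⁻ʳ {not (Q u)} f) (some⁺ {P = λ j → U j u} j e)

    -- Two graphs are needed. Exploration stays in `core`, so that getting stuck yields a closed
    -- subset of `Z`. The path is a geodesic of the larger `host`, because legs may leave `Z`;
    -- vertices of `Z` off the fan belong to `host`, so the bound of three neighbours applies to
    -- them.
    core host : Fin n → Fin n → Bool
    core u w = ((Z ∖ Q) u ∧ (Z ∖ Q) w) ∧ adj G u w
    host u w = (free u ∧ free w) ∧ adj G u w

    host-sym : Symmetric host
    host-sym u w e = ∧⁺ (∧⁺ (∧⁻ʳ {free u} (∧⁻ˡ {free u ∧ free w} e)) (∧⁻ˡ {free u} (∧⁻ˡ {free u ∧ free w} e))) (adj-sym G u w (∧⁻ʳ {free u ∧ free w} e))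

    Z∖Q⇒free : ∀ {u} → (Z ∖ Q) u ≡ true → free u ≡ true
    Z∖Q⇒free {u} e = free⁺ (not⁻ (∧⁻ʳ {Z u} e)) (λ j → Z#U j u (∧⁻ˡ {Z u} e))

    core⇒host : ∀ {u w} → core u w ≡ true → host u w ≡ true
    core⇒host {u} {w} e = ∧⁺ (∧⁺ (Z∖Q⇒free (∧⁻ˡ {(Z ∖ Q) u} (∧⁻ˡ {(Z ∖ Q) u ∧ (Z ∖ Q) w} e))) (Z∖Q⇒free (∧⁻ʳ {(Z ∖ Q) u} (∧⁻ˡ {(Z ∖ Q) u ∧ (Z ∖ Q) w} e))))
                             (∧⁻ʳ {(Z ∖ Q) u ∧ (Z ∖ Q) w} e)

    v∈Z∖Q : (Z ∖ Q) v ≡ true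
    v∈Z∖Q = ∧⁺ Zv (not⁺ v∉Q)

    module Core = BFS core (at v)
    module Host = BFS host (at v)
    module FromQ = BFS (adj G) Q

    core-ball : ∀ i → Core.ball i ⊆ (Z ∖ Q)
    core-ball zero u e = subst (λ x → (Z ∖ Q) x ≡ true) (symm (⌊⌋⁻ e)) v∈Z∖Q
    core-ball (suc i) u e with ∨⁻ {Core.ball i u} e
    ... | inj₁ e' = core-ball i u e'
    ... | inj₂ e' with some⁻ {P = λ x → Core.ball i x ∧ core x u} e'
    ...   | x , e'' = ∧⁻ʳ {(Z ∖ Q) x} (∧⁻ˡ {(Z ∖ Q) x ∧ (Z ∖ Q) u} (∧⁻ʳ {Core.ball i x} e''))

    -- The ball has stopped growing among the vertices of `Z` off `Q`, so its outside neighbours in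
    -- `Z` all lie in `Q`, where `few` counts them.
    closed : ∀ i → i ≤ N → Core.ball (suc i) ⊆ Core.ball i → Closed G Z (suc Δ ^ N) (3 * m)
    closed i i≤N sub = record
      { A = Core.ball i ; A⊆Z = λ u e → ∧⁻ˡ {Z u} (core-ball i u e)
      ; vertex = v ; vertex∈A = Core.ball-mono {0} {i} z≤n v (⌊⌋⁺ refl)
      ; small = ≤-trans (Core.ball-size Δ (λ u → ≤-trans (∑-mono (λ w → ⇒𝟙≤ (∧⁻ʳ {(Z ∖ Q) u ∧ (Z ∖ Q) w}))) (deg u)) i)
          (≤-trans (*-mono-≤ (^-monoʳ-≤ (suc Δ) i≤N) (Core.#-single v)) (≤-reflexive (*-identityʳ _)))
      ; boundary = λ w e → ≤-trans (∑-mono (λ u → ⇒𝟙≤ (toQ w e u))) (few w (∧⁻ˡ {Z w} (core-ball i w e)) (not⁻ (∧⁻ʳ {Z w} (core-ball i w e)))) }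
      where
      toQ : ∀ w → Core.ball i w ≡ true → ∀ u → (Z ∖ Core.ball i) u ∧ adj G w u ≡ true → Q u ∧ adj G w u ≡ true
      toQ w e u f with Q u in eq
      ... | true = ∧⁻ʳ {(Z ∖ Core.ball i) u} f
      ... | false = ⊥-elim (not⁻ (∧⁻ʳ {Z u} (∧⁻ˡ {(Z ∖ Core.ball i) u} f)) (sub u (Core.ball-edge {i} e
              (∧⁺ (∧⁺ (core-ball i w e) (∧⁺ (∧⁻ˡ {Z u} (∧⁻ˡ {(Z ∖ Core.ball i) u} f)) (cong not eq))) (∧⁻ʳ {(Z ∖ Core.ball i) u} f)))))

    -- A vertex whose leg misses Q can be found, since few vertices are within distance ℓ of Q.
    module Target (big : N < # (Core.ball N)) where
      Target₀ : Set
      Target₀ = ∃[ z ] ∃[ u ] Host.ball (N + ℓ) z ≡ true × adj G z u ≡ true × U (σ zero) u ≡ true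

      far : ∃[ y ] Core.ball N y ≡ true × FromQ.ball ℓ y ≢ true
      far = #-<⇒∃ (FromQ.ball ℓ) (Core.ball N) (≤-<-trans (≤-trans (FromQ.ball-size Δ deg ℓ) (*-monoʳ-≤ (suc Δ ^ ℓ) size)) big)

      target : Target₀
      target = from far
        where
        from : ∃[ y ] Core.ball N y ≡ true × FromQ.ball ℓ y ≢ true → Target₀
        from (y , y∈ , y∉) = along (leg (σ zero) (∧⁻ˡ {Z y} (core-ball N y y∈)))
          where
          offQ : ∀ {u} → Walk (adj G) (Avoids U) ℓ y u → Q u ≢ true
          offQ wk q = y∉ (FromQ.walk-ball {i = 0} q (reverseʷ (adj-sym G) wk))
          hostWalk : ∀ {k x z} → Walk (adj G) (λ u → Avoids U u × Walk (adj G) (Avoids U) ℓ y u) k x z → Walk host (λ _ → ⊤) k x z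
          hostWalk (stop q) = stop tt
          hostWalk (step (av , w) e wk) = step tt (∧⁺ (∧⁺ (free⁺ (offQ w) av) (free⁺ (offQ (proj₂ (startʷ wk))) (proj₁ (startʷ wk)))) e) (hostWalk wk)
          along : Leg G (Avoids U) ℓ (U (σ zero)) y → Target₀
          along (z , u , wk , e , q) = z , u , Host.walk-ball {i = N} (ball-host-mono core⇒host N y y∈) (hostWalk (prefixʷ wk)) , e , q

      M : ℕ
      M = suc (N + ℓ)

      level : Fin n → ℕ
      level = Host.lev M

      record NewPath : Set where
        field
          F₀    : Fin n → Bool
          low   : ∀ {x} → F₀ x ≡ true → 1 ≤ level x
          high  : ∀ {x} → F₀ x ≡ true → level x < M
          size₀ : # F₀ ≤ N + ℓ
          few₀  : ∀ w → ∑ (λ u → 𝟙 (F₀ u ∧ host w u)) ≤ 3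
          path₀ : Route G F₀ (U (σ zero)) (N + ℓ) v

      newPath : NewPath
      newPath = from target
        where
        from : Target₀ → NewPath
        from (z , u , z∈ , e , q) = go (level z) refl
          where
          z-level : level z ≤ N + ℓ
          z-level = Host.ball⇒lev M {N + ℓ} z∈
          go : ∀ d → level z ≡ d → NewPath
          -- At level 0 the vertex `z` is `v` itself, which is then adjacent to the target set, and
          -- no new vertices are needed.
          go zero eq = record
            { F₀ = λ _ → false ; low = λ () ; high = λ () ; size₀ = ∑-zero-≤ {n} ; few₀ = λ _ → ∑-zero-≤ {n}
            ; path₀ = u , u , subst (λ x → adj G x u ≡ true) (⌊⌋⁻ (Host.lev-source M eq z<s)) e , stop (inj₂ q) , q }
          go (suc d) eq = fromGeodesic (Host.geodesic M host-sym d eq (s≤s (≤-trans (≤-reflexive (symm eq)) z-level)))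
            where
            d<N+ℓ : suc d ≤ N + ℓ
            d<N+ℓ = ≤-trans (≤-reflexive (symm eq)) z-level
            fromGeodesic : Host.Geodesic M d z → NewPath
            fromGeodesic g = record
              { F₀ = set ; low = low ; high = λ q → s≤s (≤-trans (high q) d<N+ℓ) ; size₀ = ≤-trans g-size d<N+ℓ
              ; few₀ = Host.geodesic-degree g host-sym
              ; path₀ = first , u , start (Host.lev-pred M first₁ (s≤s (≤-trans (s≤s z≤n) d<N+ℓ))) ,
                  weaken d<N+ℓ (snocʷ (mapʷ (λ {a} {c} → ∧⁻ʳ {free a ∧ free c}) inj₁ (reverseʷ host-sym walk)) e (inj₂ q)) , q }
              where
              open Host.Geodesic g renaming (size to g-size)
              start : ∃[ x ] host x first ≡ true × level x ≡ 0 → adj G v first ≡ true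
              start (x , e' , lx) = subst (λ x → adj G x first ≡ true) (⌊⌋⁻ (Host.lev-source M lx z<s)) (∧⁻ʳ {free x ∧ free first} e')

      module AddPath (new : NewPath) where
        open NewPath new

        F₀-free : ∀ {x} → F₀ x ≡ true → free x ≡ true
        F₀-free {x} q = go (level x) refl
          where
          go : ∀ d → level x ≡ d → free x ≡ true
          go zero eq = ⊥-elim (n≮0 (subst (1 ≤_) eq (low q)))
          go (suc d) eq = from (Host.lev-pred M eq (subst (_< M) eq (high q)))
            where
            from : ∃[ u ] host u x ≡ true × level u ≡ d → free x ≡ true
            from (u , e , _) = ∧⁻ʳ {free u} (∧⁻ˡ {free u ∧ free x} e)

        F' : Fin (suc m) → Fin n → Bool
        F' zero = F₀
        F' (suc i) = F i

        Q' : Fin n → Bool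
        Q' u = F₀ u ∨ Q u

        F'#F' : ∀ {i j} u → F' i u ≡ true → F' j u ≡ true → i ≡ j
        F'#F' {zero} {zero} u _ _ = refl
        F'#F' {zero} {suc j} u q q' = ⊥-elim (free⁻Q (F₀-free q) (F⊆Q j u q'))
        F'#F' {suc i} {zero} u q q' = ⊥-elim (free⁻Q (F₀-free q') (F⊆Q i u q))
        F'#F' {suc i} {suc j} u q q' = cong suc (F#F u q q')

        split : ∀ {a} u (b : Bool) → 𝟙 ((a ∨ Q u) ∧ b) ≤ 𝟙 (a ∧ b) + 𝟙 (Q u ∧ b)
        split {true} u true = s≤s z≤n
        split {true} u false = z≤n
        split {false} u b = ≤-refl

        walkTo : ∀ {u} → F₀ u ≡ true → Walk (adj G) (λ _ → ⊤) (N + ℓ) v u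
        walkTo {u} q = from (Host.climb M host-sym (level u) 0 (symm (+-identityʳ _)) (≤-trans (s≤s (≤-reflexive (+-identityʳ _))) (high q)))
          where
          from : ∃[ s ] level s ≡ 0 × Walk host (λ x → 0 ≤ level x × level x ≤ level u + 0) (level u) u s → Walk (adj G) (λ _ → ⊤) (N + ℓ) v u
          from (s , ls , wk) = weaken (s≤s⁻¹ (high q)) (subst (λ s → Walk (adj G) (λ _ → ⊤) (level u) s u) (⌊⌋⁻ (Host.lev-source M ls z<s))
            (mapʷ (λ {a} {c} → ∧⁻ʳ {free a ∧ free c}) (λ _ → tt) (reverseʷ host-sym wk)))

        v-level : level v ≡ 0
        v-level = Host.source-lev M (⌊⌋⁺ refl)

        v∉F₀ : F₀ v ≢ true
        v∉F₀ q = n≮0 (subst (1 ≤_) v-level (low q))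

        few' : ∀ w → Z w ≡ true → Q' w ≢ true → ∑ (λ u → 𝟙 (Q' u ∧ adj G w u)) ≤ 3 * suc m
        few' w Zw w∉ = ≤-trans (∑-≤-+ (λ u → split {F₀ u} u (adj G w u))) (≤-trans (+-mono-≤
          (≤-trans (∑-mono (λ u → ⇒𝟙≤ (toHost u))) (few₀ w)) (few w Zw w∉Q)) (≤-reflexive (symm (*-suc 3 m))))
          where
          w∉Q : Q w ≢ true
          w∉Q q = w∉ (∨⁺ʳ {F₀ w} q)
          toHost : ∀ u → F₀ u ∧ adj G w u ≡ true → F₀ u ∧ host w u ≡ true
          toHost u e = ∧⁺ (∧⁻ˡ {F₀ u} e) (∧⁺ (∧⁺ (free⁺ w∉Q (λ j → Z#U j w Zw)) (F₀-free (∧⁻ˡ {F₀ u} e))) (∧⁻ʳ {F₀ u} e))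

        extended : Fan v σ
        extended = record
          { F = F' ; Q = Q'
          ; F⊆Q = λ { zero u q → ∨⁺ˡ q ; (suc i) u q → ∨⁺ʳ {F₀ u} (F⊆Q i u q) }
          ; F#F = F'#F'
          ; Q#U = λ j u q → case ∨⁻ {F₀ u} q of λ { (inj₁ f) → free⁻U (F₀-free f) j ; (inj₂ q') → Q#U j u q' }
          ; v∉Q = λ q → case ∨⁻ {F₀ v} q of λ { (inj₁ f) → v∉F₀ f ; (inj₂ q') → v∉Q q' }
          ; size = ≤-trans (∑-≤-+ {g = λ u → 𝟙 (F₀ u)} {λ u → 𝟙 (Q u)} (λ u → or (F₀ u) (Q u))) (≤-trans (+-mono-≤ size₀ size) (≤-reflexive (+-comm (N + ℓ) (fanSize m))))
          ; close = λ {u} q → case ∨⁻ {F₀ u} q of λ { (inj₁ f) → weaken (m≤n+m _ (fanSize m)) (walkTo f) ; (inj₂ q') → weaken (m≤m+n _ _) (close q') }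
          ; route = λ { zero → let z , u , e , wk , q = path₀ in z , u , e , weaken (m≤n+m _ (fanSize m)) wk , q
                     ; (suc i) → let z , u , e , wk , q = route i in z , u , e , weaken (m≤m+n _ _) wk , q }
          ; few = few' }
          where
          or : ∀ a c → 𝟙 (a ∨ c) ≤ 𝟙 a + 𝟙 c
          or true c = s≤s z≤n
          or false c = ≤-refl

    extend : Closed G Z (suc Δ ^ N) (3 * m) ⊎ Fan v σ
    extend = from (growOrClose core (at v) (∃⇒0<# {P = at v} v (⌊⌋⁺ refl)) N)
      where
      from : (∃[ i ] i < N × Core.ball (suc i) ⊆ Core.ball i) ⊎ N < # (Core.ball N) → Closed G Z (suc Δ ^ N) (3 * m) ⊎ Fan v σ
      from (inj₁ (i , lt , sub)) = inj₁ (closed i (<⇒≤ lt) sub)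
      from (inj₂ big) = inj₂ (Target.AddPath.extended big (Target.newPath big))

  weakenClosed : ∀ {K K' δ δ'} → K ≤ K' → δ ≤ δ' → Closed G Z K δ → Closed G Z K' δ'
  weakenClosed le le' C = record { A = A ; A⊆Z = A⊆Z ; vertex = vertex ; vertex∈A = vertex∈A ; small = ≤-trans small le ; boundary = λ w q → ≤-trans (boundary w q) le' }
    where open Closed C

  fan : ∀ {v} → Z v ≡ true → ∀ {m} (σ : Fin m → Fin T) → Closed G Z (closedSize m) (3 * m) ⊎ Fan v σ
  fan Zv {zero} σ = inj₂ (emptyFan σ)
  fan {v} Zv {suc m} σ = first (fan Zv (σ ∘ suc))
    where
    second : Closed G Z (suc Δ ^ reach m) (3 * m) ⊎ Fan v σ → Closed G Z (closedSize (suc m)) (3 * suc m) ⊎ Fan v σ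
    second (inj₁ C) = inj₁ (weakenClosed (m≤n+m _ (closedSize m)) (*-monoʳ-≤ 3 (n≤1+n m)) C)
    second (inj₂ f) = inj₂ f
    first : Closed G Z (closedSize m) (3 * m) ⊎ Fan v (σ ∘ suc) → Closed G Z (closedSize (suc m)) (3 * suc m) ⊎ Fan v σ
    first (inj₁ C) = inj₁ (weakenClosed (m≤m+n _ _) (*-monoʳ-≤ 3 (n≤1+n m)) C)
    first (inj₂ f) = second (ExtendFan.extend Zv σ f)

-- Bounded degree: joining the fans and peeling off closed sets.

-- The two orders of a pair have the same index, so the fans at both branch vertices aim at the same
-- set `U`.
slot : ∀ {t} → Fin t → Fin t → Fin (t * t)
slot i k with i Data.Fin.<? k
... | yes _ = combine i k
... | no _ = combine k i

slot-< : ∀ {t} {i k : Fin t} → i <ᶠ k → slot i k ≡ combine i k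
slot-< {i = i} {k} lt with i Data.Fin.<? k
... | yes _ = refl
... | no ¬lt = ⊥-elim (¬lt lt)

slot-> : ∀ {t} {i k : Fin t} → i <ᶠ k → slot k i ≡ combine i k
slot-> {i = i} {k} lt with k Data.Fin.<? i
... | yes gt = ⊥-elim (<-asym lt gt)
... | no _ = refl

allOr : ∀ {m} {B : Fin m → Set} {C : Set} → (∀ i → C ⊎ B i) → C ⊎ (∀ i → B i)
allOr {zero} f = inj₂ λ ()
allOr {suc m} f with f zero | allOr (f ∘ suc)
... | inj₁ c | _ = inj₁ c
... | inj₂ _ | inj₁ c = inj₁ c
... | inj₂ b | inj₂ bs = inj₂ λ { zero → b ; (suc i) → bs i }

-- `far` is distance greater than D in contrapositive form. With D twice the radius of a fan, a
-- vertex common to two fans would give a forbidden walk between their centres.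
record Spread {n} (G : Graph n) (Z : Fin n → Bool) (k D : ℕ) : Set where
  field
    v : Fin k → Fin n
    v∈Z : ∀ i → Z (v i) ≡ true
    far : ∀ {i j} → Walk (adj G) (λ _ → ⊤) D (v i) (v j) → i ≡ j

spread : ∀ {n} (G : Graph n) Δ → (∀ u → ∑ (λ v → 𝟙 (adj G u v)) ≤ Δ) → ∀ Z D k → suc Δ ^ D * k < # Z → Spread G Z k D
spread G Δ deg Z D zero _ = record { v = λ () ; v∈Z = λ () ; far = λ { {()} } }
spread {n} G Δ deg Z D (suc k) lt = extend (spread G Δ deg Z D k (≤-<-trans (*-monoʳ-≤ (suc Δ ^ D) (n≤1+n k)) lt))
  where
  extend : Spread G Z k D → Spread G Z (suc k) D
  extend S = from (#-<⇒∃ (ball D) Z (≤-<-trans (≤-trans (ball-size Δ deg D) (*-monoʳ-≤ (suc Δ ^ D) few)) (≤-<-trans (*-monoʳ-≤ (suc Δ ^ D) (n≤1+n k)) lt)))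
    where
    open Spread S
    chosen : Fin n → Bool
    chosen u = some (λ i → at (v i) u)
    open BFS (adj G) chosen
    few : # chosen ≤ k
    few = ≤-trans (∑-mono (λ u → some-≤ (λ i → at (v i) u))) (≤-trans (≤-reflexive (∑-swap (λ u i → 𝟙 (at (v i) u))))
      (≤-trans (∑-≤-const {c = 1} _ (λ i → #-single (v i))) (≤-reflexive (*-identityʳ k))))
    from : ∃[ y ] Z y ≡ true × ball D y ≢ true → Spread G Z (suc k) D
    from (y , Zy , y∉) = record { v = v' ; v∈Z = λ { zero → Zy ; (suc i) → v∈Z i } ; far = far' }
      where
      v' : Fin (suc k) → Fin n
      v' zero = y
      v' (suc i) = v i
      reached : ∀ i → Walk (adj G) (λ _ → ⊤) D (v i) y → ball D y ≡ true
      reached i wk = walk-ball {i = 0} (some⁺ {P = λ i' → at (v i') (v i)} i (⌊⌋⁺ refl)) wk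
      far' : ∀ {i j} → Walk (adj G) (λ _ → ⊤) D (v' i) (v' j) → i ≡ j
      far' {zero} {zero} _ = refl
      far' {zero} {suc j} wk = ⊥-elim (y∉ (reached j (reverseʷ (adj-sym G) wk)))
      far' {suc i} {zero} wk = ⊥-elim (y∉ (reached i wk))
      far' {suc i} {suc j} wk = cong suc (far wk)

module Join {n} (G : Graph n) (Δ : ℕ) (deg : ∀ u → ∑ (λ v → 𝟙 (adj G u v)) ≤ Δ) (t : ℕ) (U : Fin (t * t) → Fin n → Bool)
  (U#U : ∀ {i j} v → U i v ≡ true → U j v ≡ true → i ≡ j) (R : ℕ)
  (joined : ∀ j {u u'} → U j u ≡ true → U j u' ≡ true → Walk (adj G) (In (U j)) (R + R) u u')
  (ℓ : ℕ) (core : Fin n → Bool) (core#U : ∀ j v → core v ≡ true → U j v ≢ true)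
  (leg : ∀ j {y} → core y ≡ true → Leg G (Avoids U) ℓ (U j) y) where

  open FanBounds Δ ℓ

  c : ℕ
  c = fanSize t

  joinSize : ℕ
  joinSize = t + t * (t * suc (c + ((R + R) + c)))

  module At (Z : Fin n → Bool) (Z⊆core : Z ⊆ core) where

    open Fans G Δ deg U ℓ Z (λ j v q → core#U j v (Z⊆core v q)) (λ j {y} q → leg j (Z⊆core y q))

    assemble : (S : Spread G Z t (c + c)) → (∀ i → Fan (Spread.v S i) (slot i)) → HasSubdivisionWithin t G joinSize
    assemble S fans = connect v (λ {i} {j} eq → far (subst (Walk (adj G) (λ _ → ⊤) (c + c) (v i)) eq (stop tt))) W avoid distinct linked
      where
      open Spread S
      F : Fin t → Fin t → Fin n → Set
      F i k x = Fan.F (fans i) k x ≡ true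
      W : Fin t → Fin t → Fin n → Set
      W i j x = (F i j x ⊎ F j i x) ⊎ U (combine i j) x ≡ true
      toQ : ∀ {i k x} → F i k x → Fan.Q (fans i) x ≡ true
      toQ {i} {k} q = Fan.F⊆Q (fans i) k _ q
      owner : ∀ {a p b q x} → F a p x → F b q x → a ≡ b × p ≡ q
      owner {a} {p} {b} {q} {x} f f' with far {a} {b} (Fan.close (fans a) (toQ f) ++ʷ reverseʷ (adj-sym G) (Fan.close (fans b) (toQ f')))
      ... | refl = refl , Fan.F#F (fans a) x f f'
      F#U : ∀ {i k x} j → F i k x → U j x ≢ true
      F#U {i} j f = Fan.Q#U (fans i) j _ (toQ f)
      branchOff : ∀ {i k} l → F i k (v l) → ⊥
      branchOff {i} l f with far {i} {l} (weaken (m≤m+n c c) (Fan.close (fans i) (toQ f)))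
      ... | refl = Fan.v∉Q (fans i) (toQ f)
      avoid : ∀ i j k x → i <ᶠ j → W i j x → x ≢ v k
      avoid i j k x _ (inj₁ (inj₁ f)) refl = branchOff k f
      avoid i j k x _ (inj₁ (inj₂ f)) refl = branchOff k f
      avoid i j k x _ (inj₂ q) refl = core#U (combine i j) x (Z⊆core x (v∈Z k)) q
      distinct : ∀ i j i' j' x → i <ᶠ j → i' <ᶠ j' → W i j x → W i' j' x → (i ≡ i') × (j ≡ j')
      distinct i j i' j' x lt lt' (inj₂ q) (inj₂ q') = combine-injective i j i' j' (U#U x q q')
      distinct i j i' j' x lt lt' (inj₂ q) (inj₁ (inj₁ f)) = ⊥-elim (F#U _ f q)
      distinct i j i' j' x lt lt' (inj₂ q) (inj₁ (inj₂ f)) = ⊥-elim (F#U _ f q)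
      distinct i j i' j' x lt lt' (inj₁ (inj₁ f)) (inj₂ q) = ⊥-elim (F#U _ f q)
      distinct i j i' j' x lt lt' (inj₁ (inj₂ f)) (inj₂ q) = ⊥-elim (F#U _ f q)
      distinct i j i' j' x lt lt' (inj₁ (inj₁ f)) (inj₁ (inj₁ f')) = owner f f'
      distinct i j i' j' x lt lt' (inj₁ (inj₂ f)) (inj₁ (inj₂ f')) = let a , b = owner f f' in b , a
      distinct i j i' j' x lt lt' (inj₁ (inj₁ f)) (inj₁ (inj₂ f')) with owner f f'
      ... | refl , refl = ⊥-elim (<-asym lt lt')
      distinct i j i' j' x lt lt' (inj₁ (inj₂ f)) (inj₁ (inj₁ f')) with owner f f'
      ... | refl , refl = ⊥-elim (<-asym lt lt')
      linked : ∀ i j → i <ᶠ j → Linked G (W i j) (c + ((R + R) + c)) (v i) (v j)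
      linked i j lt = from (Fan.route (fans i) j) (Fan.route (fans j) i)
        where
        inˡ : ∀ {x} → F i j x ⊎ U (slot i j) x ≡ true → W i j x
        inˡ (inj₁ f) = inj₁ (inj₁ f)
        inˡ {x} (inj₂ q) = inj₂ (subst (λ s → U s x ≡ true) (slot-< lt) q)
        inʳ : ∀ {x} → F j i x ⊎ U (slot j i) x ≡ true → W i j x
        inʳ (inj₁ f) = inj₁ (inj₂ f)
        inʳ {x} (inj₂ q) = inj₂ (subst (λ s → U s x ≡ true) (slot-> lt) q)
        from : Route G (Fan.F (fans i) j) (U (slot i j)) c (v i) → Route G (Fan.F (fans j) i) (U (slot j i)) c (v j) →
               Linked G (W i j) (c + ((R + R) + c)) (v i) (v j)
        from (z , u , e , wk , q) (z' , u' , e' , wk' , q') = link e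
          (mapʷ id inˡ wk ++ʷ (mapʷ id inj₂ (joined (combine i j) (subst (λ s → U s u ≡ true) (slot-< lt) q) (subst (λ s → U s u' ≡ true) (slot-> lt) q'))
            ++ʷ reverseʷ (adj-sym G) (mapʷ id inʳ wk')))
          (adj-sym G _ _ e')

    attempt : suc Δ ^ (c + c) * t < # Z → Closed G Z (closedSize t) (3 * t) ⊎ HasSubdivisionWithin t G joinSize
    attempt big = conclude (spread G Δ deg Z (c + c) t big)
      where
      conclude : Spread G Z t (c + c) → Closed G Z (closedSize t) (3 * t) ⊎ HasSubdivisionWithin t G joinSize
      conclude S = done (allOr (λ i → fan (Spread.v∈Z S i) (slot i)))
        where
        done : Closed G Z (closedSize t) (3 * t) ⊎ (∀ i → Fan (Spread.v S i) (slot i)) → Closed G Z (closedSize t) (3 * t) ⊎ HasSubdivisionWithin t G joinSize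
        done (inj₁ C) = inj₁ C
        done (inj₂ fans) = inj₂ (assemble S fans)

  smallBound : ℕ
  smallBound = suc Δ ^ (c + c) * t + closedSize t

  -- γ/β is the density at which a closed set is accepted. A sparser one takes away at most γ/β arcs
  -- per vertex inside and 3t across the boundary in each direction, together at most α/β, so the
  -- density of the rest stays above α/β.
  module Loop (α β γ : ℕ) (γ≤ : γ + 2 * (3 * t) * β ≤ α) where

    module Peel {Z : Fin n → Bool} (C : Closed G Z (closedSize t) (3 * t)) where
      open Closed C

      crossing : ∑∑ (λ u v → on (A u ∧ (Z ∖ A) v) (𝟙 (adj G u v))) ≤ 3 * t * # A
      crossing = ≤-trans (∑-mono (λ u → row u (A u) refl)) (≤-reflexive (∑-* (3 * t) (λ v → 𝟙 (A v))))
        where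
        row : ∀ u a → A u ≡ a → ∑ (λ v → on (a ∧ (Z ∖ A) v) (𝟙 (adj G u v))) ≤ 3 * t * 𝟙 a
        row u true eq = ≤-trans (∑-mono (λ v → pointwise v ((Z ∖ A) v))) (≤-trans (boundary u eq) (≤-reflexive (symm (*-identityʳ _))))
          where
          pointwise : ∀ v a → on a (𝟙 (adj G u v)) ≤ 𝟙 (a ∧ adj G u v)
          pointwise v true = ≤-refl
          pointwise v false = z≤n
        row u false eq = ∑-zero-≤ {n}

      crossing' : ∑∑ (λ u v → on ((Z ∖ A) u ∧ A v) (𝟙 (adj G u v))) ≤ 3 * t * # A
      crossing' = ≤-trans (≤-reflexive (trans (∑-swap (λ u v → on ((Z ∖ A) u ∧ A v) (𝟙 (adj G u v)))) (∑-cong (λ v → ∑-cong (λ u → flip u v))))) crossing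
        where
        flip : ∀ u v → on ((Z ∖ A) u ∧ A v) (𝟙 (adj G u v)) ≡ on (A v ∧ (Z ∖ A) u) (𝟙 (adj G v u))
        flip u v = cong₂ (λ a e → on a (𝟙 e)) (∧-comm ((Z ∖ A) u) (A v)) (Graph.sym G u v)

      split : arcs G Z ≤ arcs G (Z ∖ A) + arcs G A + (3 * t * # A + 3 * t * # A)
      split = ≤-trans (∑∑-mono pointwise) (≤-trans (≤-reflexive total) (+-monoʳ-≤ (∑∑ a₁ + ∑∑ a₂) (+-mono-≤ crossing' crossing)))
        where
        a₁ a₂ b₁ b₂ : Fin n → Fin n → ℕ
        a₁ = (λ u v → 𝟙 (adj G u v)) ↾ (Z ∖ A)
        a₂ = (λ u v → 𝟙 (adj G u v)) ↾ A
        b₁ = λ u v → on ((Z ∖ A) u ∧ A v) (𝟙 (adj G u v))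
        b₂ = λ u v → on (A u ∧ (Z ∖ A) v) (𝟙 (adj G u v))
        total : ∑∑ (λ u v → a₁ u v + a₂ u v + (b₁ u v + b₂ u v)) ≡ ∑∑ a₁ + ∑∑ a₂ + (∑∑ b₁ + ∑∑ b₂)
        total = trans (∑∑-+ (λ u v → a₁ u v + a₂ u v) (λ u v → b₁ u v + b₂ u v)) (cong₂ _+_ (∑∑-+ a₁ a₂) (∑∑-+ b₁ b₂))
        pointwise : ∀ u v → ((λ u v → 𝟙 (adj G u v)) ↾ Z) u v ≤ a₁ u v + a₂ u v + (b₁ u v + b₂ u v)
        pointwise u v = go (Z u) (Z v) (A u) (A v)
          where
          go : ∀ zu zv au av {y} → on (zu ∧ zv) y ≤ on ((zu ∧ not au) ∧ (zv ∧ not av)) y + on (au ∧ av) y + (on ((zu ∧ not au) ∧ av) y + on (au ∧ (zv ∧ not av)) y)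
          go false _ _ _ = z≤n
          go true false _ _ = z≤n
          go true true true true = m≤m+n _ _
          go true true true false = ≤-refl
          go true true false true = m≤m+n _ _
          go true true false false = ≤-trans (m≤m+n _ _) (m≤m+n _ _)

      remains : α * # Z < β * arcs G Z → β * arcs G A ≤ γ * # A → α * # (Z ∖ A) < β * arcs G (Z ∖ A)
      remains dense sparse = arith {z = # Z} {# (Z ∖ A)} {# A} {arcs G Z} {arcs G (Z ∖ A)} {arcs G A} (#-∖ A⊆Z) split sparse dense
        where
        arith : ∀ {z z' a e e' eA} → z ≡ a + z' → e ≤ e' + eA + (3 * t * a + 3 * t * a) → β * eA ≤ γ * a → α * z < β * e → α * z' < β * e'
        arith {z' = z'} {a} {e} {e'} {eA} refl h₁ h₂ h₃ = linear 0 (+-mono-≤ (+-mono-≤ (*-monoʳ-≤ β h₁) h₂) (+-mono-≤ h₃ (*-monoˡ-≤ a γ≤))) (ring α β γ t z' a e e' eA)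
          where
          ring : ∀ α β γ t z' a e e' eA → suc (α * z') + (β * (e' + eA + (3 * t * a + 3 * t * a)) + γ * a + (β * e + α * a)) + 0 ≡
                 β * e' + (β * e + β * eA + (suc (α * (a + z')) + (γ + 2 * (3 * t) * β) * a))
          ring α β γ t z' a e e' eA = solve (α ∷ β ∷ γ ∷ t ∷ z' ∷ a ∷ e ∷ e' ∷ eA ∷ [])

      smaller : # (Z ∖ A) < # Z
      smaller = ≤-trans (+-monoˡ-≤ (# (Z ∖ A)) (∃⇒0<# {P = A} vertex vertex∈A)) (≤-reflexive (symm (#-∖ A⊆Z)))

    loop : ∀ k Z → # Z ≤ k → Z ⊆ core → α * # Z < β * arcs G Z → SmallDense G core γ β smallBound ⊎ HasSubdivisionWithin t G joinSize
    loop k Z #Z≤k Z⊆core dense = check (suc Δ ^ (c + c) * t <? # Z)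
      where
      Goal : Set
      Goal = SmallDense G core γ β smallBound ⊎ HasSubdivisionWithin t G joinSize
      peel : ∀ k → # Z ≤ k → (C : Closed G Z (closedSize t) (3 * t)) → Dec (γ * # (Closed.A C) < β * arcs G (Closed.A C)) → Goal
      peel k le C (yes A-dense) = inj₁ (Closed.A C , (λ v q → Z⊆core v (Closed.A⊆Z C v q)) , ≤-trans (Closed.small C) (m≤n+m _ _) , A-dense)
      peel zero le C (no _) = ⊥-elim (n≮0 (<-≤-trans (Peel.smaller C) le))
      peel (suc k) le C (no sparse) = loop k (Z ∖ Closed.A C) (s≤s⁻¹ (<-≤-trans (Peel.smaller C) le))
        (λ v q → Z⊆core v (∧⁻ˡ {Z v} q)) (Peel.remains C dense (≮⇒≥ sparse))
      tried : Closed G Z (closedSize t) (3 * t) ⊎ HasSubdivisionWithin t G joinSize → Goal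
      tried (inj₂ S) = inj₂ S
      tried (inj₁ C) = peel k #Z≤k C (_ <? _)
      check : Dec (suc Δ ^ (c + c) * t < # Z) → Goal
      check (yes big) = tried (At.attempt Z Z⊆core big)
      -- The density of `Z` has been preserved by all removals; once `Z` is too small for t distant
      -- vertices, it is itself a small dense set.
      check (no small) = inj₁ (Z , Z⊆core , ≤-trans (≮⇒≥ small) (m≤m+n _ _) , ≤-<-trans (*-monoˡ-≤ (# Z) (≤-trans (m≤m+n γ _) γ≤)) dense)

-- Bounded degree: the pieces put together.

module BoundedDegree (t s' x' Δ : ℕ) (fits : suc s' + t * t ≤ suc x') where

  -- These depend on t, Δ, s' and x' alone. The logarithm `L` enters only through the radius of the
  -- sets `U`.
  T b ℓ c K : ℕ
  T = t * t
  b = bands (suc x')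
  ℓ = HubBounds.legLength b Δ T 0
  c = FanBounds.fanSize Δ ℓ t
  K = HubBounds.smallSize b Δ T 0 + (suc Δ ^ (c + c) * t + FanBounds.closedSize Δ ℓ t)

  radius size : ℕ → ℕ
  radius L = 3 * suc x' * L + 1
  size L = t + t * (t * suc (c + ((radius L + radius L) + c)))

  module _ {n} (G : Graph n) (L : ℕ) (n²<2^L : n * n < 2 ^ L) (deg : ∀ u → ∑ (λ v → 𝟙 (adj G u v)) ≤ Δ)
    (α β γ : ℕ) (γ≤ : γ + 2 * (3 * t) * β ≤ α) where

    open Hubs G L n²<2^L α β x' Δ deg s' b refl using (hub)

    Goal : (Fin n → Bool) → Set
    Goal Z = SmallDense G Z γ β K ⊎ HasSubdivisionWithin t G (size L)

    fromHub : ∀ Z → Hub G (λ _ → true) Z α β T 0 ℓ (radius L) → Goal Z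
    fromHub Z H = conclude (Join.Loop.loop G Δ deg t U U#U (radius L) joined ℓ core core#U (λ j q → let z , u , wk , e = leg j q in z , u , mapʷ id proj₂ wk , e)
                              α β γ γ≤ (# core) core ≤-refl (λ _ q → q) dense)
      where
      open Hub H
      core#U : ∀ j v → core v ≡ true → U j v ≢ true
      core#U j v q q' = U#inner j v q' (pad q (stop refl))
      conclude : SmallDense G core γ β (suc Δ ^ (c + c) * t + FanBounds.closedSize Δ ℓ t) ⊎ HasSubdivisionWithin t G (size L) → Goal Z
      conclude (inj₁ (A , A⊆ , small , A-dense)) = inj₁ (A , (λ v q → core⊆Z v (A⊆ v q)) , ≤-trans small (m≤n+m _ (HubBounds.smallSize b Δ T 0)) , A-dense)
      conclude (inj₂ S) = inj₂ S

    boundedDegree : ∀ Z → (suc s' + T) * α * # Z < suc s' * β * arcs G Z → Goal Z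
    boundedDegree Z dense = conclude (hub T 0 (λ _ → true) Z (λ _ _ → refl) fits dense)
      where
      conclude : SmallDense G Z α β (HubBounds.smallSize b Δ T 0) ⊎ Hub G (λ _ → true) Z α β T 0 ℓ (radius L) → Goal Z
      conclude (inj₁ (A , A⊆Z , small , A-dense)) = inj₁ (A , A⊆Z , ≤-trans small (m≤m+n _ _) , ≤-<-trans (*-monoˡ-≤ (# A) (≤-trans (m≤m+n γ _) γ≤)) A-dense)
      conclude (inj₂ H) = fromHub Z H

subgraph : ∀ {n t N} {G H : Graph n} → (∀ u v → adj H u v ≡ true → adj G u v ≡ true) → HasSubdivisionWithin t H N → HasSubdivisionWithin t G N
subgraph {n} {t} {N} {G} {H} H⊆G (S , le) = S' , le
  where
  chain : ∀ p → Chain H p → Chain G p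
  chain [] _ = _
  chain (x ∷ []) _ = _
  chain (x ∷ y ∷ p) (e , ch) = H⊆G x y e , chain (y ∷ p) ch
  S' : Subdivision t G
  S' = record { branch = branch S ; branchInj = branchInj S ; path = path S ; isPath = λ i j lt → chain _ (isPath S i j lt)
              ; simple = simple S ; avoidsBranch = avoidsBranch S ; disjoint = disjoint S }

-- Deletion of the vertices of large degree.

total : ∀ {n} → Graph n → ℕ
total G = ∑∑ (λ u v → 𝟙 (adj G u v))

-- Vertices of degree above Δ are few; unless they already produce a subdivision,
-- deleting them costs almost no arcs.
module SplitDegree {n} (G : Graph n) (L : ℕ) (n²<2^L : n * n < 2 ^ L) (t Δ : ℕ) where

  τ : ℕ
  τ = threshold t (t * t)

  deg : Fin n → ℕ
  deg v = ∑ (λ u → 𝟙 (adj G v u))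

  B low A X : Fin n → Bool
  B v = ⌊ Δ <? deg v ⌋
  low v = not (B v)
  A v = low v ∧ ⌊ t ≤? # (λ b → B b ∧ adj G v b) ⌋
  X v = A v ∨ B v

  Low : Graph n
  Low = record { adj = λ u v → (low u ∧ low v) ∧ adj G u v
               ; sym = λ u v → cong₂ _∧_ (∧-comm (low u) (low v)) (Graph.sym G u v)
               ; irrefl = λ v → trans (cong ((low v ∧ low v) ∧_) (irrefl G v)) (∧-zeroʳ (low v ∧ low v)) }

  Low-degree : ∀ u → ∑ (λ v → 𝟙 (adj Low u v)) ≤ Δ
  Low-degree u = go (B u) refl
    where
    go : ∀ b → B u ≡ b → ∑ (λ v → 𝟙 (adj Low u v)) ≤ Δ
    go true eq = ≤-trans (∑-mono (λ v → ≤-reflexive (cong (λ b → 𝟙 ((not b ∧ low v) ∧ adj G u v)) eq))) ∑-zero-≤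
    go false eq = ≤-trans (∑-mono (λ v → ⇒𝟙≤ (∧⁻ʳ {low u ∧ low v}))) (≮⇒≥ (λ lt → false≢true (trans (symm eq) (⌊⌋⁺ {d = Δ <? deg u} lt))))

  Low⊆G : ∀ u v → adj Low u v ≡ true → adj G u v ≡ true
  Low⊆G u v = ∧⁻ʳ {low u ∧ low v}

  Δ*#B≤ : Δ * # B ≤ total G
  Δ*#B≤ = ≤-trans (≤-reflexive (symm (∑-* Δ (λ v → 𝟙 (B v))))) (∑-mono (λ v → row v (B v) refl))
    where
    row : ∀ v b → B v ≡ b → Δ * 𝟙 b ≤ deg v
    row v true eq = ≤-trans (≤-reflexive (*-identityʳ Δ)) (<⇒≤ (⌊⌋⁻ {d = Δ <? deg v} eq))
    row v false eq = ≤-trans (≤-reflexive (*-zeroʳ Δ)) z≤n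

  fewToB : ∑∑ (λ u v → on ((low ∖ A) u ∧ B v) (𝟙 (adj G u v))) ≤ t * n
  fewToB = ≤-trans (∑-≤-const _ row) (≤-reflexive (*-comm n t))
    where
    row : ∀ u → ∑ (λ v → on ((low ∖ A) u ∧ B v) (𝟙 (adj G u v))) ≤ t
    row u = go ((low ∖ A) u) refl
      where
      go : ∀ a → (low ∖ A) u ≡ a → ∑ (λ v → on (a ∧ B v) (𝟙 (adj G u v))) ≤ t
      go false _ = ∑-zero-≤ {n}
      go true eq = ≤-trans (∑-mono (λ v → both (B v) (adj G u v))) (<⇒≤ (≰⇒> (λ le → not⁻ (∧⁻ʳ {low u} eq) (∧⁺ (∧⁻ˡ {low u} eq) (⌊⌋⁺ {d = t ≤? # (λ b → B b ∧ adj G u b)} le)))))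
        where
        both : ∀ a b → on a (𝟙 b) ≤ 𝟙 (a ∧ b)
        both true b = ≤-refl
        both false b = z≤n

  -- An arc has both ends low, or joins `B` to a low vertex outside `A`, or lies in `X`. Low
  -- vertices outside `A` have fewer than t neighbours in `B`, whence t n for each direction.
  total-≤ : total G ≤ arcs Low low + (t * n + t * n) + ∑∑ (edges G X X)
  total-≤ = ≤-trans (∑∑-mono pointwise) (≤-trans (≤-reflexive sums) (+-monoˡ-≤ (∑∑ (edges G X X)) (+-monoʳ-≤ (∑∑ a₁) (+-mono-≤ fewToB
      (≤-trans (≤-reflexive (∑-swap b₂)) (≤-trans (∑∑-mono (λ v u → ≤-reflexive (flip v u))) fewToB))))))
    where
    a₁ b₁ b₂ : Fin n → Fin n → ℕ
    a₁ = (λ u v → 𝟙 (adj Low u v)) ↾ low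
    b₁ = λ u v → on ((low ∖ A) u ∧ B v) (𝟙 (adj G u v))
    b₂ = λ u v → on (B u ∧ (low ∖ A) v) (𝟙 (adj G u v))
    flip : ∀ v u → b₂ u v ≡ b₁ v u
    flip v u = cong₂ (λ a e → on a (𝟙 e)) (∧-comm (B u) ((low ∖ A) v)) (Graph.sym G u v)
    sums : ∑∑ (λ u v → a₁ u v + (b₁ u v + b₂ u v) + edges G X X u v) ≡ ∑∑ a₁ + (∑∑ b₁ + ∑∑ b₂) + ∑∑ (edges G X X)
    sums = trans (∑∑-+ (λ u v → a₁ u v + (b₁ u v + b₂ u v)) (edges G X X)) (cong (_+ ∑∑ (edges G X X))
      (trans (∑∑-+ a₁ (λ u v → b₁ u v + b₂ u v)) (cong (∑∑ a₁ +_) (∑∑-+ b₁ b₂))))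
    pointwise : ∀ u v → 𝟙 (adj G u v) ≤ a₁ u v + (b₁ u v + b₂ u v) + edges G X X u v
    pointwise u v = go (B u) (B v) ⌊ t ≤? # (λ b → B b ∧ adj G u b) ⌋ ⌊ t ≤? # (λ b → B b ∧ adj G v b) ⌋ (adj G u v)
      where
      go : ∀ bu bv mu mv e → 𝟙 e ≤ on (not bu ∧ not bv) (𝟙 ((not bu ∧ not bv) ∧ e))
             + (on ((not bu ∧ not (not bu ∧ mu)) ∧ bv) (𝟙 e) + on (bu ∧ (not bv ∧ not (not bv ∧ mv))) (𝟙 e))
             + 𝟙 (((not bu ∧ mu) ∨ bu) ∧ ((not bv ∧ mv) ∨ bv) ∧ e)
      go _ _ _ _ false = z≤n
      go true true _ _ true = ≤-refl
      go true false _ true true = ≤-refl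
      go true false _ false true = s≤s z≤n
      go false true true _ true = ≤-refl
      go false true false _ true = s≤s z≤n
      go false false _ _ true = s≤s z≤n

  R size : ℕ
  R = 1 * L + 1
  size = t + t * (t * suc (suc (suc ((R + R) + (R + R)))))

  -- If neither dense case applies, then `# X` is at most (τ + 1) `# B` and `X` spans at most 2τ
  -- `# X` arcs. By Δ `# B` ≤ `total G` and the choice of Δ this is at most 1/(q + 2) of all arcs;
  -- the 2 t n arcs between `B` and low vertices outside `A` are less than another such share.
  splitDegree : ∀ q → 1 ≤ n → ((q + 2) * (2 * t) + 1) * n ≤ total G → Δ ≡ (q + 2) * (2 * (τ * suc τ)) →
                HasSubdivisionWithin t G size ⊎ q * total G * # low < (q + 2) * n * arcs Low low
  splitDegree q 1≤n dense Δ-def = first (τ * # B <? # A)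
    where
    Goal : Set
    Goal = HasSubdivisionWithin t G size ⊎ q * total G * # low < (q + 2) * n * arcs Low low
    A#B : ∀ v → A v ≡ true → B v ≢ true
    A#B v a = not⁻ (∧⁻ˡ {low v} a)
    X≤ : # X ≤ # A + # B
    X≤ = ∑-≤-+ {f = λ v → 𝟙 (X v)} (λ v → or (A v) (B v))
      where
      or : ∀ a c → 𝟙 (a ∨ c) ≤ 𝟙 a + 𝟙 c
      or true c = s≤s z≤n
      or false c = ≤-refl
    arith : ∀ {S e n l a b x f} → ((q + 2) * (2 * t) + 1) * n ≤ S → 1 ≤ n → l ≤ n → S ≤ e + (t * n + t * n) + f → f ≤ τ * (x + x) → x ≤ a + b → a ≤ τ * b →
            (q + 2) * (2 * (τ * suc τ)) * b ≤ S → q * S * l < (q + 2) * n * e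
    arith {S} {e} {n} {l} {a} {b} {x} {f} h₁ h₂ h₃ h₄ h₅ h₆ h₇ h₈ = ≤-<-trans (*-monoʳ-≤ (q * S) h₃) (<-≤-trans (*-monoˡ-< n {{>-nonZero h₂}} strict) (≤-reflexive (comm q n e)))
      where
      comm : ∀ q n e → (q + 2) * e * n ≡ (q + 2) * n * e
      comm q n e = solve (q ∷ n ∷ e ∷ [])
      strict : q * S < (q + 2) * e
      strict = linear 0 (+-mono-≤ (+-mono-≤ (+-mono-≤ h₁ h₂) (+-mono-≤ (*-monoʳ-≤ (q + 2) h₄) (*-monoʳ-≤ (q + 2) h₅)))
          (+-mono-≤ (+-mono-≤ (*-monoʳ-≤ ((q + 2) * (2 * τ)) h₆) (*-monoʳ-≤ ((q + 2) * (2 * τ)) h₇)) h₈))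
        (ring q t τ S e n a b x f)
        where
        ring : ∀ q t τ S e n a b x f →
          suc (q * S) + (S + n + ((q + 2) * (e + (t * n + t * n) + f) + (q + 2) * (τ * (x + x))) + ((q + 2) * (2 * τ) * (a + b) + (q + 2) * (2 * τ) * (τ * b) + S)) + 0
          ≡ (q + 2) * e + (((q + 2) * (2 * t) + 1) * n + 1 + ((q + 2) * S + (q + 2) * f) + ((q + 2) * (2 * τ) * x + (q + 2) * (2 * τ) * a + (q + 2) * (2 * (τ * suc τ)) * b))
        ring q t τ S e n a b x f = solve (q ∷ t ∷ τ ∷ S ∷ e ∷ n ∷ a ∷ b ∷ x ∷ f ∷ [])
    R+R≤ : t + t * (t * suc (R + R)) ≤ size
    R+R≤ = +-monoʳ-≤ t (*-monoʳ-≤ t (*-monoʳ-≤ t (s≤s (≤-trans (m≤m+n (R + R) (R + R)) (m≤n+m _ 2)))))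
    second : ¬ τ * # B < # A → Dec (τ * (# X + # X) < ∑∑ (edges G X X)) → Goal
    second _ (yes big) = inj₁ (let S , le = skeleton⇒subdivision (skeleton G L n²<2^L t (t * t) X X big) in S , ≤-trans le R+R≤)
    second few (no sparse) = inj₂ (arith {total G} {arcs Low low} {n} {# low} {# A} {# B} {# X} dense 1≤n (#-≤ low) total-≤ (≮⇒≥ sparse) X≤ (≮⇒≥ few)
      (subst (λ d → d * # B ≤ total G) Δ-def Δ*#B≤))
    first : Dec (τ * # B < # A) → Goal
    first (yes big) = inj₁ (Pairing.paired G A B A#B t (λ a q' → ⌊⌋⁻ (∧⁻ʳ {low a} q')) L n²<2^L big)
    first (no few) = second few (τ * (# X + # X) <? ∑∑ (edges G X X))

-- The quadratic lower bound for s(t).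

opaque
  unfolding ∑
  ∑-split : ∀ m {n} (f : Fin (m + n) → ℕ) → ∑ f ≡ ∑ (λ i → f (i ↑ˡ n)) + ∑ (λ j → f (m ↑ʳ j))
  ∑-split zero f = refl
  ∑-split (suc m) f = trans (cong (f zero +_) (∑-split m (f ∘ suc))) (symm (+-assoc (f zero) _ _))

record Monochromatic {t} (a : ℕ) (f : Fin t → Bool) (s : Bool) : Set where
  field
    σ    : Fin a → Fin t
    hue  : ∀ i → f (σ i) ≡ s
    mono : ∀ i j → i <ᶠ j → σ i <ᶠ σ j

skipZero : ∀ {t a} {f : Fin (suc t) → Bool} {s} → Monochromatic a (f ∘ suc) s → Monochromatic a f s
skipZero M = record { σ = suc ∘ σ ; hue = hue ; mono = λ i j lt → s≤s (mono i j lt) }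
  where open Monochromatic M

useZero : ∀ {t a} {f : Fin (suc t) → Bool} {s} → f zero ≡ s → Monochromatic a (f ∘ suc) s → Monochromatic (suc a) f s
useZero {t} {a} f0 M = record { σ = σ' ; hue = λ { zero → f0 ; (suc i) → hue i } ; mono = mono' }
  where
  open Monochromatic M
  σ' : Fin (suc a) → Fin (suc t)
  σ' zero = zero
  σ' (suc i) = suc (σ i)
  mono' : ∀ i j → i <ᶠ j → σ' i <ᶠ σ' j
  mono' zero (suc j) _ = s≤s z≤n
  mono' (suc i) (suc j) (s≤s lt) = s≤s (mono i j lt)

monochromatic : ∀ t a b (f : Fin t → Bool) → a + b ≤ suc t → Monochromatic a f true ⊎ Monochromatic b f false
monochromatic t zero b f le = inj₁ (record { σ = λ () ; hue = λ () ; mono = λ () })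
monochromatic t (suc a) zero f le = inj₂ (record { σ = λ () ; hue = λ () ; mono = λ () })
monochromatic zero (suc a) (suc b) f le = ⊥-elim (n≮0 (s≤s⁻¹ (subst (_≤ 1) (cong suc (+-suc a b)) le)))
monochromatic (suc t) (suc a) (suc b) f le with f zero in f0
... | true  = Sum.map (useZero f0) skipZero (monochromatic t a (suc b) (f ∘ suc) (s≤s⁻¹ le))
... | false = Sum.map skipZero (useZero f0) (monochromatic t (suc a) b (f ∘ suc) (s≤s⁻¹ (subst (_≤ suc (suc t)) (+-suc (suc a) b) le)))

module CompleteBipartite (r : ℕ) where

  side : Fin (r + r) → Bool
  side v = Sum.[ (λ _ → true) , (λ _ → false) ] (splitAt r v)

  index : Fin (r + r) → Fin r
  index v = Sum.[ id , id ] (splitAt r v)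

  index-injective : ∀ {u v} → side u ≡ side v → index u ≡ index v → u ≡ v
  index-injective {u} {v} s i = trans (symm (join-splitAt r r u)) (trans (cong (Data.Fin.join r r) (same (splitAt r u) (splitAt r v) s i)) (join-splitAt r r v))
    where
    same : ∀ (x y : Fin r ⊎ Fin r) → Sum.[ (λ _ → true) , (λ _ → false) ] x ≡ Sum.[ (λ _ → true) , (λ _ → false) ] y →
           Sum.[ id , id ] x ≡ Sum.[ id , id ] y → x ≡ y
    same (inj₁ _) (inj₁ _) _ refl = refl
    same (inj₂ _) (inj₂ _) _ refl = refl

  bipartite : Graph (r + r)
  bipartite = record { adj = λ u v → side u xor side v ; sym = λ u v → xor-comm (side u) (side v) ; irrefl = λ v → xor-same (side v) }

  bipartite-degree : ∀ u → r ≤ ∑ (λ v → 𝟙 (adj bipartite u v))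
  bipartite-degree u = ≤-trans (half (side u)) (≤-reflexive (symm (∑-split r (λ v → 𝟙 (side u xor side v)))))
    where
    half : ∀ s → r ≤ ∑ {r} (λ i → 𝟙 (s xor side (i ↑ˡ r))) + ∑ {r} (λ j → 𝟙 (s xor side (r ↑ʳ j)))
    half true = ≤-trans (≤-trans (≤-reflexive (symm (*-identityʳ r))) (∑-≥-const {r} 1 _ (λ j → ≤-reflexive (symm (cong (λ x → 𝟙 (true xor Sum.[ (λ _ → true) , (λ _ → false) ] x)) (splitAt-↑ʳ r r j)))))) (m≤n+m _ _)
    half false = ≤-trans (≤-trans (≤-reflexive (symm (*-identityʳ r))) (∑-≥-const {r} 1 _ (λ i → ≤-reflexive (symm (cong (λ x → 𝟙 (false xor Sum.[ (λ _ → true) , (λ _ → false) ] x)) (splitAt-↑ˡ r i r)))))) (m≤m+n _ _)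

  bipartite-degreeSum : (r + r) * r ≤ degreeSum bipartite
  bipartite-degreeSum = ≤-trans (∑-≥-const r _ bipartite-degree) (≤-reflexive (symm (degreeSum-∑∑ bipartite)))

  -- Among 4g branch vertices 2g lie on one side, and the g² paths joining the first g of
  -- them to the last g need distinct vertices of the other side.
  noSubdivision : ∀ {t} g → 4 * g ≤ t → Subdivision t bipartite → g * g ≤ r
  noSubdivision {t} g 4g≤t S = Sum.[ oneSide true , oneSide false ] (monochromatic t (g + g) (g + g) (side ∘ branch S) (≤-trans (≤-reflexive (ring g)) (m≤n⇒m≤1+n 4g≤t)))
    where
    ring : ∀ g → g + g + (g + g) ≡ 4 * g
    ring g = solve (g ∷ [])
    oneSide : ∀ s → Monochromatic (g + g) (side ∘ branch S) s → g * g ≤ r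
    oneSide s M = injective⇒≤ {f = index ∘ hit} (λ {e} {e'} eq → hit-injective e e' (index-injective (opposite-same (hit-side e) (hit-side e')) eq))
      where
      open Monochromatic M renaming (hue to c; mono to m)
      lo hi : Fin g → Fin t
      lo i = σ (i ↑ˡ g)
      hi j = σ (g ↑ʳ j)
      lo<hi : ∀ i j → lo i <ᶠ hi j
      lo<hi i j = m (i ↑ˡ g) (g ↑ʳ j) (≤-trans (s≤s (≤-reflexive (toℕ-↑ˡ i g))) (≤-trans (toℕ<n i) (≤-trans (m≤m+n g (toℕ j)) (≤-reflexive (symm (toℕ-↑ʳ g j))))))
      -- Two vertices on the same side are not adjacent, so the path has an interior vertex, and the
      -- first one is on the other side.
      firstVertex : ∀ {x y} p → side x ≡ s → side y ≡ s → Chain bipartite (x ∷ p ++ [ y ]) → ∃[ v ] v ∈ p × s xor side v ≡ true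
      firstVertex {x} {y} [] sx sy (e , _) = ⊥-elim (false≢true (trans (symm (xor-same s)) (trans (cong₂ _xor_ (symm sx) (symm sy)) e)))
      firstVertex (v ∷ p) sx sy (e , _) = v , here refl , trans (cong (_xor side v) (symm sx)) e
      at-pair : ∀ i j → ∃[ v ] v ∈ path S (lo i) (hi j) × s xor side v ≡ true
      at-pair i j = firstVertex (path S (lo i) (hi j)) (c _) (c _) (isPath S (lo i) (hi j) (lo<hi i j))
      row col : Fin (g * g) → Fin g
      row e = proj₁ (remQuot {g} g e)
      col e = proj₂ (remQuot {g} g e)
      hit : Fin (g * g) → Fin (r + r)
      hit e = proj₁ (at-pair (row e) (col e))
      hit-side : ∀ e → s xor side (hit e) ≡ true
      hit-side e = proj₂ (proj₂ (at-pair (row e) (col e)))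
      opposite-same : ∀ {u v} → s xor side u ≡ true → s xor side v ≡ true → side u ≡ side v
      opposite-same {u} {v} = go s (side u) (side v)
        where
        go : ∀ s a b → s xor a ≡ true → s xor b ≡ true → a ≡ b
        go true false false _ _ = refl
        go false true true _ _ = refl
      σ-injective : ∀ {i j} → σ i ≡ σ j → i ≡ j
      σ-injective {i} {j} eq with <-cmp (toℕ i) (toℕ j)
      ... | tri< lt _ _ = ⊥-elim (<-irrefl (cong toℕ eq) (m i j lt))
      ... | tri≈ _ e _ = toℕ-injective e
      ... | tri> _ _ gt = ⊥-elim (<-irrefl (cong toℕ (symm eq)) (m j i gt))
      hit-injective : ∀ e e' → hit e ≡ hit e' → e ≡ e'
      hit-injective e e' eq = trans (symm (combine-remQuot {g} g e)) (trans (go (lo (row e) ≟ lo (row e')) (hi (col e) ≟ hi (col e'))) (combine-remQuot {g} g e'))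
        where
        Same : Set
        Same = combine (row e) (col e) ≡ combine (row e') (col e')
        clash : ¬ ((lo (row e) ≡ lo (row e')) × (hi (col e) ≡ hi (col e'))) → Same
        clash ne = ⊥-elim (disjoint S (lo (row e)) (hi (col e)) (lo (row e')) (hi (col e')) (hit e) (lo<hi _ _) (lo<hi _ _) ne
          (proj₁ (proj₂ (at-pair (row e) (col e)))) (subst (_∈ path S (lo (row e')) (hi (col e'))) (symm eq) (proj₁ (proj₂ (at-pair (row e') (col e'))))))
        go : Dec (lo (row e) ≡ lo (row e')) → Dec (hi (col e) ≡ hi (col e')) → Same
        go (yes p) (yes q) = cong₂ combine (Data.Fin.Properties.↑ˡ-injective g _ _ (σ-injective p)) (Data.Fin.Properties.↑ʳ-injective g _ _ (σ-injective q))
        go (no ¬p) _ = clash (λ (p , _) → ¬p p)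
        go (yes _) (no ¬q) = clash (λ (_ , q) → ¬q q)

-- Rational inequalities and logarithms.

positive-shape : ∀ {ε} → 0ℚᵘ <ᵘ ε → ∃[ a ] ∃[ d ] ε ≡ mkℚᵘ (ℤ.+ suc a) d
positive-shape {mkℚᵘ (ℤ.+ suc a) d} _ = a , d , refl
positive-shape {mkℚᵘ (ℤ.+ zero) d} (*<* (+<+ ()))
positive-shape {mkℚᵘ (ℤ.-[1+ a ]) d} (*<* ())

-- Of ε only ε ≥ 1/(d + 1) matters, that is 1 + ε ≥ (d + 2)/(d + 1).
belowScaled : ∀ S m N D a d → suc d * S * suc D < suc (suc d) * N * suc m →
              mkℚᵘ (ℤ.+ S) m <ᵘ (1ℚᵘ +ᵘ mkℚᵘ (ℤ.+ suc a) d) *ᵘ mkℚᵘ (ℤ.+ N) D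
belowScaled S m N D a d lt = *<* (subst₂ ℤ._<_ (pos-* S (1 * suc d * suc D))
  (trans (pos-* (X * N) (suc m)) (cong (ℤ._* ℤ.+ suc m) (pos-* X N))) (+<+ (≤-trans (≤-trans (s≤s (≤-reflexive (ring S d D))) lt) (*-monoˡ-≤ (suc m) (*-monoˡ-≤ N X-large)))))
  where
  X : ℕ
  X = 1 * suc d + suc a * 1
  X-large : suc (suc d) ≤ X
  X-large = linear a (z≤n {0}) (ringX a d)
    where
    ringX : ∀ a d → suc (suc d) + 0 + a ≡ 1 * suc d + suc a * 1 + 0
    ringX a d = solve (a ∷ d ∷ [])
  ring : ∀ S d D → S * (1 * suc d * suc D) ≡ suc d * S * suc D
  ring S d D = solve (S ∷ d ∷ D ∷ [])

avgDeg-≥ : ∀ {m} (H : Graph m) N D → 0 < m → N * m ≤ degreeSum H * suc D → mkℚᵘ (ℤ.+ N) D ≤ᵘ avgDeg H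
avgDeg-≥ {suc m} H N D _ le = *≤* (subst₂ ℤ._≤_ (pos-* N (suc m)) (pos-* (degreeSum H) (suc D)) (+≤+ le))

n<2^[1+log₂n] : ∀ n → n < 2 ^ suc ⌊log₂ n ⌋
n<2^[1+log₂n] n with n <? 2 ^ suc ⌊log₂ n ⌋
... | yes lt = lt
... | no ¬lt = ⊥-elim (1+n≰n (≤-trans (≤-reflexive (symm (⌊log₂[2^n]⌋≡n (suc ⌊log₂ n ⌋)))) (⌊log₂⌋-mono-≤ (≮⇒≥ ¬lt))))

n²<2^ : ∀ n → n * n < 2 ^ (2 * suc ⌊log₂ n ⌋)
n²<2^ n = <-≤-trans (*-mono-< (n<2^[1+log₂n] n) (n<2^[1+log₂n] n)) (≤-reflexive (trans (symm (^-distribˡ-+-* 2 l l)) (cong (2 ^_) (double l))))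
  where
  l : ℕ
  l = suc ⌊log₂ n ⌋
  double : ∀ l → l + l ≡ 2 * l
  double l = solve (l ∷ [])

affine : ℕ → ℕ → ℕ → ℕ
affine t u v = t + t * (t * (u + v * 4))

affine-≤ : ∀ t u v {l L} → 1 ≤ l → L ≤ 4 * l → t + t * (t * (u + v * L)) ≤ affine t u v * l
affine-≤ t u v {suc l} {L} _ L≤ = ≤-trans (+-monoʳ-≤ t (*-monoʳ-≤ t (*-monoʳ-≤ t (+-monoʳ-≤ u (*-monoʳ-≤ v L≤)))))
  (linear (t * l + t * (t * (u * l))) (z≤n {0}) (ring t u v l))
  where
  ring : ∀ t u v l → t + t * (t * (u + v * (4 * suc l))) + 0 + (t * l + t * (t * (u * l))) ≡ (t + t * (t * (u + v * 4))) * suc l + 0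
  ring t u v l = solve (t ∷ u ∷ v ∷ l ∷ [])

-- Choice of the constants and conclusion.

-- With ε ≥ 1/k, every graph of density at least (4k+1)/Q times that of G is forced to
-- contain a subdivision; the thresholds (4k+i)/Q, i ≤ 3, absorb the successive losses.
module Main (a d : ℕ) where

  ε : ℚᵘ
  ε = mkℚᵘ (ℤ.+ suc a) d

  k Q t₀ : ℕ
  k = suc d
  Q = 4 * k + 3 + 2
  t₀ = 4 * (43 * Q + 1)

  -- The amount of superlinearity needed from s(t): 6 t Q arcs per vertex pay for the boundaries of
  -- peeled sets in `γ≤`, and exceed the 2 t Q wanted by `splitDegree`.
  rate : ℕ → ℕ
  rate t = suc (6 * t * Q)

  quarter : ∀ t → ∃[ g ] 4 * g ≤ t × t ≤ 4 * g + 3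
  quarter zero = 0 , z≤n , z≤n
  quarter (suc t) with quarter t
  ... | g , lo , hi with t <? 4 * g + 3
  ...   | yes lt = g , m≤n⇒m≤1+n lo , lt
  ...   | no ¬lt = suc g , ≤-trans (≤-reflexive (ring g)) (s≤s (≮⇒≥ ¬lt)) , ≤-trans (s≤s hi) (≤-trans (≤-reflexive (symm (ring g))) (m≤m+n _ 3))
    where
    ring : ∀ g → 4 * suc g ≡ suc (4 * g + 3)
    ring g = solve (g ∷ [])

  -- The complete bipartite graph with r = `rate t` is a counterexample. From t ≤ 4g + 3 and g ≥ 43Q
  -- + 1 one gets r ≤ 24Qg + 18Q + 1 ≤ 43Qg < g², against `noSubdivision`.
  noForce : ∀ t → t₀ ≤ t → Forces t (mkℚᵘ (ℤ.+ rate t) 0) → ⊥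
  noForce t t₀≤t forces = from (quarter t)
    where
    r : ℕ
    r = rate t
    open CompleteBipartite r
    sub : Subdivision t bipartite
    sub = forces (r + r) bipartite (avgDeg-≥ bipartite r 0 z<s (≤-trans (≤-trans (≤-reflexive (*-comm r (r + r))) bipartite-degreeSum) (≤-reflexive (symm (*-identityʳ _)))))
    arith : ∀ Q g t → 1 ≤ Q → 4 * (43 * Q + 1) ≤ t → t ≤ 4 * g + 3 → g * g ≤ suc (6 * t * Q) → ⊥
    arith Q g t h₀ h₁ h₂ h₃ = big (43 * Q + 1 ≤? g)
      where
      big : Dec (43 * Q + 1 ≤ g) → ⊥
      big (no small) = 1+n≰n {0} (linear 0 (+-mono-≤ (+-mono-≤ h₁ h₂) (*-monoʳ-≤ 4 (≰⇒> small))) (ring Q g t))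
        where
        ring : ∀ Q g t → 1 + (t + (4 * g + 3) + 4 * (43 * Q + 1)) + 0 ≡ 0 + (4 * (43 * Q + 1) + t + 4 * suc g)
        ring Q g t = solve (Q ∷ g ∷ t ∷ [])
      big (yes le) with m≤n⇒∃[o]m+o≡n le
      ... | o , refl = 1+n≰n {0} (linear (817 * Q * Q + 62 * Q * o + o * o + 43 * Q + 2 * o) (+-mono-≤ h₀ (+-mono-≤ h₃ (*-monoʳ-≤ (6 * Q) h₂))) (ring Q o t))
        where
        ring : ∀ Q o t → 1 + (Q + (suc (6 * t * Q) + 6 * Q * (4 * (43 * Q + 1 + o) + 3))) + (817 * Q * Q + 62 * Q * o + o * o + 43 * Q + 2 * o)
               ≡ 0 + (1 + ((43 * Q + 1 + o) * (43 * Q + 1 + o) + 6 * Q * t))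
        ring Q o t = solve (Q ∷ o ∷ t ∷ [])
    from : ∃[ g ] 4 * g ≤ t × t ≤ 4 * g + 3 → ⊥
    from (g , lo , hi) = arith Q g t (≤-trans (s≤s z≤n) (m≤n+m 2 (4 * k + 3))) t₀≤t hi (noSubdivision g lo sub)

  module At (t : ℕ) (t₀≤t : t₀ ≤ t) where

    τ Δ s' x' K : ℕ
    τ = threshold t (t * t)
    Δ = Q * (2 * (τ * suc τ))
    -- The t² rounds may spend the factor (4k + 3)/(4k + 2). With s = t² Q + 1 the total slack (s +
    -- t²)/s stays below it, and x = s + t² is the largest value met.
    s' = t * t * Q
    x' = t * t * Q + t * t

    fits : suc s' + t * t ≤ suc x'
    fits = ≤-refl

    open BoundedDegree t s' x' Δ fits using (c; boundedDegree) renaming (size to boundedSize; K to boundedK)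
    K = boundedK

    C : ℕ
    C = affine t 7 4 + (affine t (3 + 2 * c) (6 * suc x') + affine t K 0)

    module _ (m : ℕ) (G : Graph (suc m)) (large : AtLeastTimesS t (1ℚᵘ +ᵘ ε) (avgDeg G)) where

      n S l L : ℕ
      n = suc m
      S = total G
      l = ⌊log₂ n ⌋
      L = 2 * suc l

      degreeSum≡S : degreeSum G ≡ S
      degreeSum≡S = degreeSum-∑∑ G

      forced : ∀ N D → k * S * suc D < suc k * N * n → Forces t (mkℚᵘ (ℤ.+ N) D)
      forced N D lt = large (mkℚᵘ (ℤ.+ N) D) (subst (λ s → mkℚᵘ (ℤ.+ s) m <ᵘ (1ℚᵘ +ᵘ ε) *ᵘ mkℚᵘ (ℤ.+ N) D) (symm degreeSum≡S) (belowScaled S m N D a d lt))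

      -- If d(G) were below `rate t`, the hypothesis on `G` would make `rate t` forcing, which
      -- `noForce` excludes.
      rate≤ : rate t * n ≤ S
      rate≤ with rate t * n ≤? S
      ... | yes le = le
      ... | no ¬le = ⊥-elim (noForce t t₀≤t (forced (rate t) 0 (arith k S (rate t) n (≰⇒> ¬le))))
        where
        arith : ∀ k S r n → S < r * n → k * S * 1 < suc k * r * n
        arith k S r n lt = linear (k + S) (*-monoʳ-≤ (suc k) lt) (ring k S r n)
          where
          ring : ∀ k S r n → suc (k * S * 1) + suc k * (r * n) + (k + S) ≡ suc k * r * n + suc k * suc S
          ring k S r n = solve (k ∷ S ∷ r ∷ n ∷ [])

      1≤t : 1 ≤ t
      1≤t = ≤-trans (≤-trans (m≤n+m 1 (43 * Q)) (m≤m+n _ (3 * (43 * Q + 1)))) t₀≤t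

      -- A multiple of `l` can absorb additive constants only if n ≥ 2; this follows from 2 n ≤
      -- `rate t` n ≤ S ≤ n².
      1≤l : 1 ≤ l
      1≤l = ⌊log₂⌋-mono-≤ {2} {n} (*-cancelʳ-≤ 2 n n (≤-trans (*-monoˡ-≤ n (s≤s (*-mono-≤ (*-mono-≤ {1} {6} (s≤s z≤n) 1≤t) 1≤Q))) (≤-trans rate≤ (∑∑-𝟙≤ (adj G)))))
        where
        1≤Q : 1 ≤ Q
        1≤Q = ≤-trans (s≤s z≤n) (m≤n+m 2 (4 * k + 3))

      L≤4l : L ≤ 4 * l
      L≤4l = linear 0 (*-monoʳ-≤ 2 1≤l) (ring l)
        where
        ring : ∀ l → 2 * suc l + 2 * l + 0 ≡ 4 * l + 2 * 1
        ring l = solve (l ∷ [])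

      n²<2^L : n * n < 2 ^ L
      n²<2^L = n²<2^ n

      open SplitDegree G L n²<2^L t Δ using (Low; low; Low⊆G; Low-degree; splitDegree) renaming (size to splitSize)

      Goal : Set
      Goal = HasSubdivisionWithin t G (C * l)

      within : ∀ {N M} → N ≤ M → HasSubdivisionWithin t G N → HasSubdivisionWithin t G M
      within le (sub , le') = sub , ≤-trans le' le

      C₁≤C : affine t 7 4 * l ≤ C * l
      C₁≤C = *-monoˡ-≤ l (m≤m+n (affine t 7 4) _)

      C₂≤C : affine t (3 + 2 * c) (6 * suc x') * l ≤ C * l
      C₂≤C = *-monoˡ-≤ l (≤-trans (m≤m+n (affine t (3 + 2 * c) (6 * suc x')) (affine t K 0)) (m≤n+m _ (affine t 7 4)))

      C₃≤C : affine t K 0 * l ≤ C * l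
      C₃≤C = *-monoˡ-≤ l (≤-trans (m≤n+m (affine t K 0) (affine t (3 + 2 * c) (6 * suc x'))) (m≤n+m _ (affine t 7 4)))

      splitSize≤ : splitSize ≤ C * l
      splitSize≤ = ≤-trans (≤-trans (≤-reflexive (ring t L)) (affine-≤ t 7 4 1≤l L≤4l)) C₁≤C
        where
        ring : ∀ t L → t + t * (t * suc (suc (suc (((1 * L + 1) + (1 * L + 1)) + ((1 * L + 1) + (1 * L + 1)))))) ≡ t + t * (t * (7 + 4 * L))
        ring t L = solve (t ∷ L ∷ [])

      boundedSize≤ : boundedSize L ≤ C * l
      boundedSize≤ = ≤-trans (≤-trans (≤-reflexive (ring t c x' L)) (affine-≤ t (3 + 2 * c) (6 * suc x') 1≤l L≤4l)) C₂≤C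
        where
        ring : ∀ t c x' L → t + t * (t * suc (c + (((3 * suc x' * L + 1) + (3 * suc x' * L + 1)) + c))) ≡ t + t * (t * (3 + 2 * c + 6 * suc x' * L))
        ring t c x' L = solve (t ∷ c ∷ x' ∷ L ∷ [])

      α β γ : ℕ
      α = (4 * k + 2) * S
      β = Q * n
      γ = (4 * k + 1) * S

      γ≤ : γ + 2 * (3 * t) * β ≤ α
      γ≤ = arith k S t Q n rate≤
        where
        arith : ∀ k S t Q n → suc (6 * t * Q) * n ≤ S → (4 * k + 1) * S + 2 * (3 * t) * (Q * n) ≤ (4 * k + 2) * S
        arith k S t Q n h = linear n h (ring k S t Q n)
          where
          ring : ∀ k S t Q n → (4 * k + 1) * S + 2 * (3 * t) * (Q * n) + S + n ≡ (4 * k + 2) * S + suc (6 * t * Q) * n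
          ring k S t Q n = solve (k ∷ S ∷ t ∷ Q ∷ n ∷ [])

      fromSmallDense : SmallDense Low low γ β K → Goal
      fromSmallDense (A , _ , small , dense) = within size≤ (liftInduced G e (forced γ (pred β) enough (card) (induced G e) (avgDeg-≥ (induced G e) γ (pred β) nonempty (<⇒≤ (<-≤-trans (subst (λ c → γ * c < β * arcs Low A) (symm (card-# G e)) dense) denser)))))
        where
        e : Enumeration A
        e = enumerate A
        open Enumeration e using (card)
        size≤ : t + t * (t * # A) ≤ C * l
        size≤ = ≤-trans (≤-trans (+-monoʳ-≤ t (*-monoʳ-≤ t (*-monoʳ-≤ t (≤-trans small (≤-reflexive (symm (+-identityʳ K))))))) (affine-≤ t K 0 {L = L} 1≤l L≤4l)) C₃≤C
        -- This fixes Q = 4k + 5: the final density (4k + 1)/Q must exceed k/(k + 1), and (k + 1)(4k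
        -- + 1) = k(4k + 5) + 1.
        enough : k * S * suc (pred β) < suc k * γ * n
        enough = arith k S (≤-trans (*-mono-≤ {1} {rate t} {1} {n} (s≤s z≤n) (s≤s z≤n)) rate≤)
          where
          arith : ∀ k S → 1 ≤ S → k * S * ((4 * k + 3 + 2) * suc m) < suc k * ((4 * k + 1) * S) * suc m
          arith k S h = linear (m * S) h (ring k S m)
            where
            ring : ∀ k S m → suc (k * S * ((4 * k + 3 + 2) * suc m)) + S + m * S ≡ suc k * ((4 * k + 1) * S) * suc m + 1
            ring k S m = solve (k ∷ S ∷ m ∷ [])
        nonempty : 0 < card
        nonempty = subst (0 <_) (symm (card-# G e)) (let v , q = arcs⇒vertex Low A (0<factorʳ β (≤-<-trans z≤n dense)) in ∃⇒0<# v q)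
        denser : β * arcs Low A ≤ degreeSum (induced G e) * suc (pred β)
        denser = ≤-trans (*-monoʳ-≤ β (≤-trans (∑∑-mono (λ u v → mono (A u ∧ A v) (⇒𝟙≤ (Low⊆G u v)))) (≤-reflexive (symm (degreeSum-induced G e))))) (≤-reflexive (*-comm β _))
          where
          mono : ∀ b {x y} → x ≤ y → on b x ≤ on b y
          mono true le = le
          mono false _ = z≤n

      fromLow : (4 * k + 3) * S * # low < Q * n * arcs Low low → Goal
      fromLow dense = conclude (boundedDegree Low L n²<2^L Low-degree α β γ γ≤ low (<-≤-trans (arith k s' (t * t) S (# low) (β * arcs Low low) T≤ dense) (≤-reflexive (symm (*-assoc (suc s') β (arcs Low low))))))
        where
        T≤ : t * t * (4 * k + 2) ≤ s'
        T≤ = *-monoʳ-≤ (t * t) (≤-trans (+-monoʳ-≤ (4 * k) (n≤1+n 2)) (m≤m+n (4 * k + 3) 2))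
        arith : ∀ k s' T S c e → T * (4 * k + 2) ≤ s' → (4 * k + 3) * S * c < e → (suc s' + T) * ((4 * k + 2) * S) * c < suc s' * e
        arith k s' T S c e h lt = linear (s' + S * c) (+-mono-≤ (*-monoˡ-≤ (S * c) h) (*-monoʳ-≤ (suc s') lt)) (ring k s' T S c e)
          where
          ring : ∀ k s' T S c e → suc ((suc s' + T) * ((4 * k + 2) * S) * c) + (s' * (S * c) + suc s' * e) + (s' + S * c)
                 ≡ suc s' * e + (T * (4 * k + 2) * (S * c) + suc s' * suc ((4 * k + 3) * S * c))
          ring k s' T S c e = solve (k ∷ s' ∷ T ∷ S ∷ c ∷ e ∷ [])
        conclude : SmallDense Low low γ β K ⊎ HasSubdivisionWithin t Low (boundedSize L) → Goal
        conclude (inj₁ small) = fromSmallDense small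
        conclude (inj₂ sub) = within boundedSize≤ (subgraph {G = G} {Low} Low⊆G sub)

      found : Goal
      found = conclude (splitDegree (4 * k + 3) (s≤s z≤n) (≤-trans (*-monoˡ-≤ n (arith Q t)) rate≤) refl)
        where
        arith : ∀ Q t → Q * (2 * t) + 1 ≤ suc (6 * t * Q)
        arith Q t = linear (4 * t * Q) (z≤n {0}) (ring Q t)
          where
          ring : ∀ Q t → Q * (2 * t) + 1 + 0 + 4 * t * Q ≡ suc (6 * t * Q) + 0
          ring Q t = solve (Q ∷ t ∷ [])
        conclude : HasSubdivisionWithin t G splitSize ⊎ (4 * k + 3) * S * # low < Q * n * arcs Low low → Goal
        conclude (inj₁ sub) = within splitSize≤ sub
        conclude (inj₂ dense) = fromLow dense

    logSubdivision : ∀ n (G : Graph n) → AtLeastTimesS t (1ℚᵘ +ᵘ ε) (avgDeg G) → HasSubdivisionWithin t G (C * ⌊log₂ n ⌋)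
    logSubdivision (suc m) G large = found m G large
    -- The empty graph has average degree 0, so the hypothesis would make every positive rational
    -- forcing, `rate t` included.
    logSubdivision zero G large = ⊥-elim (noForce t t₀≤t (large (mkℚᵘ (ℤ.+ rate t) 0) (belowScaled 0 0 (rate t) 0 a d positive)))
      where
      positive : suc d * 0 * 1 < suc (suc d) * rate t * 1
      positive = ≤-trans (s≤s (≤-reflexive (trans (*-identityʳ _) (*-zeroʳ (suc d))))) (≤-trans (*-mono-≤ {1} {suc (suc d)} {1} {rate t} (s≤s z≤n) (s≤s z≤n)) (≤-reflexive (symm (*-identityʳ _))))

-- `⌊log₂ n⌋` is at most log n / log 2, so the passage to the natural logarithm only changes the
-- constant.
theorem1p2 : ∀ (ε : ℚᵘ) → 0ℚᵘ <ᵘ ε →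
    ∃[ t₀ ] ∀ (t : ℕ) → t₀ ≤ t →
      ∃[ C ] ∀ (n : ℕ) (G : Graph n) →
        AtLeastTimesS t (1ℚᵘ +ᵘ ε) (avgDeg G) →
        HasSubdivisionWithin t G (C * ⌊log₂ n ⌋)
theorem1p2 ε 0<ε with positive-shape 0<ε
... | a , d , refl = Main.t₀ a d , λ t t₀≤t → Main.At.C a d t t₀≤t , Main.At.logSubdivision a d t t₀≤t
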